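{- For positive integers $p\le q$ with $\gcd(p,q)=1$, \[ m^{L,\circ}_{\frac pq}=m^{R,\circ}_{\frac pq}=6\,m_{\frac pq}-1. \]
   Context: Generalized Markov numbers. Start from the three positions with labels $\tfrac01,\tfrac10,\tfrac{ -1}{1}$, each carrying the number $1$. Mutating a position with label $\tfrac ef$ and number $z$, where the other two positions have labels $\tfrac ab,\tfrac cd$ and numbers $x,y$, does two things. It replaces the label by $\tfrac{a+c}{b+d}$, or by $\tfrac{c-a}{d-b}$ if $\tfrac ef=\tfrac{a+c}{b+d}$. It replaces $z$ by $(x^2+xy+y^2)/z$. Consider mutation sequences that start with the position labelled $\tfrac{ -1}1$, then the one labelled $\tfrac10$, and never mutate the same position twice in a row. Every reduced $\tfrac pq\in(0,1]$ occurs as a label, always carrying the same number $m_{\frac pq}$ (the generalized Markov number indexed by $\tfrac pq$; e.g. $m_{\frac11}=3$, $m_{\frac12}=13$). These triples are exactly the positive integer solutions of $x^2+y^2+z^2+xy+xz+yz=6xyz$. Orbifold. $\mathcal O_3$ is a sphere with one puncture and three orbifold points of order $3$, with initial triangulation $T_0$ of three pending arcs $\tau_{\frac01},\tau_{\frac10},\tau_{\frac{ -1}1}$ at the puncture. Curves on $\mathcal O_3$ are drawn in the plane tiled by the lattice of unit segments on the lines $y=c$, $x=c$, $y=-x+c$ ($c\in\mathbb Z$). Lattice segments of slope $0$, $\infty$, $-1$ represent $\tau_{\frac01}$, $\tau_{\frac10}$, $\tau_{\frac{ -1}1}$ respectively. Closed curves. Take the segment from $(0,0)$ to $(q,p)$.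 Move its endpoints to $(\epsilon,\epsilon)$ and $(q+\epsilon,p+\epsilon)$ for small $\epsilon>0$, nudging the path slightly to the left (resp. right) so that it avoids the lattice point $(q,p)$. Then identify the endpoints. This gives a simple closed curve $\gamma^{L,\circ}_{\frac pq}$ (resp. $\gamma^{R,\circ}_{\frac pq}$) on $\mathcal O_3$. Its band graph with respect to $T_0$ is formed from the snake graph of its crossing sequence by gluing an edge of the first tile to an edge of the last tile (standard Musiker–Schiffler–Williams band graph construction, in the orbifold setting of Banaian–Kelley). $m^{L,\circ}_{\frac pq}$ (resp. $m^{R,\circ}_{\frac pq}$) is the number of good matchings of this band graph. Good matchings. A good matching of a band graph with glued edge $e=e'$ is a perfect matching of the underlying snake graph that contains $e$ or $e'$. -}

module Defs where

open import Data.Nat as ℕ using (ℕ; zero; suc; _+_; _*_; _∸_; _≡ᵇ_; _<ᵇ_)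
open import Data.Nat.DivMod using (_/_; _%_)
open import Data.Integer as ℤ using (ℤ; +_)
import Data.Integer.Properties as ℤP
open import Data.Bool using (Bool; true; false; _∧_; _∨_; not; if_then_else_)
open import Data.Product using (Σ; Σ-syntax; _×_; _,_; proj₁; proj₂)
open import Data.List using (List; []; _∷_; _++_; length; map; concatMap; upTo; filterᵇ)
open import Data.Bool.ListAction using (any; all)
open import Data.Fin as Fin using (Fin; zero; suc)
open import Relation.Nullary.Decidable using (⌊_⌋)
open import Relation.Binary.PropositionalEquality using (_≡_; _≢_)
open import Data.List.Relation.Unary.Linked using (Linked)

-- a label e/f is stored as the pair (e , f) of integers
Label : Set
Label = ℤ × ℤ

record Position : Set where
  constructor ⟨_,_⟩
  field
    label : Label
    number : ℕ
open Position public

State : Set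
State = Fin 3 → Position

initState : State
initState zero = ⟨ (+ 0 , + 1) , 1 ⟩
initState (suc zero) = ⟨ (+ 1 , + 0) , 1 ⟩
initState (suc (suc zero)) = ⟨ (ℤ.-1ℤ , + 1) , 1 ⟩

pos01 pos10 pos-11 : Fin 3
pos01 = zero
pos10 = suc zero
pos-11 = suc (suc zero)

other₁ other₂ : Fin 3 → Fin 3
other₁ zero = suc zero
other₁ (suc zero) = zero
other₁ (suc (suc zero)) = zero
other₂ zero = suc (suc zero)
other₂ (suc zero) = suc (suc zero)
other₂ (suc (suc zero)) = suc zero

newLabel : Label → Label → Label → Label
newLabel (a , b) (c , d) (e , f) =
  if ⌊ e ℤ.* (b ℤ.+ d) ℤP.≟ f ℤ.* (a ℤ.+ c) ⌋
  then (c ℤ.- a , d ℤ.- b)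
  else (a ℤ.+ c , b ℤ.+ d)

update : State → Fin 3 → Position → State
update s i v j = if ⌊ i Fin.≟ j ⌋ then v else s j

exch : ℕ → ℕ → ℕ
exch x y = x * x + x * y + y * y

-- mutation at position i : the new number z' is (x²+xy+y²)/z,
-- expressed without division as  z' * z = x²+xy+y²
data Mutation (s : State) (i : Fin 3) : State → Set where
  mutate : (z' : ℕ) →
           z' * number (s i) ≡ exch (number (s (other₁ i))) (number (s (other₂ i))) →
           Mutation s i
             (update s i ⟨ newLabel (label (s (other₁ i))) (label (s (other₂ i))) (label (s i)) , z' ⟩)

data Run : State → List (Fin 3) → State → Set where
  done : ∀ {s} → Run s [] s
  step : ∀ {s i s′ is s″} → Mutation s i s′ → Run s′ is s″ → Run s (i ∷ is) s″

Admissible : List (Fin 3) → Set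
Admissible is = (Σ[ rest ∈ List (Fin 3) ] is ≡ pos-11 ∷ pos10 ∷ rest) × Linked _≢_ is

LabelIs : Label → ℕ → ℕ → Set
LabelIs (e , f) p q = (e ℤ.* + q ≡ f ℤ.* + p) × (f ≢ + 0)

-- m is the number carried by the label p/q after some admissible sequence
-- (by the paper this number m_{p/q} is well defined)
IsGenMarkov : ℕ → ℕ → ℕ → Set
IsGenMarkov p q m =
  Σ[ is ∈ List (Fin 3) ] Σ[ s ∈ State ] Σ[ i ∈ Fin 3 ]
    Admissible is × Run initState is s × LabelIs (label (s i)) p q × number (s i) ≡ m

-- total versions of division / remainder (only used with nonzero divisors)
_/′_ _%′_ : ℕ → ℕ → ℕ
m /′ zero = 0
m /′ suc n = m / suc n
m %′ zero = m
m %′ suc n = m % suc n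

Pt : Set
Pt = ℤ × ℤ

Seg : Set
Seg = Pt × Pt

pt : ℕ → ℕ → Pt
pt x y = (+ x , + y)

-- segment of slope 0 / ∞ / -1 ↦ τ_{0/1} / τ_{1/0} / τ_{-1/1};
-- the midpoint of a unit segment is (the lift of) the orbifold point of its pending arc

-- L : the curve is pushed off slightly to the left of the line through (0,0) and (q,p)
-- R : pushed off slightly to the right
data Side : Set where
  L R : Side

-- a crossing: the lattice segment crossed, together with the endpoint of that
-- segment on whose side the curve passes the orbifold point (midpoint) of the segment,
-- i.e. the endpoint nearer to the crossing point
Crossing : Set
Crossing = Seg × Pt

pick : Side → ℕ → ℕ → Pt → Pt → Pt → Pt → Pt
pick s twor n ifLess ifGreater tieL tieR =
  if twor <ᵇ n then ifLess
  else if n <ᵇ twor then ifGreater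
  else (tieSide s)
  where
  tieSide : Side → Pt
  tieSide L = tieL
  tieSide R = tieR

-- crossing with the vertical line x = a (0 < a < q) : at height p a / q
vertCross : Side → ℕ → ℕ → ℕ → Crossing
vertCross s p q a =
  let y = (p * a) /′ q ; r = (p * a) %′ q in
  ((pt a y , pt a (suc y)) , pick s (2 * r) q (pt a y) (pt a (suc y)) (pt a (suc y)) (pt a y))

-- crossing with the horizontal line y = b (0 < b < p) : at abscissa q b / p
horCross : Side → ℕ → ℕ → ℕ → Crossing
horCross s p q b =
  let x = (q * b) /′ p ; r = (q * b) %′ p in
  ((pt x b , pt (suc x) b) , pick s (2 * r) p (pt x b) (pt (suc x) b) (pt x b) (pt (suc x) b))

-- crossing with the line x + y = c (0 < c < p+q) : at abscissa q c / (p+q)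
diagCross : Side → ℕ → ℕ → ℕ → Crossing
diagCross s p q c =
  let x = (q * c) /′ (p + q) ; r = (q * c) %′ (p + q)
      A = pt (suc x) (c ∸ x ∸ 1) ; B = pt x (c ∸ x) in
  ((A , B) , pick s (2 * r) (p + q) B A B A)

-- the crossing (if any) of the segment (0,0)–(q,p) at time t = k / (p q (p+q));
-- every crossing time in (0,1) is of this form, and distinct lines are crossed at distinct times
crossAt : Side → ℕ → ℕ → ℕ → List Crossing
crossAt s p q k =
  if k %′ (p * (p + q)) ≡ᵇ 0 then vertCross s p q (k /′ (p * (p + q))) ∷ []
  else if k %′ (q * (p + q)) ≡ᵇ 0 then horCross s p q (k /′ (q * (p + q))) ∷ []
  else if k %′ (p * q) ≡ᵇ 0 then diagCross s p q (k /′ (p * q)) ∷ []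
  else []

-- the three segments at the lattice point (q,p) crossed when going around it,
-- in order: on the left (W, NW, N) or on the right (S, SE, E)
cornerCross : Side → ℕ → ℕ → List Crossing
cornerCross L p q =
  ((pt (q ∸ 1) p , pt q p) , pt q p) ∷
  ((pt q p , pt (q ∸ 1) (suc p)) , pt q p) ∷
  ((pt q p , pt q (suc p)) , pt q p) ∷ []
cornerCross R p q =
  ((pt q (p ∸ 1) , pt q p) , pt q p) ∷
  ((pt q p , pt (suc q) (p ∸ 1)) , pt q p) ∷
  ((pt q p , pt (suc q) p) , pt q p) ∷ []

-- crossing sequence of γ^{L,∘}_{p/q} / γ^{R,∘}_{p/q} with T₀, over one period,
-- starting just after the lattice point (0,0)
crossingSeq : Side → ℕ → ℕ → List Crossing
crossingSeq s p q =
  concatMap (crossAt s p q) (map suc (upTo (p * q * (p + q) ∸ 1))) ++ cornerCross s p q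

-- translation of a segment by ±(q,p) (deck translation of the period)
shiftSeg : ℤ → ℤ → Seg → Seg
shiftSeg dx dy ((a , b) , (c , d)) = ((a ℤ.+ dx , b ℤ.+ dy) , (c ℤ.+ dx , d ℤ.+ dy))

eqPt : Pt → Pt → Bool
eqPt (a , b) (c , d) = ⌊ a ℤP.≟ c ⌋ ∧ ⌊ b ℤP.≟ d ⌋

_∈ˢ_ : Pt → Seg → Bool
v ∈ˢ (x , y) = eqPt v x ∨ eqPt v y

withNeighbours : Seg → List Crossing → Seg → List (Seg × Crossing × Seg)
withNeighbours pr [] nx = []
withNeighbours pr (c ∷ []) nx = (pr , c , nx) ∷ []
withNeighbours pr (c ∷ c′ ∷ cs) nx = (pr , c , proj₁ c′) ∷ withNeighbours (proj₁ c) (c′ ∷ cs) nx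

headSeg lastSeg : List Crossing → Seg
headSeg [] = (pt 0 0 , pt 0 0)
headSeg (c ∷ _) = proj₁ c
lastSeg [] = (pt 0 0 , pt 0 0)
lastSeg (c ∷ []) = proj₁ c
lastSeg (_ ∷ c′ ∷ cs) = lastSeg (c′ ∷ cs)

cyclicCrossings : Side → ℕ → ℕ → List (Seg × Crossing × Seg)
cyclicCrossings s p q =
  let cs = crossingSeq s p q in
  withNeighbours (shiftSeg (ℤ.- + q) (ℤ.- + p) (lastSeg cs)) cs (shiftSeg (+ q) (+ p) (headSeg cs))

data Dir : Set where
  E N : Dir

flipDir : Dir → Dir
flipDir E = N
flipDir N = E

turnIf : Bool → Dir → Dir
turnIf b d = if b then flipDir d else d

-- Each crossing of a pending arc (orbifold point of order 3) contributes two square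
-- tiles (the Banaian–Kelley tile).  The tiles are glued following the
-- Musiker–Schiffler–Williams rule: the snake turns at a tile exactly when the curve
-- goes on around the same vertex as at the previous tile (fan).  Concretely, for a
-- crossing of segment e passing its orbifold point on the side of endpoint v, with
-- neighbouring crossed segments e₋ and e₊: the first tile turns iff v ∈ e₋, the
-- second tile turns iff v ∈ e₊.  Output: the list of gluing directions between
-- consecutive tiles (the last one being the direction towards the copy of the first tile).
tileSteps : Dir → List (Seg × Crossing × Seg) → List Dir
tileSteps a [] = []
tileSteps a ((pr , (e , v) , nx) ∷ ts) =
  let b = turnIf (v ∈ˢ pr) a
      c = turnIf (v ∈ˢ nx) b
  in b ∷ c ∷ tileSteps c ts

-- snake graph drawn in ℕ² : tiles are unit squares given by their south-west corner
SPt : Set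
SPt = ℕ × ℕ

SEdge : Set
SEdge = SPt × SPt

move : SPt → Dir → SPt
move (x , y) E = (suc x , y)
move (x , y) N = (x , suc y)

sideEdge : SPt → Dir → SEdge
sideEdge (x , y) E = ((suc x , y) , (suc x , suc y))
sideEdge (x , y) N = ((x , suc y) , (suc x , suc y))

-- tiles (south-west corners) placed along the steps, the last step giving the
-- glued edge e′ of the last tile (where the copy of the first tile would be attached)
placeTiles : SPt → List Dir → List SPt × SEdge
placeTiles x [] = ([] , (x , x))
placeTiles x (d ∷ []) = (x ∷ [] , sideEdge x d)
placeTiles x (d ∷ d′ ∷ ds) =
  let r = placeTiles (move x d) (d′ ∷ ds) in (x ∷ proj₁ r , proj₂ r)

tileEdges : SPt → List SEdge
tileEdges (x , y) =
  ((x , y) , (suc x , y)) ∷ ((x , suc y) , (suc x , suc y)) ∷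
  ((x , y) , (x , suc y)) ∷ ((suc x , y) , (suc x , suc y)) ∷ []

eqSPt : SPt → SPt → Bool
eqSPt (a , b) (c , d) = (a ≡ᵇ c) ∧ (b ≡ᵇ d)

eqSEdge : SEdge → SEdge → Bool
eqSEdge (u , v) (u′ , v′) = eqSPt u u′ ∧ eqSPt v v′

dedupE : List SEdge → List SEdge
dedupE [] = []
dedupE (e ∷ es) = if any (eqSEdge e) es then dedupE es else e ∷ dedupE es

dedupV : List SPt → List SPt
dedupV [] = []
dedupV (v ∷ vs) = if any (eqSPt v) vs then dedupV vs else v ∷ dedupV vs

record BandGraph : Set where
  field
    edges : List SEdge
    glue : SEdge
    glue′ : SEdge
open BandGraph public

-- the band graph of a list of tile-gluing directions, the first tile at (0,0) being
-- entered from the West (its glued edge e is its west side)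
bandFromSteps : List Dir → BandGraph
bandFromSteps ds =
  let r = placeTiles (0 , 0) ds in
  record { edges = dedupE (concatMap tileEdges (proj₁ r))
         ; glue = ((0 , 0) , (0 , 1))
         ; glue′ = proj₂ r }

bandGraph : Side → ℕ → ℕ → BandGraph
bandGraph s p q = bandFromSteps (tileSteps E (cyclicCrossings s p q))

vertices : List SEdge → List SPt
vertices es = dedupV (concatMap (λ e → proj₁ e ∷ proj₂ e ∷ []) es)

_∈ᵉ_ : SPt → SEdge → Bool
v ∈ᵉ (a , b) = eqSPt v a ∨ eqSPt v b

subsets : {A : Set} → List A → List (List A)
subsets [] = [] ∷ []
subsets (x ∷ xs) = let r = subsets xs in r ++ map (x ∷_) r

isPerfectMatching : List SEdge → List SEdge → Bool
isPerfectMatching G M = all (λ v → length (filterᵇ (v ∈ᵉ_) M) ≡ᵇ 1) (vertices G)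

isGoodMatching : BandGraph → List SEdge → Bool
isGoodMatching B M =
  isPerfectMatching (edges B) M ∧ (any (eqSEdge (glue B)) M ∨ any (eqSEdge (glue′ B)) M)

goodMatchingCount : BandGraph → ℕ
goodMatchingCount B = length (filterᵇ (isGoodMatching B) (subsets (edges B)))

mCirc : Side → ℕ → ℕ → ℕ
mCirc s p q = goodMatchingCount (bandGraph s p q)

{-# OPTIONS --safe #-}
-- In the half-integer lattice the curve is a staircase crossing one line x + y = c/2 per letter, its word being the
-- doubled Christoffel word w w of p/q. Counting good matchings tile by tile turns the count into the trace of a
-- product of 2×2 matrices along this word. Christoffel words of Farey neighbours concatenate, w = w₁ w₂, and the
-- matrices of w₁ and w₂ satisfy relations coming from the orbifold group (three rotations of order 3 and a parabolic
-- element) that persist under concatenation. They give tr(w₁ w₁ w₂) = tr(w₁) tr(w₁ w₂) − tr(w₂) − 3 for the doubled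
-- words, which for tr = 6m − 1 is the Vieta relation of x² + y² + z² + xy + xz + yz = 6xyz, i.e. mutation.
-- Pushing the curve to the other side exchanges the roles of p and q.
module Submission where

open import Defs
open import Data.Nat as ℕ using (ℕ; zero; suc; _+_; _*_; _∸_; _≤_; _<_; z≤n; s≤s; _≡ᵇ_; _<ᵇ_)
import Data.Nat.Properties as ℕP
import Data.Nat.DivMod as DivMod
open import Data.Nat.GCD using (gcd)
open import Data.Nat.Divisibility as Div using (_∣_; divides)
open import Data.Nat.Coprimality as Coprimality using (Coprime)
import Data.Nat.Tactic.RingSolver as ℕSolver
open import Data.Integer as ℤ using (ℤ; +_; -[1+_])
import Data.Integer.Properties as ℤP
import Data.Integer.Tactic.RingSolver as ℤSolver
open import Data.Bool using (Bool; true; false; _∧_; _∨_; not; _xor_; T; if_then_else_)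
import Data.Bool.Properties as BoolP
open import Data.Bool.ListAction using (any; all)
open import Data.Product using (Σ-syntax; ∃; ∃₂; _×_; _,_; proj₁; proj₂)
open import Data.Sum using (_⊎_; inj₁; inj₂)
open import Data.List using (List; []; _∷_; _++_; length; map; concatMap; filterᵇ; upTo; applyUpTo)
import Data.List.Properties as ListP
open import Data.List.Relation.Unary.All as All using (All; []; _∷_)
import Data.List.Relation.Unary.All.Properties as AllP
open import Data.List.Relation.Binary.Permutation.Propositional as Perm using (_↭_)
open import Data.Empty using (⊥; ⊥-elim)
open import Function using (id)
open import Relation.Nullary using (yes; no)
open import Relation.Binary.PropositionalEquality using (_≡_; _≢_; refl; sym; trans; cong; cong₂; subst; subst₂; module ≡-Reasoning)

-- Matrices

-- In units of half the lattice spacing the period is (2q, 2p), twice a primitive vector, which is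
-- why the word is a square. Half-lattice points fall into four parity classes: the lifts of the
-- puncture and those of the three orbifold points. The matrix of a word depends on the class in
-- which it starts, so a pair of Farey neighbours is recorded by eight matrices, not by two. The
-- obstacle is that the usual trace identity for two matrices A and B produces the trace of A⁻¹B,
-- which is not a word of the family. The order three of `J` removes it: 1 + J + J² = 0, so the
-- identity may be replaced by -J - J² at a junction of two words. In the term with J a commutation
-- relation reorders the words; in the term with J² the half-turn relations cancel all letters and
-- leave J² or `P`. Since tr J² = -1 and tr P = 2, the constant 3 of the recursion is 1 + 2.

record Mat : Set where
  constructor mat
  field m₁₁ m₁₂ m₂₁ m₂₂ : ℤ

infixr 7 _·_
_·_ : Mat → Mat → Mat
mat a b c d · mat a′ b′ c′ d′ =
  mat (a ℤ.* a′ ℤ.+ b ℤ.* c′) (a ℤ.* b′ ℤ.+ b ℤ.* d′) (c ℤ.* a′ ℤ.+ d ℤ.* c′) (c ℤ.* b′ ℤ.+ d ℤ.* d′)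

1ᴹ : Mat
1ᴹ = mat (+ 1) (+ 0) (+ 0) (+ 1)

negᴹ adj : Mat → Mat
negᴹ (mat a b c d) = mat (ℤ.- a) (ℤ.- b) (ℤ.- c) (ℤ.- d)
adj (mat a b c d) = mat d (ℤ.- b) (ℤ.- c) a

tr det : Mat → ℤ
tr (mat a b c d) = a ℤ.+ d
det (mat a b c d) = a ℤ.* d ℤ.+ ℤ.- (b ℤ.* c)

mat-≡ : ∀ {a b c d a′ b′ c′ d′} → a ≡ a′ → b ≡ b′ → c ≡ c′ → d ≡ d′ → mat a b c d ≡ mat a′ b′ c′ d′
mat-≡ refl refl refl refl = refl

·-assoc : ∀ A B C → (A · B) · C ≡ A · (B · C)
·-assoc (mat a b c d) (mat e f g h) (mat i j k l) = mat-≡ (lem a b e f g h i k) (lem a b e f g h j l) (lem c d e f g h i k) (lem c d e f g h j l)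
  where
  lem : ∀ a b e f g h i k →
    (a ℤ.* e ℤ.+ b ℤ.* g) ℤ.* i ℤ.+ (a ℤ.* f ℤ.+ b ℤ.* h) ℤ.* k ≡ a ℤ.* (e ℤ.* i ℤ.+ f ℤ.* k) ℤ.+ b ℤ.* (g ℤ.* i ℤ.+ h ℤ.* k)
  lem = ℤSolver.solve-∀

·-identityˡ : ∀ A → 1ᴹ · A ≡ A
·-identityˡ (mat a b c d) = mat-≡ (lem a c) (lem b d) (lem′ a c) (lem′ b d)
  where
  lem : ∀ a c → + 1 ℤ.* a ℤ.+ + 0 ℤ.* c ≡ a
  lem = ℤSolver.solve-∀
  lem′ : ∀ a c → + 0 ℤ.* a ℤ.+ + 1 ℤ.* c ≡ c
  lem′ = ℤSolver.solve-∀

·-identityʳ : ∀ A → A · 1ᴹ ≡ A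
·-identityʳ (mat a b c d) = mat-≡ (lem a b) (lem′ a b) (lem c d) (lem′ c d)
  where
  lem : ∀ a c → a ℤ.* + 1 ℤ.+ c ℤ.* + 0 ≡ a
  lem = ℤSolver.solve-∀
  lem′ : ∀ a c → a ℤ.* + 0 ℤ.+ c ℤ.* + 1 ≡ c
  lem′ = ℤSolver.solve-∀

neg-·ˡ : ∀ A B → negᴹ A · B ≡ negᴹ (A · B)
neg-·ˡ (mat a b c d) (mat e f g h) = mat-≡ (lem a b e g) (lem a b f h) (lem c d e g) (lem c d f h)
  where
  lem : ∀ a b e g → ℤ.- a ℤ.* e ℤ.+ ℤ.- b ℤ.* g ≡ ℤ.- (a ℤ.* e ℤ.+ b ℤ.* g)
  lem = ℤSolver.solve-∀

neg-·ʳ : ∀ A B → A · negᴹ B ≡ negᴹ (A · B)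
neg-·ʳ (mat a b c d) (mat e f g h) = mat-≡ (lem a b e g) (lem a b f h) (lem c d e g) (lem c d f h)
  where
  lem : ∀ a b e g → a ℤ.* ℤ.- e ℤ.+ b ℤ.* ℤ.- g ≡ ℤ.- (a ℤ.* e ℤ.+ b ℤ.* g)
  lem = ℤSolver.solve-∀

neg-involutive : ∀ A → negᴹ (negᴹ A) ≡ A
neg-involutive (mat a b c d) = mat-≡ (ℤP.neg-involutive a) (ℤP.neg-involutive b) (ℤP.neg-involutive c) (ℤP.neg-involutive d)

tr-neg : ∀ A → tr (negᴹ A) ≡ ℤ.- tr A
tr-neg (mat a _ _ d) = sym (ℤP.neg-distrib-+ a d)

tr-comm : ∀ A B → tr (A · B) ≡ tr (B · A)
tr-comm (mat a b c d) (mat e f g h) = lem a b c d e f g h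
  where
  lem : ∀ a b c d e f g h →
    (a ℤ.* e ℤ.+ b ℤ.* g) ℤ.+ (c ℤ.* f ℤ.+ d ℤ.* h) ≡ (e ℤ.* a ℤ.+ f ℤ.* c) ℤ.+ (g ℤ.* b ℤ.+ h ℤ.* d)
  lem = ℤSolver.solve-∀

det-· : ∀ A B → det (A · B) ≡ det A ℤ.* det B
det-· (mat a b c d) (mat e f g h) = lem a b c d e f g h
  where
  lem : ∀ a b c d e f g h →
    (a ℤ.* e ℤ.+ b ℤ.* g) ℤ.* (c ℤ.* f ℤ.+ d ℤ.* h) ℤ.+ ℤ.- ((a ℤ.* f ℤ.+ b ℤ.* h) ℤ.* (c ℤ.* e ℤ.+ d ℤ.* g))
    ≡ (a ℤ.* d ℤ.+ ℤ.- (b ℤ.* c)) ℤ.* (e ℤ.* h ℤ.+ ℤ.- (f ℤ.* g))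
  lem = ℤSolver.solve-∀

-- Cayley-Hamilton in the form A + adj A = (tr A)·1, multiplied by B. For det A = 1 it is Fricke's
-- identity with A⁻¹.
tr-skein : ∀ A B → tr (A · B) ≡ tr A ℤ.* tr B ℤ.+ ℤ.- tr (adj A · B)
tr-skein (mat a b c d) (mat e f g h) = lem a b c d e f g h
  where
  lem : ∀ a b c d e f g h →
    (a ℤ.* e ℤ.+ b ℤ.* g) ℤ.+ (c ℤ.* f ℤ.+ d ℤ.* h) ≡
    (a ℤ.+ d) ℤ.* (e ℤ.+ h) ℤ.+ ℤ.- ((d ℤ.* e ℤ.+ ℤ.- b ℤ.* g) ℤ.+ (ℤ.- c ℤ.* f ℤ.+ a ℤ.* h))
  lem = ℤSolver.solve-∀

adj-· : ∀ A B → adj (A · B) ≡ adj B · adj A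
adj-· (mat a b c d) (mat e f g h) = mat-≡ (l₁ c d f h) (l₂ a b f h) (l₃ c d e g) (l₄ a b e g)
  where
  l₁ : ∀ c d f h → c ℤ.* f ℤ.+ d ℤ.* h ≡ h ℤ.* d ℤ.+ ℤ.- f ℤ.* ℤ.- c
  l₁ = ℤSolver.solve-∀
  l₂ : ∀ a b f h → ℤ.- (a ℤ.* f ℤ.+ b ℤ.* h) ≡ h ℤ.* ℤ.- b ℤ.+ ℤ.- f ℤ.* a
  l₂ = ℤSolver.solve-∀
  l₃ : ∀ c d e g → ℤ.- (c ℤ.* e ℤ.+ d ℤ.* g) ≡ ℤ.- g ℤ.* d ℤ.+ e ℤ.* ℤ.- c
  l₃ = ℤSolver.solve-∀
  l₄ : ∀ a b e g → a ℤ.* e ℤ.+ b ℤ.* g ≡ ℤ.- g ℤ.* ℤ.- b ℤ.+ e ℤ.* a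
  l₄ = ℤSolver.solve-∀

adj-inverseˡ : ∀ A → det A ≡ + 1 → adj A · A ≡ 1ᴹ
adj-inverseˡ (mat a b c d) eq = mat-≡ (trans (l₁ a b c d) eq) (l₂ b d) (l₃ a c) (trans (l₄ a b c d) eq)
  where
  l₁ : ∀ a b c d → d ℤ.* a ℤ.+ ℤ.- b ℤ.* c ≡ a ℤ.* d ℤ.+ ℤ.- (b ℤ.* c)
  l₁ = ℤSolver.solve-∀
  l₂ : ∀ b d → d ℤ.* b ℤ.+ ℤ.- b ℤ.* d ≡ + 0
  l₂ = ℤSolver.solve-∀
  l₃ : ∀ a c → ℤ.- c ℤ.* a ℤ.+ a ℤ.* c ≡ + 0
  l₃ = ℤSolver.solve-∀
  l₄ : ∀ a b c d → ℤ.- c ℤ.* b ℤ.+ a ℤ.* d ≡ a ℤ.* d ℤ.+ ℤ.- (b ℤ.* c)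
  l₄ = ℤSolver.solve-∀

adj-inverseʳ : ∀ A → det A ≡ + 1 → A · adj A ≡ 1ᴹ
adj-inverseʳ (mat a b c d) eq = mat-≡ (trans (l₁ a b c d) eq) (l₂ a b) (l₃ c d) (trans (l₄ a b c d) eq)
  where
  l₁ : ∀ a b c d → a ℤ.* d ℤ.+ b ℤ.* ℤ.- c ≡ a ℤ.* d ℤ.+ ℤ.- (b ℤ.* c)
  l₁ = ℤSolver.solve-∀
  l₂ : ∀ a b → a ℤ.* ℤ.- b ℤ.+ b ℤ.* a ≡ + 0
  l₂ = ℤSolver.solve-∀
  l₃ : ∀ c d → c ℤ.* d ℤ.+ d ℤ.* ℤ.- c ≡ + 0
  l₃ = ℤSolver.solve-∀
  l₄ : ∀ a b c d → c ℤ.* ℤ.- b ℤ.+ d ℤ.* a ≡ a ℤ.* d ℤ.+ ℤ.- (b ℤ.* c)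
  l₄ = ℤSolver.solve-∀

-- Syntax for signed products; `norm` computes the sign and the list of factors.
infixr 7 _⊙_
data Tm : Set where
  `_ : Mat → Tm
  ε : Tm
  _⊙_ : Tm → Tm → Tm
  ν_ : Tm → Tm

⟦_⟧ : Tm → Mat
⟦ ` A ⟧ = A
⟦ ε ⟧ = 1ᴹ
⟦ s ⊙ t ⟧ = ⟦ s ⟧ · ⟦ t ⟧
⟦ ν t ⟧ = negᴹ ⟦ t ⟧

signed : Bool → Mat → Mat
signed false A = A
signed true A = negᴹ A

∏ : List Mat → Mat
∏ [] = 1ᴹ
∏ (A ∷ As) = A · ∏ As

norm : Tm → Bool × List Mat
norm (` A) = false , A ∷ []
norm ε = false , []
norm (s ⊙ t) = proj₁ (norm s) xor proj₁ (norm t) , proj₂ (norm s) ++ proj₂ (norm t)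
norm (ν t) = not (proj₁ (norm t)) , proj₂ (norm t)

evalNorm : Bool × List Mat → Mat
evalNorm (σ , As) = signed σ (∏ As)

∏-++ : ∀ As Bs → ∏ (As ++ Bs) ≡ ∏ As · ∏ Bs
∏-++ [] Bs = sym (·-identityˡ (∏ Bs))
∏-++ (A ∷ As) Bs = trans (cong (A ·_) (∏-++ As Bs)) (sym (·-assoc A (∏ As) (∏ Bs)))

signed-· : ∀ σ τ A B → signed (σ xor τ) (A · B) ≡ signed σ A · signed τ B
signed-· false false A B = refl
signed-· false true A B = sym (neg-·ʳ A B)
signed-· true false A B = sym (neg-·ˡ A B)
signed-· true true A B = sym (trans (neg-·ˡ A (negᴹ B)) (trans (cong negᴹ (neg-·ʳ A B)) (neg-involutive (A · B))))

signed-not : ∀ σ A → signed (not σ) A ≡ negᴹ (signed σ A)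
signed-not false A = refl
signed-not true A = sym (neg-involutive A)

norm-sound : ∀ t → ⟦ t ⟧ ≡ evalNorm (norm t)
norm-sound (` A) = sym (·-identityʳ A)
norm-sound ε = refl
norm-sound (s ⊙ t) = begin
  ⟦ s ⟧ · ⟦ t ⟧ ≡⟨ cong₂ _·_ (norm-sound s) (norm-sound t) ⟩
  signed σ (∏ As) · signed τ (∏ Bs) ≡⟨ sym (signed-· σ τ (∏ As) (∏ Bs)) ⟩
  signed (σ xor τ) (∏ As · ∏ Bs) ≡⟨ cong (signed (σ xor τ)) (sym (∏-++ As Bs)) ⟩
  signed (σ xor τ) (∏ (As ++ Bs)) ∎
  where
  open ≡-Reasoning
  σ = proj₁ (norm s) ; As = proj₂ (norm s)
  τ = proj₁ (norm t) ; Bs = proj₂ (norm t)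
norm-sound (ν t) = trans (cong negᴹ (norm-sound t)) (sym (signed-not (proj₁ (norm t)) _))

reassoc : ∀ s t → norm s ≡ norm t → ⟦ s ⟧ ≡ ⟦ t ⟧
reassoc s t eq = trans (norm-sound s) (trans (cong evalNorm eq) (sym (norm-sound t)))

-- The workhorse of all cancellations below. On terms of known shape `norm` computes even though the
-- atoms are variable matrices, so both side conditions become `refl` and associativity, units and
-- signs need no attention.
rewriteAt : ∀ s pre a b post t → ⟦ a ⟧ ≡ ⟦ b ⟧ →
  norm s ≡ norm (pre ⊙ a ⊙ post) → norm (pre ⊙ b ⊙ post) ≡ norm t → ⟦ s ⟧ ≡ ⟦ t ⟧
rewriteAt s pre a b post t eq ns nt = begin
  ⟦ s ⟧ ≡⟨ reassoc s (pre ⊙ a ⊙ post) ns ⟩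
  ⟦ pre ⟧ · (⟦ a ⟧ · ⟦ post ⟧) ≡⟨ cong (λ X → ⟦ pre ⟧ · (X · ⟦ post ⟧)) eq ⟩
  ⟦ pre ⟧ · (⟦ b ⟧ · ⟦ post ⟧) ≡⟨ reassoc (pre ⊙ b ⊙ post) t nt ⟩
  ⟦ t ⟧ ∎
  where open ≡-Reasoning

-- `K` is the square of `J`, hence its inverse, and has trace -1; `P` is parabolic of trace 2. These
-- traces are the sources of the constants in the trace recursion.
J K P : Mat
J = mat (+ 0) -[1+ 0 ] (+ 1) -[1+ 0 ]
K = mat -[1+ 0 ] (+ 1) -[1+ 0 ] (+ 0)
P = mat (+ 1) (+ 6) (+ 0) (+ 1)

-- 1 + J + K = 0
tr-split : ∀ A B → tr (A · B) ≡ ℤ.- tr (A · (J · B)) ℤ.+ ℤ.- tr (A · (K · B))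
tr-split (mat a b c d) (mat e f g h) = lem a b c d e f g h
  where
  lem : ∀ a b c d e f g h →
    (a ℤ.* e ℤ.+ b ℤ.* g) ℤ.+ (c ℤ.* f ℤ.+ d ℤ.* h) ≡
    ℤ.- ((a ℤ.* (+ 0 ℤ.* e ℤ.+ -[1+ 0 ] ℤ.* g) ℤ.+ b ℤ.* (+ 1 ℤ.* e ℤ.+ -[1+ 0 ] ℤ.* g)) ℤ.+
         (c ℤ.* (+ 0 ℤ.* f ℤ.+ -[1+ 0 ] ℤ.* h) ℤ.+ d ℤ.* (+ 1 ℤ.* f ℤ.+ -[1+ 0 ] ℤ.* h))) ℤ.+
    ℤ.- ((a ℤ.* (-[1+ 0 ] ℤ.* e ℤ.+ + 1 ℤ.* g) ℤ.+ b ℤ.* (-[1+ 0 ] ℤ.* e ℤ.+ + 0 ℤ.* g)) ℤ.+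
         (c ℤ.* (-[1+ 0 ] ℤ.* f ℤ.+ + 1 ℤ.* h) ℤ.+ d ℤ.* (-[1+ 0 ] ℤ.* f ℤ.+ + 0 ℤ.* h)))
  lem = ℤSolver.solve-∀

-- x₀ … x₃ and y₀ … y₃ are the holonomies of two half-lattice words started at the parity classes
-- 0, v₁, v₂, v₁ + v₂, where v₁ and v₂ are the displacements of the two words. J, of order 3, is the
-- rotation about an orbifold point and P the loop around the puncture. The s-relations express the symmetry of
-- a word under the half-turn about its midpoint, the q-relations its commutation with the other word around one
-- orbifold point. All are stated without inverses.
record Holonomy (x₀ x₁ x₂ x₃ y₀ y₁ y₂ y₃ : Mat) : Set where
  field
    sx₀ : x₀ · (K · x₁) ≡ P
    sx₂ : x₂ · (K · x₃) ≡ negᴹ J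
    sx₃ : x₃ · (K · x₂) ≡ negᴹ J
    sy₀ : y₀ · (K · y₂) ≡ P
    sy₁ : y₁ · (K · y₃) ≡ negᴹ J
    sy₃ : y₃ · (K · y₁) ≡ negᴹ J
    q₀ : x₀ · y₁ ≡ negᴹ (y₀ · (J · x₂))
    q₁ : x₁ · y₀ ≡ negᴹ (y₁ · (J · x₃))
    q₃ : x₃ · y₂ ≡ negᴹ (y₃ · (J · x₁))
    dx₀ : det x₀ ≡ + 1
    dx₁ : det x₁ ≡ + 1
    dx₂ : det x₂ ≡ + 1
    dx₃ : det x₃ ≡ + 1
    dy₀ : det y₀ ≡ + 1
    dy₁ : det y₁ ≡ + 1
    dy₂ : det y₂ ≡ + 1
    dy₃ : det y₃ ≡ + 1

det-1 : ∀ A B → det A ≡ + 1 → det B ≡ + 1 → det (A · B) ≡ + 1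
det-1 A B a b = trans (det-· A B) (cong₂ ℤ._*_ a b)

module _ {x₀ x₁ x₂ x₃ y₀ y₁ y₂ y₃ : Mat} (H : Holonomy x₀ x₁ x₂ x₃ y₀ y₁ y₂ y₃) where
  open Holonomy H
  open ≡-Reasoning

  private
    X0 = ` x₀ ; X1 = ` x₁ ; X2 = ` x₂ ; X3 = ` x₃
    Y0 = ` y₀ ; Y1 = ` y₁ ; Y2 = ` y₂ ; Y3 = ` y₃
    j = ` J ; k = ` K

  q₀⁻ : y₀ · (J · x₂) ≡ negᴹ (x₀ · y₁)
  q₀⁻ = trans (sym (neg-involutive _)) (cong negᴹ (sym q₀))

  q₁⁻ : y₁ · (J · x₃) ≡ negᴹ (x₁ · y₀)
  q₁⁻ = trans (sym (neg-involutive _)) (cong negᴹ (sym q₁))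

  q₃⁻ : y₃ · (J · x₁) ≡ negᴹ (x₃ · y₂)
  q₃⁻ = trans (sym (neg-involutive _)) (cong negᴹ (sym q₃))

  -- The half-turn relation for the concatenated word: `q₀` brings y₀ to the front, the two
  -- x-factors annihilate by `sx₂`, and J·J = K leaves the relation `sy₀` of the second word alone.
  -- The next two relations follow the same pattern.
  z₀-z₃ : (x₀ · y₁) · (K · (x₃ · y₂)) ≡ P
  z₀-z₃ = begin
    ⟦ s₀ ⟧ ≡⟨ rewriteAt s₀ ε (X0 ⊙ Y1) (ν (Y0 ⊙ j ⊙ X2)) (k ⊙ X3 ⊙ Y2) s₁ q₀ refl refl ⟩
    ⟦ s₁ ⟧ ≡⟨ rewriteAt s₁ (ν (Y0 ⊙ j)) (X2 ⊙ k ⊙ X3) (ν j) Y2 s₂ sx₂ refl refl ⟩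
    ⟦ s₂ ⟧ ≡⟨ rewriteAt s₂ Y0 (j ⊙ j) k Y2 (Y0 ⊙ k ⊙ Y2) refl refl refl ⟩
    y₀ · (K · y₂) ≡⟨ sy₀ ⟩
    P ∎
    where
    s₀ = (X0 ⊙ Y1) ⊙ k ⊙ (X3 ⊙ Y2)
    s₁ = ν (Y0 ⊙ j ⊙ X2 ⊙ k ⊙ X3 ⊙ Y2)
    s₂ = Y0 ⊙ j ⊙ j ⊙ Y2

  z₁-z₂ : (x₁ · y₀) · (K · (x₂ · y₃)) ≡ negᴹ J
  z₁-z₂ = begin
    ⟦ s₀ ⟧ ≡⟨ rewriteAt s₀ ε (X1 ⊙ Y0) (ν (Y1 ⊙ j ⊙ X3)) (k ⊙ X2 ⊙ Y3) s₁ q₁ refl refl ⟩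
    ⟦ s₁ ⟧ ≡⟨ rewriteAt s₁ (ν (Y1 ⊙ j)) (X3 ⊙ k ⊙ X2) (ν j) Y3 s₂ sx₃ refl refl ⟩
    ⟦ s₂ ⟧ ≡⟨ rewriteAt s₂ Y1 (j ⊙ j) k Y3 (Y1 ⊙ k ⊙ Y3) refl refl refl ⟩
    y₁ · (K · y₃) ≡⟨ sy₁ ⟩
    negᴹ J ∎
    where
    s₀ = (X1 ⊙ Y0) ⊙ k ⊙ (X2 ⊙ Y3)
    s₁ = ν (Y1 ⊙ j ⊙ X3 ⊙ k ⊙ X2 ⊙ Y3)
    s₂ = Y1 ⊙ j ⊙ j ⊙ Y3

  z₂-z₁ : (x₂ · y₃) · (K · (x₁ · y₀)) ≡ negᴹ J
  z₂-z₁ = begin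
    ⟦ s₀ ⟧ ≡⟨ rewriteAt s₀ (X2 ⊙ Y3 ⊙ k) (X1 ⊙ Y0) (ν (Y1 ⊙ j ⊙ X3)) ε s₁ q₁ refl refl ⟩
    ⟦ s₁ ⟧ ≡⟨ rewriteAt s₁ (ν X2) (Y3 ⊙ k ⊙ Y1) (ν j) (j ⊙ X3) s₂ sy₃ refl refl ⟩
    ⟦ s₂ ⟧ ≡⟨ rewriteAt s₂ X2 (j ⊙ j) k X3 (X2 ⊙ k ⊙ X3) refl refl refl ⟩
    x₂ · (K · x₃) ≡⟨ sx₂ ⟩
    negᴹ J ∎
    where
    s₀ = (X2 ⊙ Y3) ⊙ k ⊙ (X1 ⊙ Y0)
    s₁ = ν (X2 ⊙ Y3 ⊙ k ⊙ Y1 ⊙ j ⊙ X3)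
    s₂ = X2 ⊙ j ⊙ j ⊙ X3

  -- This is the pair (w₁ , w₁w₂). The second displacement becomes v₁ + v₂, which exchanges the
  -- classes v₂ and v₁ + v₂; hence the order x₀ x₁ x₃ x₂.
  holonomyˡ : Holonomy x₀ x₁ x₃ x₂ (x₀ · y₁) (x₁ · y₀) (x₃ · y₂) (x₂ · y₃)
  holonomyˡ = record
    { sx₀ = sx₀ ; sx₂ = sx₃ ; sx₃ = sx₂
    ; sy₀ = z₀-z₃ ; sy₁ = z₁-z₂ ; sy₃ = z₂-z₁
    ; q₀ = rewriteAt (X0 ⊙ X1 ⊙ Y0) X0 (X1 ⊙ Y0) (ν (Y1 ⊙ j ⊙ X3)) ε (ν ((X0 ⊙ Y1) ⊙ (j ⊙ X3))) q₁ refl refl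
    ; q₁ = rewriteAt (X1 ⊙ X0 ⊙ Y1) X1 (X0 ⊙ Y1) (ν (Y0 ⊙ j ⊙ X2)) ε (ν ((X1 ⊙ Y0) ⊙ (j ⊙ X2))) q₀ refl refl
    ; q₃ = rewriteAt (X2 ⊙ X3 ⊙ Y2) X2 (X3 ⊙ Y2) (ν (Y3 ⊙ j ⊙ X1)) ε (ν ((X2 ⊙ Y3) ⊙ (j ⊙ X1))) q₃ refl refl
    ; dx₀ = dx₀ ; dx₁ = dx₁ ; dx₂ = dx₃ ; dx₃ = dx₂
    ; dy₀ = det-1 x₀ y₁ dx₀ dy₁ ; dy₁ = det-1 x₁ y₀ dx₁ dy₀ ; dy₂ = det-1 x₃ y₂ dx₃ dy₂ ; dy₃ = det-1 x₂ y₃ dx₂ dy₃ }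

  -- This is the pair (w₁w₂ , w₂). Now the first displacement becomes v₁ + v₂, so the entries for v₁
  -- and v₁ + v₂ change places.
  holonomyʳ : Holonomy (x₀ · y₁) (x₃ · y₂) (x₂ · y₃) (x₁ · y₀) y₀ y₃ y₂ y₁
  holonomyʳ = record
    { sx₀ = z₀-z₃ ; sx₂ = z₂-z₁ ; sx₃ = z₁-z₂
    ; sy₀ = sy₀ ; sy₁ = sy₃ ; sy₃ = sy₁
    ; q₀ = rewriteAt ((X0 ⊙ Y1) ⊙ Y3) ε (X0 ⊙ Y1) (ν (Y0 ⊙ j ⊙ X2)) Y3 (ν (Y0 ⊙ j ⊙ (X2 ⊙ Y3))) q₀ refl refl
    ; q₁ = rewriteAt ((X3 ⊙ Y2) ⊙ Y0) ε (X3 ⊙ Y2) (ν (Y3 ⊙ j ⊙ X1)) Y0 (ν (Y3 ⊙ j ⊙ (X1 ⊙ Y0))) q₃ refl refl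
    ; q₃ = rewriteAt ((X1 ⊙ Y0) ⊙ Y2) ε (X1 ⊙ Y0) (ν (Y1 ⊙ j ⊙ X3)) Y2 (ν (Y1 ⊙ j ⊙ (X3 ⊙ Y2))) q₁ refl refl
    ; dx₀ = det-1 x₀ y₁ dx₀ dy₁ ; dx₁ = det-1 x₃ y₂ dx₃ dy₂ ; dx₂ = det-1 x₂ y₃ dx₂ dy₃ ; dx₃ = det-1 x₁ y₀ dx₁ dy₀
    ; dy₀ = dy₀ ; dy₁ = dy₃ ; dy₂ = dy₂ ; dy₃ = dy₁ }

  x₀y₁Kx₃y₂ : x₀ · (y₁ · (K · (x₃ · y₂))) ≡ P
  x₀y₁Kx₃y₂ = trans (sym (·-assoc x₀ y₁ (K · (x₃ · y₂)))) z₀-z₃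

  -- With determinant 1 the adjugate is the inverse, so x₀ cancels. Splitting between y₁ and x₃, the
  -- part with `J` becomes y₀ y₂ by `q₁`, and the part with `K` collapses to `K` itself, whose trace
  -- -1 gives the summand 1.
  trace-adjˡ : tr (adj (x₀ · x₁) · (x₀ · (y₁ · (x₃ · y₂)))) ≡ tr (y₀ · y₂) ℤ.+ + 1
  trace-adjˡ = begin
    tr (adj (x₀ · x₁) · (x₀ · (y₁ · (x₃ · y₂))))
      ≡⟨ cong tr (cong (_· (x₀ · (y₁ · (x₃ · y₂)))) (adj-· x₀ x₁)) ⟩
    tr ⟦ s₀ ⟧
      ≡⟨ cong tr (rewriteAt s₀ C (` adj x₀ ⊙ X0) ε (Y1 ⊙ X3 ⊙ Y2) s₁ (adj-inverseˡ x₀ dx₀) refl refl) ⟩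
    tr ⟦ s₁ ⟧ ≡⟨ tr-split (adj x₁ · y₁) (x₃ · y₂) ⟩
    ℤ.- tr ⟦ s₂ ⟧ ℤ.+ ℤ.- tr ⟦ s₃ ⟧ ≡⟨ cong₂ (λ a b → ℤ.- a ℤ.+ b) e₂ e₃ ⟩
    ℤ.- (ℤ.- tr (y₀ · y₂)) ℤ.+ + 1 ≡⟨ cong (ℤ._+ + 1) (ℤP.neg-involutive (tr (y₀ · y₂))) ⟩
    tr (y₀ · y₂) ℤ.+ + 1 ∎
    where
    C = ` adj x₁
    s₀ = (C ⊙ ` adj x₀) ⊙ X0 ⊙ Y1 ⊙ X3 ⊙ Y2
    s₁ = (C ⊙ Y1) ⊙ X3 ⊙ Y2
    s₂ = (C ⊙ Y1) ⊙ j ⊙ X3 ⊙ Y2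
    s₃ = (C ⊙ Y1) ⊙ k ⊙ X3 ⊙ Y2
    e₂ : tr ⟦ s₂ ⟧ ≡ ℤ.- tr (y₀ · y₂)
    e₂ = begin
      tr ⟦ s₂ ⟧ ≡⟨ cong tr (rewriteAt s₂ C (Y1 ⊙ j ⊙ X3) (ν (X1 ⊙ Y0)) Y2 (ν (C ⊙ X1 ⊙ Y0 ⊙ Y2)) q₁⁻ refl refl) ⟩
      tr ⟦ ν (C ⊙ X1 ⊙ Y0 ⊙ Y2) ⟧
        ≡⟨ cong tr (rewriteAt (ν (C ⊙ X1 ⊙ Y0 ⊙ Y2)) (ν ε) (C ⊙ X1) ε (Y0 ⊙ Y2) (ν (Y0 ⊙ Y2)) (adj-inverseˡ x₁ dx₁) refl refl) ⟩
      tr ⟦ ν (Y0 ⊙ Y2) ⟧ ≡⟨ tr-neg (y₀ · y₂) ⟩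
      ℤ.- tr (y₀ · y₂) ∎
    e₃ : ℤ.- tr ⟦ s₃ ⟧ ≡ + 1
    e₃ = cong ℤ.-_ (begin
      tr ⟦ s₃ ⟧ ≡⟨ cong tr (rewriteAt s₃ (C ⊙ Y1 ⊙ k) (X3 ⊙ Y2) (ν (Y3 ⊙ j ⊙ X1)) ε s₄ q₃ refl refl) ⟩
      tr ⟦ s₄ ⟧ ≡⟨ cong tr (rewriteAt s₄ (ν C) (Y1 ⊙ k ⊙ Y3) (ν j) (j ⊙ X1) s₅ sy₁ refl refl) ⟩
      tr ⟦ s₅ ⟧ ≡⟨ cong tr (rewriteAt s₅ C (j ⊙ j) k X1 (C ⊙ k ⊙ X1) refl refl refl) ⟩
      tr (adj x₁ · (K · x₁)) ≡⟨ tr-comm (adj x₁) (K · x₁) ⟩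
      tr ((K · x₁) · adj x₁) ≡⟨ cong tr (rewriteAt ((k ⊙ X1) ⊙ C) k (X1 ⊙ C) ε ε k (adj-inverseʳ x₁ dx₁) refl refl) ⟩
      tr K ∎)
      where
      s₄ = ν (C ⊙ Y1 ⊙ k ⊙ Y3 ⊙ j ⊙ X1)
      s₅ = C ⊙ j ⊙ j ⊙ X1

  -- As before, after a cyclic rotation that cancels y₂ at the end instead of x₀ at the front; the
  -- collapsing part is now J·J.
  trace-adjʳ : tr (adj (y₀ · y₂) · (x₀ · (y₁ · (x₃ · y₂)))) ≡ tr (x₀ · x₁) ℤ.+ + 1
  trace-adjʳ = begin
    tr (adj (y₀ · y₂) · (x₀ · (y₁ · (x₃ · y₂))))
      ≡⟨ cong tr (cong (_· (x₀ · (y₁ · (x₃ · y₂)))) (adj-· y₀ y₂)) ⟩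
    tr ⟦ s₀ ⟧ ≡⟨ cong tr (reassoc s₀ (` adj y₂ ⊙ (C ⊙ X0 ⊙ Y1 ⊙ X3 ⊙ Y2)) refl) ⟩
    tr ⟦ ` adj y₂ ⊙ (C ⊙ X0 ⊙ Y1 ⊙ X3 ⊙ Y2) ⟧ ≡⟨ tr-comm (adj y₂) ⟦ C ⊙ X0 ⊙ Y1 ⊙ X3 ⊙ Y2 ⟧ ⟩
    tr ⟦ s₁ ⟧ ≡⟨ cong tr (rewriteAt s₁ (C ⊙ X0 ⊙ Y1 ⊙ X3) (Y2 ⊙ ` adj y₂) ε ε ((C ⊙ X0 ⊙ Y1) ⊙ X3) (adj-inverseʳ y₂ dy₂) refl refl) ⟩
    tr ((adj y₀ · (x₀ · y₁)) · x₃) ≡⟨ tr-split (adj y₀ · (x₀ · y₁)) x₃ ⟩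
    ℤ.- tr ⟦ s₂ ⟧ ℤ.+ ℤ.- tr ⟦ s₃ ⟧ ≡⟨ cong₂ (λ a b → ℤ.- a ℤ.+ b) e₂ e₃ ⟩
    ℤ.- (ℤ.- tr (x₀ · x₁)) ℤ.+ + 1 ≡⟨ cong (ℤ._+ + 1) (ℤP.neg-involutive (tr (x₀ · x₁))) ⟩
    tr (x₀ · x₁) ℤ.+ + 1 ∎
    where
    C = ` adj y₀
    s₀ = (` adj y₂ ⊙ C) ⊙ X0 ⊙ Y1 ⊙ X3 ⊙ Y2
    s₁ = (C ⊙ X0 ⊙ Y1 ⊙ X3 ⊙ Y2) ⊙ ` adj y₂
    s₂ = (C ⊙ X0 ⊙ Y1) ⊙ j ⊙ X3
    s₃ = (C ⊙ X0 ⊙ Y1) ⊙ k ⊙ X3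
    e₂ : tr ⟦ s₂ ⟧ ≡ ℤ.- tr (x₀ · x₁)
    e₂ = begin
      tr ⟦ s₂ ⟧ ≡⟨ cong tr (rewriteAt s₂ (C ⊙ X0) (Y1 ⊙ j ⊙ X3) (ν (X1 ⊙ Y0)) ε (ν (C ⊙ (X0 ⊙ X1 ⊙ Y0))) q₁⁻ refl refl) ⟩
      tr ⟦ ν (C ⊙ (X0 ⊙ X1 ⊙ Y0)) ⟧ ≡⟨ tr-neg (adj y₀ · (x₀ · (x₁ · y₀))) ⟩
      ℤ.- tr (adj y₀ · (x₀ · (x₁ · y₀))) ≡⟨ cong ℤ.-_ (tr-comm (adj y₀) (x₀ · (x₁ · y₀))) ⟩
      ℤ.- tr ⟦ s₄ ⟧ ≡⟨ cong (λ z → ℤ.- tr z) (rewriteAt s₄ (X0 ⊙ X1) (Y0 ⊙ C) ε ε (X0 ⊙ X1) (adj-inverseʳ y₀ dy₀) refl refl) ⟩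
      ℤ.- tr (x₀ · x₁) ∎
      where s₄ = (X0 ⊙ X1 ⊙ Y0) ⊙ C
    e₃ : ℤ.- tr ⟦ s₃ ⟧ ≡ + 1
    e₃ = cong ℤ.-_ (begin
      tr ⟦ s₃ ⟧ ≡⟨ cong tr (rewriteAt s₃ C (X0 ⊙ Y1) (ν (Y0 ⊙ j ⊙ X2)) (k ⊙ X3) s₄ q₀ refl refl) ⟩
      tr ⟦ s₄ ⟧ ≡⟨ cong tr (rewriteAt s₄ (ν (C ⊙ Y0 ⊙ j)) (X2 ⊙ k ⊙ X3) (ν j) ε s₅ sx₂ refl refl) ⟩
      tr ⟦ s₅ ⟧ ≡⟨ cong tr (rewriteAt s₅ ε (C ⊙ Y0) ε (j ⊙ j) (j ⊙ j) (adj-inverseˡ y₀ dy₀) refl refl) ⟩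
      tr (J · J) ∎)
      where
      s₄ = ν (C ⊙ Y0 ⊙ j ⊙ X2 ⊙ k ⊙ X3)
      s₅ = C ⊙ Y0 ⊙ j ⊙ j

  private
    t₁ t₂ t₁₂ : ℤ
    t₁ = tr (x₀ · x₁)
    t₂ = tr (y₀ · y₂)
    t₁₂ = tr ((x₀ · y₁) · (x₃ · y₂))

    arith : ∀ a b c → ℤ.- ℤ.- (a ℤ.* b ℤ.+ ℤ.- (c ℤ.+ + 1)) ℤ.+ -[1+ 1 ] ≡ a ℤ.* b ℤ.+ ℤ.- c ℤ.+ -[1+ 2 ]
    arith = ℤSolver.solve-∀

    t₁₂-assoc : t₁₂ ≡ tr (x₀ · (y₁ · (x₃ · y₂)))
    t₁₂-assoc = cong tr (·-assoc x₀ y₁ (x₃ · y₂))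

  -- The left side belongs to the doubled word of w₁w₁w₂. In the part with `J`, the factor y₀ J x₂
  -- becomes -x₀ y₁, which exposes (x₀ x₁)·B with B the matrix of w₁w₂w₁w₂, so that `tr-skein` and
  -- `trace-adjˡ` apply. The part with `K` collapses to `P`, and its trace 2 together with the 1 of
  -- `trace-adjˡ` gives 3.
  traceˡ : tr ((x₀ · (x₁ · y₀)) · (x₂ · (x₃ · y₂))) ≡ t₁ ℤ.* t₁₂ ℤ.+ ℤ.- t₂ ℤ.+ -[1+ 2 ]
  traceˡ = begin
    tr ((x₀ · (x₁ · y₀)) · (x₂ · (x₃ · y₂))) ≡⟨ tr-split (x₀ · (x₁ · y₀)) (x₂ · (x₃ · y₂)) ⟩
    ℤ.- tr ⟦ s₂ ⟧ ℤ.+ ℤ.- tr ⟦ s₃ ⟧ ≡⟨ cong₂ (λ a b → ℤ.- a ℤ.+ b) e₂ e₃ ⟩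
    ℤ.- ℤ.- (t₁ ℤ.* tr B ℤ.+ ℤ.- (t₂ ℤ.+ + 1)) ℤ.+ -[1+ 1 ] ≡⟨ arith t₁ (tr B) t₂ ⟩
    t₁ ℤ.* tr B ℤ.+ ℤ.- t₂ ℤ.+ -[1+ 2 ] ≡⟨ cong (λ b → t₁ ℤ.* b ℤ.+ ℤ.- t₂ ℤ.+ -[1+ 2 ]) (sym t₁₂-assoc) ⟩
    t₁ ℤ.* t₁₂ ℤ.+ ℤ.- t₂ ℤ.+ -[1+ 2 ] ∎
    where
    B = x₀ · (y₁ · (x₃ · y₂))
    s₂ = (X0 ⊙ X1 ⊙ Y0) ⊙ j ⊙ X2 ⊙ X3 ⊙ Y2
    s₃ = (X0 ⊙ X1 ⊙ Y0) ⊙ k ⊙ X2 ⊙ X3 ⊙ Y2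
    e₂ : tr ⟦ s₂ ⟧ ≡ ℤ.- (t₁ ℤ.* tr B ℤ.+ ℤ.- (t₂ ℤ.+ + 1))
    e₂ = begin
      tr ⟦ s₂ ⟧ ≡⟨ cong tr (rewriteAt s₂ (X0 ⊙ X1) (Y0 ⊙ j ⊙ X2) (ν (X0 ⊙ Y1)) (X3 ⊙ Y2) (ν ((X0 ⊙ X1) ⊙ (X0 ⊙ Y1 ⊙ X3 ⊙ Y2))) q₀⁻ refl refl) ⟩
      tr (negᴹ ((x₀ · x₁) · B)) ≡⟨ tr-neg ((x₀ · x₁) · B) ⟩
      ℤ.- tr ((x₀ · x₁) · B) ≡⟨ cong ℤ.-_ (tr-skein (x₀ · x₁) B) ⟩
      ℤ.- (t₁ ℤ.* tr B ℤ.+ ℤ.- tr (adj (x₀ · x₁) · B)) ≡⟨ cong (λ z → ℤ.- (t₁ ℤ.* tr B ℤ.+ ℤ.- z)) trace-adjˡ ⟩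
      ℤ.- (t₁ ℤ.* tr B ℤ.+ ℤ.- (t₂ ℤ.+ + 1)) ∎
    e₃ : ℤ.- tr ⟦ s₃ ⟧ ≡ -[1+ 1 ]
    e₃ = cong (λ z → ℤ.- tr z) (begin
      ⟦ s₃ ⟧ ≡⟨ rewriteAt s₃ X0 (X1 ⊙ Y0) (ν (Y1 ⊙ j ⊙ X3)) (k ⊙ X2 ⊙ X3 ⊙ Y2) s₄ q₁ refl refl ⟩
      ⟦ s₄ ⟧ ≡⟨ rewriteAt s₄ (ν (X0 ⊙ Y1 ⊙ j)) (X3 ⊙ k ⊙ X2) (ν j) (X3 ⊙ Y2) s₅ sx₃ refl refl ⟩
      ⟦ s₅ ⟧ ≡⟨ rewriteAt s₅ (X0 ⊙ Y1) (j ⊙ j) k (X3 ⊙ Y2) (X0 ⊙ Y1 ⊙ k ⊙ X3 ⊙ Y2) refl refl refl ⟩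
      x₀ · (y₁ · (K · (x₃ · y₂))) ≡⟨ x₀y₁Kx₃y₂ ⟩
      P ∎)
      where
      s₄ = ν (X0 ⊙ Y1 ⊙ j ⊙ X3 ⊙ k ⊙ X2 ⊙ X3 ⊙ Y2)
      s₅ = X0 ⊙ Y1 ⊙ j ⊙ j ⊙ X3 ⊙ Y2

  traceʳ : tr (((x₀ · y₁) · y₃) · ((x₁ · y₀) · y₂)) ≡ t₂ ℤ.* t₁₂ ℤ.+ ℤ.- t₁ ℤ.+ -[1+ 2 ]
  traceʳ = begin
    tr (((x₀ · y₁) · y₃) · ((x₁ · y₀) · y₂)) ≡⟨ tr-split ((x₀ · y₁) · y₃) ((x₁ · y₀) · y₂) ⟩
    ℤ.- tr ⟦ s₂ ⟧ ℤ.+ ℤ.- tr ⟦ s₃ ⟧ ≡⟨ cong₂ (λ a b → ℤ.- a ℤ.+ b) e₂ e₃ ⟩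
    ℤ.- ℤ.- (t₂ ℤ.* tr B ℤ.+ ℤ.- (t₁ ℤ.+ + 1)) ℤ.+ -[1+ 1 ] ≡⟨ arith t₂ (tr B) t₁ ⟩
    t₂ ℤ.* tr B ℤ.+ ℤ.- t₁ ℤ.+ -[1+ 2 ] ≡⟨ cong (λ b → t₂ ℤ.* b ℤ.+ ℤ.- t₁ ℤ.+ -[1+ 2 ]) (sym t₁₂-assoc) ⟩
    t₂ ℤ.* t₁₂ ℤ.+ ℤ.- t₁ ℤ.+ -[1+ 2 ] ∎
    where
    B = x₀ · (y₁ · (x₃ · y₂))
    s₂ = ((X0 ⊙ Y1) ⊙ Y3) ⊙ j ⊙ (X1 ⊙ Y0) ⊙ Y2
    s₃ = ((X0 ⊙ Y1) ⊙ Y3) ⊙ k ⊙ (X1 ⊙ Y0) ⊙ Y2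
    e₂ : tr ⟦ s₂ ⟧ ≡ ℤ.- (t₂ ℤ.* tr B ℤ.+ ℤ.- (t₁ ℤ.+ + 1))
    e₂ = begin
      tr ⟦ s₂ ⟧ ≡⟨ cong tr (rewriteAt s₂ (X0 ⊙ Y1) (Y3 ⊙ j ⊙ X1) (ν (X3 ⊙ Y2)) (Y0 ⊙ Y2) (ν ((X0 ⊙ Y1 ⊙ X3 ⊙ Y2) ⊙ (Y0 ⊙ Y2))) q₃⁻ refl refl) ⟩
      tr (negᴹ (B · (y₀ · y₂))) ≡⟨ tr-neg (B · (y₀ · y₂)) ⟩
      ℤ.- tr (B · (y₀ · y₂)) ≡⟨ cong ℤ.-_ (trans (tr-comm B (y₀ · y₂)) (tr-skein (y₀ · y₂) B)) ⟩
      ℤ.- (t₂ ℤ.* tr B ℤ.+ ℤ.- tr (adj (y₀ · y₂) · B)) ≡⟨ cong (λ z → ℤ.- (t₂ ℤ.* tr B ℤ.+ ℤ.- z)) trace-adjʳ ⟩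
      ℤ.- (t₂ ℤ.* tr B ℤ.+ ℤ.- (t₁ ℤ.+ + 1)) ∎
    e₃ : ℤ.- tr ⟦ s₃ ⟧ ≡ -[1+ 1 ]
    e₃ = cong (λ z → ℤ.- tr z) (begin
      ⟦ s₃ ⟧ ≡⟨ rewriteAt s₃ (X0 ⊙ Y1 ⊙ Y3 ⊙ k) (X1 ⊙ Y0) (ν (Y1 ⊙ j ⊙ X3)) Y2 s₄ q₁ refl refl ⟩
      ⟦ s₄ ⟧ ≡⟨ rewriteAt s₄ (ν (X0 ⊙ Y1)) (Y3 ⊙ k ⊙ Y1) (ν j) (j ⊙ X3 ⊙ Y2) s₅ sy₃ refl refl ⟩
      ⟦ s₅ ⟧ ≡⟨ rewriteAt s₅ (X0 ⊙ Y1) (j ⊙ j) k (X3 ⊙ Y2) (X0 ⊙ Y1 ⊙ k ⊙ X3 ⊙ Y2) refl refl refl ⟩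
      x₀ · (y₁ · (K · (x₃ · y₂))) ≡⟨ x₀y₁Kx₃y₂ ⟩
      P ∎)
      where
      s₄ = ν (X0 ⊙ Y1 ⊙ Y3 ⊙ k ⊙ Y1 ⊙ j ⊙ X3 ⊙ Y2)
      s₅ = X0 ⊙ Y1 ⊙ j ⊙ j ⊙ X3 ⊙ Y2

-- The pair of one-letter words, up and right: the entries are the matrices `Φ` of a single letter
-- in the four parity classes.
holonomy-init : Holonomy
  (mat -[1+ 0 ] -[1+ 3 ] (+ 0) -[1+ 0 ]) (mat (+ 0) (+ 1) -[1+ 0 ] -[1+ 0 ])
  (mat (+ 1) (+ 0) (+ 2) (+ 1)) (mat (+ 1) (+ 1) (+ 1) (+ 2))
  (mat -[1+ 0 ] -[1+ 1 ] (+ 0) -[1+ 0 ]) (mat (+ 0) -[1+ 0 ] (+ 1) (+ 1))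
  (mat (+ 0) (+ 1) -[1+ 0 ] -[1+ 2 ]) (mat (+ 0) (+ 1) -[1+ 0 ] (+ 3))
holonomy-init = record
  { sx₀ = refl ; sx₂ = refl ; sx₃ = refl ; sy₀ = refl ; sy₁ = refl ; sy₃ = refl
  ; q₀ = refl ; q₁ = refl ; q₃ = refl
  ; dx₀ = refl ; dx₁ = refl ; dx₂ = refl ; dx₃ = refl ; dy₀ = refl ; dy₁ = refl ; dy₂ = refl ; dy₃ = refl }

-- Good matchings

module _ {A : Set} where
  count : (A → Bool) → List A → ℕ
  count f [] = 0
  count f (x ∷ xs) = (if f x then 1 else 0) + count f xs

  length-filterᵇ : ∀ (f : A → Bool) xs → length (filterᵇ f xs) ≡ count f xs
  length-filterᵇ f [] = refl
  length-filterᵇ f (x ∷ xs) with f x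
  ... | true = cong suc (length-filterᵇ f xs)
  ... | false = length-filterᵇ f xs

  count-++ : ∀ f (xs ys : List A) → count f (xs ++ ys) ≡ count f xs + count f ys
  count-++ f [] ys = refl
  count-++ f (x ∷ xs) ys = trans (cong (λ n → (if f x then 1 else 0) + n) (count-++ f xs ys)) (sym (ℕP.+-assoc (if f x then 1 else 0) (count f xs) (count f ys)))

  count-↭ : ∀ f {xs ys : List A} → xs ↭ ys → count f xs ≡ count f ys
  count-↭ f Perm.refl = refl
  count-↭ f (Perm.prep x π) = cong (λ n → (if f x then 1 else 0) + n) (count-↭ f π)
  count-↭ f (Perm.swap {xs} {ys} x y π) = begin
    a + (b + count f xs) ≡⟨ sym (ℕP.+-assoc a b _) ⟩
    (a + b) + count f xs ≡⟨ cong₂ _+_ (ℕP.+-comm a b) (count-↭ f π) ⟩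
    (b + a) + count f ys ≡⟨ ℕP.+-assoc b a _ ⟩
    b + (a + count f ys) ∎
    where
    open ≡-Reasoning
    a = if f x then 1 else 0
    b = if f y then 1 else 0
  count-↭ f (Perm.trans π ρ) = trans (count-↭ f π) (count-↭ f ρ)

  any-↭ : ∀ (f : A → Bool) {xs ys : List A} → xs ↭ ys → any f xs ≡ any f ys
  any-↭ f Perm.refl = refl
  any-↭ f (Perm.prep x π) = cong (f x ∨_) (any-↭ f π)
  any-↭ f (Perm.swap x y π) with f x | f y
  ... | true | true = refl
  ... | true | false = refl
  ... | false | true = refl
  ... | false | false = any-↭ f π
  any-↭ f (Perm.trans π ρ) = trans (any-↭ f π) (any-↭ f ρ)

  all-cong : ∀ {Q : A → Set} {f g : A → Bool} {xs} → (∀ {x} → Q x → f x ≡ g x) → All Q xs → all f xs ≡ all g xs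
  all-cong h [] = refl
  all-cong h (px ∷ pxs) = cong₂ _∧_ (h px) (all-cong h pxs)

  all-++ : ∀ (f : A → Bool) xs ys → all f (xs ++ ys) ≡ all f xs ∧ all f ys
  all-++ f [] ys = refl
  all-++ f (x ∷ xs) ys = trans (cong (f x ∧_) (all-++ f xs ys)) (sym (BoolP.∧-assoc (f x) (all f xs) (all f ys)))

module _ {A B : Set} where
  count-map : ∀ (f : B → Bool) (g : A → B) xs → count f (map g xs) ≡ count (λ x → f (g x)) xs
  count-map f g [] = refl
  count-map f g (x ∷ xs) = cong (λ n → (if f (g x) then 1 else 0) + n) (count-map f g xs)

  all-concatMap : ∀ (f : B → Bool) (g : A → List B) xs → all f (concatMap g xs) ≡ all (λ x → all f (g x)) xs
  all-concatMap f g [] = refl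
  all-concatMap f g (x ∷ xs) = trans (all-++ f (g x) (concatMap g xs)) (cong (all f (g x) ∧_) (all-concatMap f g xs))

countSub : {A : Set} → (List A → Bool) → List A → ℕ
countSub f es = count f (subsets es)

module _ {A : Set} where
  countSub-∷ : ∀ f (x : A) es → countSub f (x ∷ es) ≡ countSub f es + countSub (λ M → f (x ∷ M)) es
  countSub-∷ f x es = trans (count-++ f (subsets es) (map (x ∷_) (subsets es)))
                           (cong (λ n → countSub f es + n) (count-map f (x ∷_) (subsets es)))

  countSub-cong : ∀ {Q : A → Set} {f g : List A → Bool} {es} → (∀ {M} → All Q M → f M ≡ g M) → All Q es → countSub f es ≡ countSub g es
  countSub-cong {f = f} {g} h [] rewrite h [] = refl
  countSub-cong {f = f} {g} {x ∷ es} h (px ∷ pE) = begin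
    countSub f (x ∷ es) ≡⟨ countSub-∷ f x es ⟩
    countSub f es + countSub (λ M → f (x ∷ M)) es ≡⟨ cong₂ _+_ (countSub-cong h pE) (countSub-cong (λ pM → h (px ∷ pM)) pE) ⟩
    countSub g es + countSub (λ M → g (x ∷ M)) es ≡⟨ sym (countSub-∷ g x es) ⟩
    countSub g (x ∷ es) ∎
    where open ≡-Reasoning

  countSub-false : ∀ (es : List A) → countSub (λ _ → false) es ≡ 0
  countSub-false [] = refl
  countSub-false (x ∷ es) = trans (countSub-∷ (λ _ → false) x es) (cong₂ _+_ (countSub-false es) (countSub-false es))

  -- Matchings are enumerated over the deduplicated edge list, while the induction wants each tile's
  -- far edge and sides in front of all later edges; the two lists differ by a permutation.
  countSub-↭ : ∀ {es es′ : List A} → es ↭ es′ → ∀ f → (∀ {M M′} → M ↭ M′ → f M ≡ f M′) → countSub f es ≡ countSub f es′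
  countSub-↭ Perm.refl f hf = refl
  countSub-↭ {x ∷ es} {_ ∷ es′} (Perm.prep x π) f hf = begin
    countSub f (x ∷ es) ≡⟨ countSub-∷ f x es ⟩
    countSub f es + countSub (λ M → f (x ∷ M)) es
      ≡⟨ cong₂ _+_ (countSub-↭ π f hf) (countSub-↭ π (λ M → f (x ∷ M)) (λ ρ → hf (Perm.prep x ρ))) ⟩
    countSub f es′ + countSub (λ M → f (x ∷ M)) es′ ≡⟨ sym (countSub-∷ f x es′) ⟩
    countSub f (x ∷ es′) ∎
    where open ≡-Reasoning
  countSub-↭ {x ∷ y ∷ es} {_ ∷ _ ∷ es′} (Perm.swap x y π) f hf = begin
    countSub f (x ∷ y ∷ es) ≡⟨ expand x y es ⟩
    (countSub f es + countSub (λ M → f (y ∷ M)) es) + (countSub (λ M → f (x ∷ M)) es + countSub (λ M → f (x ∷ y ∷ M)) es)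
      ≡⟨ cong₂ _+_ (cong₂ _+_ (countSub-↭ π f hf) (countSub-↭ π (λ M → f (y ∷ M)) (λ ρ → hf (Perm.prep y ρ))))
                   (cong₂ _+_ (countSub-↭ π (λ M → f (x ∷ M)) (λ ρ → hf (Perm.prep x ρ)))
                              (trans (countSub-↭ π (λ M → f (x ∷ y ∷ M)) (λ ρ → hf (Perm.prep x (Perm.prep y ρ))))
                                     (countSub-cong {Q = λ _ → A} (λ {M} _ → hf (Perm.swap x y Perm.refl)) (All.universal (λ z → z) es′)))) ⟩
    (countSub f es′ + countSub (λ M → f (y ∷ M)) es′) + (countSub (λ M → f (x ∷ M)) es′ + countSub (λ M → f (y ∷ x ∷ M)) es′)
      ≡⟨ interchange (countSub f es′) _ _ _ ⟩
    (countSub f es′ + countSub (λ M → f (x ∷ M)) es′) + (countSub (λ M → f (y ∷ M)) es′ + countSub (λ M → f (y ∷ x ∷ M)) es′)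
      ≡⟨ sym (expand y x es′) ⟩
    countSub f (y ∷ x ∷ es′) ∎
    where
    open ≡-Reasoning
    expand : ∀ x y es → countSub f (x ∷ y ∷ es) ≡
      (countSub f es + countSub (λ M → f (y ∷ M)) es) + (countSub (λ M → f (x ∷ M)) es + countSub (λ M → f (x ∷ y ∷ M)) es)
    expand x y es = trans (countSub-∷ f x (y ∷ es)) (cong₂ _+_ (countSub-∷ f y es) (countSub-∷ (λ M → f (x ∷ M)) y es))
    interchange : ∀ a b c d → (a + b) + (c + d) ≡ (a + c) + (b + d)
    interchange a b c d = begin
      (a + b) + (c + d) ≡⟨ ℕP.+-assoc a b (c + d) ⟩
      a + (b + (c + d)) ≡⟨ cong (λ n → a + n) (trans (sym (ℕP.+-assoc b c d)) (trans (cong (_+ d) (ℕP.+-comm b c)) (ℕP.+-assoc c b d))) ⟩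
      a + (c + (b + d)) ≡⟨ sym (ℕP.+-assoc a c (b + d)) ⟩
      (a + c) + (b + d) ∎
  countSub-↭ (Perm.trans π ρ) f hf = trans (countSub-↭ π f hf) (countSub-↭ ρ f hf)

-- Degrees and matchings at a single tile

≡ᵇ-refl : ∀ n → (n ≡ᵇ n) ≡ true
≡ᵇ-refl zero = refl
≡ᵇ-refl (suc n) = ≡ᵇ-refl n

≡ᵇ-true : ∀ m n → (m ≡ᵇ n) ≡ true → m ≡ n
≡ᵇ-true m n eq = ℕP.≡ᵇ⇒≡ m n (subst T (sym eq) _)

eqSPt-refl : ∀ v → eqSPt v v ≡ true
eqSPt-refl (a , b) rewrite ≡ᵇ-refl a | ≡ᵇ-refl b = refl

eqSPt-true : ∀ u v → eqSPt u v ≡ true → u ≡ v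
eqSPt-true (a , b) (c , d) eq with a ≡ᵇ c in e₁ | b ≡ᵇ d in e₂ | eq
... | true | true | _ = cong₂ _,_ (≡ᵇ-true a c e₁) (≡ᵇ-true b d e₂)

eqSPt-≢ : ∀ {u v} → u ≢ v → eqSPt u v ≡ false
eqSPt-≢ {u} {v} ne with eqSPt u v in eq
... | true = ⊥-elim (ne (eqSPt-true u v eq))
... | false = refl

eqSEdge-refl : ∀ e → eqSEdge e e ≡ true
eqSEdge-refl (u , v) rewrite eqSPt-refl u | eqSPt-refl v = refl

eqSEdge-true : ∀ e e′ → eqSEdge e e′ ≡ true → e ≡ e′
eqSEdge-true (u , v) (u′ , v′) eq with eqSPt u u′ in e₁ | eqSPt v v′ in e₂ | eq
... | true | true | _ = cong₂ _,_ (eqSPt-true u u′ e₁) (eqSPt-true v v′ e₂)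

deg : SPt → List SEdge → ℕ
deg v = count (v ∈ᵉ_)

saturated : List SEdge → SPt → Bool
saturated M v = deg v M ≡ᵇ 1

-- Matchings that start with the edges in `W` already chosen, cover `V`, and contain `g′` unless `H` waives it.
rootedMatching : (List SEdge → Bool) → List SEdge → List SPt → SEdge → List SEdge → Bool
rootedMatching H W V g′ M = all (saturated (W ++ M)) V ∧ (H M ∨ any (eqSEdge g′) M)

matchingCount : (List SEdge → Bool) → List SEdge → List SPt → SEdge → List SEdge → ℕ
matchingCount H W V g′ es = countSub (rootedMatching H W V g′) es

-- One tile with corners p, q (away from the next tile) and s, t (its exit edge).
module Tile {p q s t : SPt} (p≢q : p ≢ q) (p≢s : p ≢ s) (p≢t : p ≢ t) (q≢s : q ≢ s) (q≢t : q ≢ t) (s≢t : s ≢ t) where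
  far side₁ side₂ exit : SEdge
  far = (p , q)
  side₁ = (p , s)
  side₂ = (q , t)
  exit = (s , t)

  Beyond : SPt → Set
  Beyond v = v ≢ p × v ≢ q

  BeyondE : SEdge → Set
  BeyondE (u , v) = Beyond u × Beyond v

  p∉ : ∀ {M} → All BeyondE M → deg p M ≡ 0
  p∉ [] = refl
  p∉ {(u , v) ∷ M} (((u≢p , _) , (v≢p , _)) ∷ bM)
    rewrite eqSPt-≢ {p} {u} (λ e → u≢p (sym e)) | eqSPt-≢ {p} {v} (λ e → v≢p (sym e)) = p∉ bM

  q∉ : ∀ {M} → All BeyondE M → deg q M ≡ 0
  q∉ [] = refl
  q∉ {(u , v) ∷ M} (((_ , u≢q) , (_ , v≢q)) ∷ bM)
    rewrite eqSPt-≢ {q} {u} (λ e → u≢q (sym e)) | eqSPt-≢ {q} {v} (λ e → v≢q (sym e)) = q∉ bM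

  module _ {V′ : List SPt} {es′ : List SEdge} {g′ : SEdge} (bV : All Beyond V′) (bE : All BeyondE es′) (bg : BeyondE g′) where
    private
      V : List SPt
      V = p ∷ q ∷ V′

    -- p and q lie on no later tile, so the chosen edges must already cover each of them exactly once
    module _ {H : List SEdge → Bool} {W M₀ : List SEdge} where
      private
        f : List SEdge → Bool
        f M = rootedMatching H W V g′ (M₀ ++ M)
        W₀ = W ++ M₀

      deg-split : ∀ v M → deg v (W ++ (M₀ ++ M)) ≡ deg v W₀ + deg v M
      deg-split v M = trans (cong (deg v) (sym (ListP.++-assoc W M₀ M))) (count-++ (v ∈ᵉ_) W₀ M)

      deg-p-split : ∀ {M} → All BeyondE M → deg p (W ++ (M₀ ++ M)) ≡ deg p W₀
      deg-p-split {M} bM = trans (deg-split p M) (trans (cong (λ n → deg p W₀ + n) (p∉ bM)) (ℕP.+-identityʳ _))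

      deg-q-split : ∀ {M} → All BeyondE M → deg q (W ++ (M₀ ++ M)) ≡ deg q W₀
      deg-q-split {M} bM = trans (deg-split q M) (trans (cong (λ n → deg q W₀ + n) (q∉ bM)) (ℕP.+-identityʳ _))

      private
        saturated-p : ∀ M → All BeyondE M → saturated (W ++ (M₀ ++ M)) p ≡ saturated W₀ p
        saturated-p M bM = cong (_≡ᵇ 1) (deg-p-split {M} bM)

        saturated-q : ∀ M → All BeyondE M → saturated (W ++ (M₀ ++ M)) q ≡ saturated W₀ q
        saturated-q M bM = cong (_≡ᵇ 1) (deg-q-split {M} bM)

        later gate : List SEdge → Bool
        later M = all (saturated (W ++ (M₀ ++ M))) V′
        gate M = H (M₀ ++ M) ∨ any (eqSEdge g′) (M₀ ++ M)

      bad-p : saturated W₀ p ≡ false → countSub f es′ ≡ 0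
      bad-p eq = trans (countSub-cong {g = λ _ → false} (λ {M} → vanish M) bE) (countSub-false es′)
        where
        vanish : ∀ M → All BeyondE M → f M ≡ false
        vanish M bM = cong (λ b → (b ∧ (saturated (W ++ (M₀ ++ M)) q ∧ later M)) ∧ gate M) (trans (saturated-p M bM) eq)

      bad-q : saturated W₀ q ≡ false → countSub f es′ ≡ 0
      bad-q eq = trans (countSub-cong {g = λ _ → false} (λ {M} → vanish M) bE) (countSub-false es′)
        where
        vanish : ∀ M → All BeyondE M → f M ≡ false
        vanish M bM = trans (cong (λ b → (a ∧ (b ∧ later M)) ∧ gate M) (trans (saturated-q M bM) eq))
                            (cong (_∧ gate M) (BoolP.∧-zeroʳ a))
          where a = saturated (W ++ (M₀ ++ M)) p

      -- Once p and q are settled, the later tiles see the chosen edges only through degrees of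
      -- vertices beyond them, so W₀ may be replaced by a normal form W′: nothing, or the exit edge
      -- alone.
      good : ∀ {c W′} → saturated W₀ p ≡ true → saturated W₀ q ≡ true →
        (∀ {v} → Beyond v → deg v W₀ ≡ deg v W′) →
        (∀ {M} → All BeyondE M → H (M₀ ++ M) ≡ c) →
        (∀ M → any (eqSEdge g′) (M₀ ++ M) ≡ any (eqSEdge g′) M) →
        countSub f es′ ≡ matchingCount (λ _ → c) W′ V′ g′ es′
      good {c} {W′} ep eq eL eH eg = countSub-cong (λ {M} → agree M) bE
        where
        same : ∀ M {v} → Beyond v → saturated (W ++ (M₀ ++ M)) v ≡ saturated (W′ ++ M) v
        same M {v} bv = cong (_≡ᵇ 1) (begin
          deg v (W ++ (M₀ ++ M)) ≡⟨ deg-split v M ⟩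
          deg v W₀ + deg v M ≡⟨ cong (_+ deg v M) (eL bv) ⟩
          deg v W′ + deg v M ≡⟨ sym (count-++ (v ∈ᵉ_) W′ M) ⟩
          deg v (W′ ++ M) ∎)
          where open ≡-Reasoning
        agree : ∀ M → All BeyondE M → f M ≡ rootedMatching (λ _ → c) W′ V′ g′ M
        agree M bM = cong₂ _∧_
          (cong₂ _∧_ (trans (saturated-p M bM) ep)
            (cong₂ _∧_ (trans (saturated-q M bM) eq) (all-cong (same M) bV)))
          (cong₂ _∨_ (eH bM) (eg M))

    expand : ∀ f → countSub f (far ∷ side₁ ∷ side₂ ∷ es′) ≡
      ((countSub f es′ + countSub (λ M → f (side₂ ∷ M)) es′) +
       (countSub (λ M → f (side₁ ∷ M)) es′ + countSub (λ M → f (side₁ ∷ side₂ ∷ M)) es′)) +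
      ((countSub (λ M → f (far ∷ M)) es′ + countSub (λ M → f (far ∷ side₂ ∷ M)) es′) +
       (countSub (λ M → f (far ∷ side₁ ∷ M)) es′ + countSub (λ M → f (far ∷ side₁ ∷ side₂ ∷ M)) es′))
    expand f = trans (countSub-∷ f far (side₁ ∷ side₂ ∷ es′)) (cong₂ _+_ (two f) (two (λ M → f (far ∷ M))))
      where
      two : ∀ f → countSub f (side₁ ∷ side₂ ∷ es′) ≡
        (countSub f es′ + countSub (λ M → f (side₂ ∷ M)) es′) +
        (countSub (λ M → f (side₁ ∷ M)) es′ + countSub (λ M → f (side₁ ∷ side₂ ∷ M)) es′)
      two f = trans (countSub-∷ f side₁ (side₂ ∷ es′)) (cong₂ _+_ (countSub-∷ f side₂ es′) (countSub-∷ (λ M → f (side₁ ∷ M)) side₂ es′))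

    private
      pq : eqSPt p q ≡ false
      pq = eqSPt-≢ p≢q
      ps : eqSPt p s ≡ false
      ps = eqSPt-≢ p≢s
      pt′ : eqSPt p t ≡ false
      pt′ = eqSPt-≢ p≢t
      qp : eqSPt q p ≡ false
      qp = eqSPt-≢ (λ e → p≢q (sym e))
      qs : eqSPt q s ≡ false
      qs = eqSPt-≢ q≢s
      pp = eqSPt-refl p
      qq = eqSPt-refl q

      g′₁ = proj₁ g′
      g′≢ : eqSPt g′₁ p ≡ false × eqSPt g′₁ q ≡ false
      g′≢ = eqSPt-≢ (proj₁ (proj₁ bg)) , eqSPt-≢ (proj₂ (proj₁ bg))

      v-out : ∀ {v} → Beyond v → eqSPt v p ≡ false × eqSPt v q ≡ false
      v-out (a , b) = eqSPt-≢ a , eqSPt-≢ b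

      far-out : ∀ {v} → Beyond v → deg v (far ∷ []) ≡ 0
      far-out bv rewrite proj₁ (v-out bv) | proj₂ (v-out bv) = refl

      -- Choosing both sides covers s and t just as the exit edge would. Hence one bit of state,
      -- exit ends both covered or both free, passes from tile to tile, and a virtual exit edge
      -- encodes it.
      sides-out : ∀ {v} → Beyond v → deg v (side₁ ∷ side₂ ∷ []) ≡ deg v (exit ∷ [])
      sides-out {v} bv rewrite proj₁ (v-out bv) | proj₂ (v-out bv) with eqSPt v s in e₁ | eqSPt v t in e₂
      ... | true | true = ⊥-elim (s≢t (trans (sym (eqSPt-true v s e₁)) (eqSPt-true v t e₂)))
      ... | true | false = refl
      ... | false | true = refl
      ... | false | false = refl

      any-far : ∀ M → any (eqSEdge g′) (far ∷ M) ≡ any (eqSEdge g′) M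
      any-far M rewrite proj₁ g′≢ = refl
      any-side₂ : ∀ M → any (eqSEdge g′) (side₂ ∷ M) ≡ any (eqSEdge g′) M
      any-side₂ M rewrite proj₂ g′≢ = refl
      any-side₁ : ∀ M → any (eqSEdge g′) (side₁ ∷ M) ≡ any (eqSEdge g′) M
      any-side₁ M rewrite proj₁ g′≢ = refl

      zeros₁ : ∀ {a b c d e f g h n m} → a ≡ 0 → b ≡ 0 → c ≡ 0 → d ≡ m → e ≡ n → f ≡ 0 → g ≡ 0 → h ≡ 0 →
        ((a + b) + (c + d)) + ((e + f) + (g + h)) ≡ n + m
      zeros₁ {n = n} {m} refl refl refl refl refl refl refl refl =
        trans (cong (λ k → m + k) (trans (ℕP.+-identityʳ (n + 0)) (ℕP.+-identityʳ n))) (ℕP.+-comm m n)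

    -- Of the eight subsets of the three edges only {`far`} and {`side₁`, `side₂`} cover p and q
    -- once each. The first leaves the exit ends free, the second covers them.
    uncovered : ∀ {H c₁ c₂} →
      (∀ {M} → All BeyondE M → H (far ∷ M) ≡ c₁) → (∀ {M} → All BeyondE M → H (side₁ ∷ side₂ ∷ M) ≡ c₂) →
      matchingCount H [] V g′ (far ∷ side₁ ∷ side₂ ∷ es′) ≡
      matchingCount (λ _ → c₁) [] V′ g′ es′ + matchingCount (λ _ → c₂) (exit ∷ []) V′ g′ es′
    uncovered {H} {c₁} {c₂} h₁ h₂ = trans (expand (rootedMatching H [] V g′)) (zeros₁
      (bad-p {H} {[]} {[]} refl)
      (bad-p {H} {[]} {side₂ ∷ []} e₂)
      (bad-q {H} {[]} {side₁ ∷ []} e₃)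
      (good {H} {[]} {side₁ ∷ side₂ ∷ []} {c₂} {exit ∷ []} e₄ e₄′ sides-out h₂ (λ M → trans (any-side₁ (side₂ ∷ M)) (any-side₂ M)))
      (good {H} {[]} {far ∷ []} {c₁} {[]} e₅ e₅′ far-out h₁ any-far)
      (bad-q {H} {[]} {far ∷ side₂ ∷ []} e₆)
      (bad-p {H} {[]} {far ∷ side₁ ∷ []} e₇)
      (bad-p {H} {[]} {far ∷ side₁ ∷ side₂ ∷ []} e₈))
      where
      e₂ : saturated (side₂ ∷ []) p ≡ false
      e₂ rewrite pq | pt′ = refl
      e₃ : saturated (side₁ ∷ []) q ≡ false
      e₃ rewrite qp | qs = refl
      e₄ : saturated (side₁ ∷ side₂ ∷ []) p ≡ true
      e₄ rewrite pp | pq | pt′ = refl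
      e₄′ : saturated (side₁ ∷ side₂ ∷ []) q ≡ true
      e₄′ rewrite qq | qp | qs = refl
      e₅ : saturated (far ∷ []) p ≡ true
      e₅ rewrite pp = refl
      e₅′ : saturated (far ∷ []) q ≡ true
      e₅′ rewrite qp | qq = refl
      e₆ : saturated (far ∷ side₂ ∷ []) q ≡ false
      e₆ rewrite qp | qq = refl
      e₇ : saturated (far ∷ side₁ ∷ []) p ≡ false
      e₇ rewrite pp = refl
      e₈ : saturated (far ∷ side₁ ∷ side₂ ∷ []) p ≡ false
      e₈ rewrite pp = refl

    private
      zeros₂ : ∀ {a b c d e f g h m} → a ≡ m → b ≡ 0 → c ≡ 0 → d ≡ 0 → e ≡ 0 → f ≡ 0 → g ≡ 0 → h ≡ 0 →
        ((a + b) + (c + d)) + ((e + f) + (g + h)) ≡ m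
      zeros₂ {m = m} refl refl refl refl refl refl refl refl =
        trans (ℕP.+-identityʳ _) (trans (ℕP.+-identityʳ _) (ℕP.+-identityʳ m))
      zeros₃ : ∀ {a b c d e f g h m} → a ≡ 0 → b ≡ m → c ≡ 0 → d ≡ 0 → e ≡ 0 → f ≡ 0 → g ≡ 0 → h ≡ 0 →
        ((a + b) + (c + d)) + ((e + f) + (g + h)) ≡ m
      zeros₃ {m = m} refl refl refl refl refl refl refl refl =
        trans (ℕP.+-identityʳ _) (ℕP.+-identityʳ m)

    -- The `far` in the chosen list is virtual and records that p and q are covered from before. No
    -- edge at p or q may then be added, which excludes all three, including the real copy of `far`.
    covered-straight : ∀ {H c} → (∀ {M} → All BeyondE M → H M ≡ c) →
      matchingCount H (far ∷ []) V g′ (far ∷ side₁ ∷ side₂ ∷ es′) ≡ matchingCount (λ _ → c) [] V′ g′ es′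
    covered-straight {H} {c} h = trans (expand (rootedMatching H (far ∷ []) V g′)) (zeros₂
      (good {H} {far ∷ []} {[]} {c} {[]} e₁ e₁′ far-out h (λ _ → refl))
      (bad-q {H} {far ∷ []} {side₂ ∷ []} e₂)
      (bad-p {H} {far ∷ []} {side₁ ∷ []} e₃)
      (bad-p {H} {far ∷ []} {side₁ ∷ side₂ ∷ []} e₄)
      (bad-p {H} {far ∷ []} {far ∷ []} e₅)
      (bad-p {H} {far ∷ []} {far ∷ side₂ ∷ []} e₆)
      (bad-p {H} {far ∷ []} {far ∷ side₁ ∷ []} e₇)
      (bad-p {H} {far ∷ []} {far ∷ side₁ ∷ side₂ ∷ []} e₈))
      where
      e₁ : saturated (far ∷ []) p ≡ true
      e₁ rewrite pp = refl
      e₁′ : saturated (far ∷ []) q ≡ true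
      e₁′ rewrite qp | qq = refl
      e₂ : saturated (far ∷ side₂ ∷ []) q ≡ false
      e₂ rewrite qp | qq = refl
      e₃ : saturated (far ∷ side₁ ∷ []) p ≡ false
      e₃ rewrite pp = refl
      e₄ : saturated (far ∷ side₁ ∷ side₂ ∷ []) p ≡ false
      e₄ rewrite pp = refl
      e₅ : saturated (far ∷ far ∷ []) p ≡ false
      e₅ rewrite pp = refl
      e₆ : saturated (far ∷ far ∷ side₂ ∷ []) p ≡ false
      e₆ rewrite pp = refl
      e₇ : saturated (far ∷ far ∷ side₁ ∷ []) p ≡ false
      e₇ rewrite pp = refl
      e₈ : saturated (far ∷ far ∷ side₁ ∷ side₂ ∷ []) p ≡ false
      e₈ rewrite pp = refl

    -- After a turn the tile was entered through `side₁`, so p and s are covered. Only `side₂` can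
    -- still cover q, and it also covers t.
    covered-turn : ∀ {H c} → (∀ {M} → All BeyondE M → H (side₂ ∷ M) ≡ c) →
      matchingCount H (side₁ ∷ []) V g′ (far ∷ side₁ ∷ side₂ ∷ es′) ≡ matchingCount (λ _ → c) (exit ∷ []) V′ g′ es′
    covered-turn {H} {c} h = trans (expand (rootedMatching H (side₁ ∷ []) V g′)) (zeros₃
      (bad-q {H} {side₁ ∷ []} {[]} e₁)
      (good {H} {side₁ ∷ []} {side₂ ∷ []} {c} {exit ∷ []} e₂ e₂′ sides-out h any-side₂)
      (bad-p {H} {side₁ ∷ []} {side₁ ∷ []} e₃)
      (bad-p {H} {side₁ ∷ []} {side₁ ∷ side₂ ∷ []} e₄)
      (bad-p {H} {side₁ ∷ []} {far ∷ []} e₅)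
      (bad-p {H} {side₁ ∷ []} {far ∷ side₂ ∷ []} e₆)
      (bad-p {H} {side₁ ∷ []} {far ∷ side₁ ∷ []} e₇)
      (bad-p {H} {side₁ ∷ []} {far ∷ side₁ ∷ side₂ ∷ []} e₈))
      where
      e₁ : saturated (side₁ ∷ []) q ≡ false
      e₁ rewrite qp | qs = refl
      e₂ : saturated (side₁ ∷ side₂ ∷ []) p ≡ true
      e₂ rewrite pp | pq | pt′ = refl
      e₂′ : saturated (side₁ ∷ side₂ ∷ []) q ≡ true
      e₂′ rewrite qq | qp | qs = refl
      e₃ : saturated (side₁ ∷ side₁ ∷ []) p ≡ false
      e₃ rewrite pp = refl
      e₄ : saturated (side₁ ∷ side₁ ∷ side₂ ∷ []) p ≡ false
      e₄ rewrite pp = refl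
      e₅ : saturated (side₁ ∷ far ∷ []) p ≡ false
      e₅ rewrite pp = refl
      e₆ : saturated (side₁ ∷ far ∷ side₂ ∷ []) p ≡ false
      e₆ rewrite pp = refl
      e₇ : saturated (side₁ ∷ far ∷ side₁ ∷ []) p ≡ false
      e₇ rewrite pp = refl
      e₈ : saturated (side₁ ∷ far ∷ side₁ ∷ side₂ ∷ []) p ≡ false
      e₈ rewrite pp = refl

  last-uncovered : ∀ c → matchingCount (λ _ → c) [] (s ∷ t ∷ []) exit (exit ∷ []) ≡ 1
  last-uncovered true rewrite eqSPt-refl s | eqSPt-refl t | BoolP.∨-zeroʳ (eqSPt t s) = refl
  last-uncovered false rewrite eqSPt-refl s | eqSPt-refl t | BoolP.∨-zeroʳ (eqSPt t s) = refl

  -- The exit edge is the glued edge e′ here. With its ends already covered it cannot be chosen, so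
  -- the matching is good only if the condition on e′ was waived.
  last-covered : ∀ c → matchingCount (λ _ → c) (exit ∷ []) (s ∷ t ∷ []) exit (exit ∷ []) ≡ (if c then 1 else 0)
  last-covered true rewrite eqSPt-refl s | eqSPt-refl t | BoolP.∨-zeroʳ (eqSPt t s) = refl
  last-covered false rewrite eqSPt-refl s | eqSPt-refl t | BoolP.∨-zeroʳ (eqSPt t s) = refl

-- Snake graphs unrolled along a lattice path

far₂ : SPt → Dir → SPt
far₂ (a , b) E = (a , suc b)
far₂ (a , b) N = (suc a , b)

corner : SPt → SPt
corner (a , b) = (suc a , suc b)

-- With the direction of arrival this is the edge through which the tile is entered; with the
-- direction of departure it is the edge opposite the exit. The two agree exactly when the snake
-- goes straight.
farEdge : SPt → Dir → SEdge
farEdge x d = (x , far₂ x d)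

module TileAt (x : SPt) (d : Dir) where
  private
    distinct : ∀ d → let s = move x d ; q = far₂ x d ; t = corner x in
      (x ≢ q) × (x ≢ s) × (x ≢ t) × (q ≢ s) × (q ≢ t) × (s ≢ t)
    distinct E = (λ ()) , (λ ()) , (λ ()) , (λ ()) , (λ ()) , (λ ())
    distinct N = (λ ()) , (λ ()) , (λ ()) , (λ ()) , (λ ()) , (λ ())
    δ = distinct d
  open Tile {x} {far₂ x d} {move x d} {corner x} (proj₁ δ) (proj₁ (proj₂ δ)) (proj₁ (proj₂ (proj₂ δ)))
    (proj₁ (proj₂ (proj₂ (proj₂ δ)))) (proj₁ (proj₂ (proj₂ (proj₂ (proj₂ δ))))) (proj₂ (proj₂ (proj₂ (proj₂ (proj₂ δ))))) public

pathVerts : SPt → List Dir → List SPt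
pathVerts x [] = []
pathVerts x (d ∷ []) = x ∷ far₂ x d ∷ move x d ∷ corner x ∷ []
pathVerts x (d ∷ d′ ∷ ds) = x ∷ far₂ x d ∷ pathVerts (move x d) (d′ ∷ ds)

pathEdges : SPt → List Dir → List SEdge
pathEdges x [] = []
pathEdges x (d ∷ []) = farEdge x d ∷ (x , move x d) ∷ (far₂ x d , corner x) ∷ sideEdge x d ∷ []
pathEdges x (d ∷ d′ ∷ ds) = farEdge x d ∷ (x , move x d) ∷ (far₂ x d , corner x) ∷ pathEdges (move x d) (d′ ∷ ds)

Above : SPt → SPt → Set
Above (a , b) (c , d) = a ≤ c × b ≤ d

AboveE : SEdge → SPt → Set
AboveE (u , v) x = Above x u × Above x v

above-refl : ∀ x → Above x x
above-refl x = ℕP.≤-refl , ℕP.≤-refl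

above-move : ∀ x d {v} → Above (move x d) v → Above x v
above-move x E (l , m) = ℕP.<⇒≤ l , m
above-move x N (l , m) = l , ℕP.<⇒≤ m

above-far : ∀ x d → Above x (far₂ x d)
above-far x E = ℕP.≤-refl , ℕP.n≤1+n _
above-far x N = ℕP.n≤1+n _ , ℕP.≤-refl

above-corner : ∀ x → Above x (corner x)
above-corner x = ℕP.n≤1+n _ , ℕP.n≤1+n _

above-exit : ∀ x d → Above (move x d) (corner x)
above-exit x E = ℕP.≤-refl , ℕP.n≤1+n _
above-exit x N = ℕP.n≤1+n _ , ℕP.≤-refl

above⇒beyond : ∀ x d {v} → Above (move x d) v → TileAt.Beyond x d v
above⇒beyond x E (l , _) = (λ { refl → ℕP.<-irrefl refl l }) , (λ { refl → ℕP.<-irrefl refl l })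
above⇒beyond x N (_ , l) = (λ { refl → ℕP.<-irrefl refl l }) , (λ { refl → ℕP.<-irrefl refl l })

pathVerts-above : ∀ x ds → All (Above x) (pathVerts x ds)
pathVerts-above x [] = []
pathVerts-above x (d ∷ []) = above-refl x ∷ above-far x d ∷ above-move x d (above-refl (move x d)) ∷ above-corner x ∷ []
pathVerts-above x (d ∷ d′ ∷ ds) =
  above-refl x ∷ above-far x d ∷ All.map (above-move x d) (pathVerts-above (move x d) (d′ ∷ ds))

pathEdges-above : ∀ x ds → All (λ e → AboveE e x) (pathEdges x ds)
pathEdges-above x [] = []
pathEdges-above x (d ∷ []) =
  (above-refl x , above-far x d) ∷ (above-refl x , above-move x d (above-refl (move x d))) ∷
  (above-far x d , above-corner x) ∷ exit d ∷ []
  where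
  exit : ∀ d → AboveE (sideEdge x d) x
  exit E = above-move x E (above-refl (move x E)) , above-corner x
  exit N = above-move x N (above-refl (move x N)) , above-corner x
pathEdges-above x (d ∷ d′ ∷ ds) =
  (above-refl x , above-far x d) ∷ (above-refl x , above-move x d (above-refl (move x d))) ∷
  (above-far x d , above-corner x) ∷
  All.map (λ (u , v) → above-move x d u , above-move x d v) (pathEdges-above (move x d) (d′ ∷ ds))

glueOf : SPt → List Dir → SEdge
glueOf x ds = proj₂ (placeTiles x ds)

tilesOf : SPt → List Dir → List SPt
tilesOf x ds = proj₁ (placeTiles x ds)

glueOf-above : ∀ x d ds → AboveE (glueOf x (d ∷ ds)) x
glueOf-above x E [] = above-move x E (above-refl (move x E)) , above-corner x
glueOf-above x N [] = above-move x N (above-refl (move x N)) , above-corner x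
glueOf-above x d (d′ ∷ ds) = let (u , v) = glueOf-above (move x d) d′ ds in above-move x d u , above-move x d v

tile-above : ∀ x → All (λ e → AboveE e x) (tileEdges x)
tile-above x =
  (above-refl x , above-far x N) ∷ (above-far x E , above-corner x) ∷
  (above-refl x , above-far x E) ∷ (above-far x N , above-corner x) ∷ []

tileEdges-above : ∀ x ds → All (λ e → AboveE e x) (concatMap tileEdges (tilesOf x ds))
tileEdges-above x [] = []
tileEdges-above x (d ∷ []) = AllP.++⁺ (tile-above x) []
tileEdges-above x (d ∷ d′ ∷ ds) = AllP.++⁺ (tile-above x)
  (All.map (λ (u , v) → above-move x d u , above-move x d v) (tileEdges-above (move x d) (d′ ∷ ds)))

any-absent : ∀ {e : SEdge} {es} → All (λ e′ → proj₁ e′ ≢ proj₁ e) es → any (eqSEdge e) es ≡ false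
any-absent [] = refl
any-absent {e} {e′ ∷ es} (ne ∷ nes) rewrite eqSPt-≢ {proj₁ e} {proj₁ e′} (λ eq → ne (sym eq)) = any-absent {e} nes

dedupE-keep : ∀ {e es} → any (eqSEdge e) es ≡ false → dedupE (e ∷ es) ≡ e ∷ dedupE es
dedupE-keep eq rewrite eq = refl

dedupE-drop : ∀ {e es} → any (eqSEdge e) es ≡ true → dedupE (e ∷ es) ≡ dedupE es
dedupE-drop eq rewrite eq = refl

module _ (a b : ℕ) where
  private
    x = (a , b)
    bottom top left right : SEdge
    bottom = ((a , b) , (suc a , b))
    top = ((a , suc b) , (suc a , suc b))
    left = ((a , b) , (a , suc b))
    right = ((suc a , b) , (suc a , suc b))

    eqSEdge-≢ : ∀ e e′ → e ≢ e′ → eqSEdge e e′ ≡ false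
    eqSEdge-≢ e e′ ne with eqSEdge e e′ in eq
    ... | true = ⊥-elim (ne (eqSEdge-true e e′ eq))
    ... | false = refl

    no-left : ∀ es → any (eqSEdge left) es ≡ false → any (eqSEdge left) (right ∷ es) ≡ false
    no-left es eq = cong₂ _∨_ (eqSEdge-≢ left right λ ()) eq

    no-top : ∀ es → any (eqSEdge top) es ≡ false → any (eqSEdge top) (left ∷ right ∷ es) ≡ false
    no-top es eq = cong₂ _∨_ (eqSEdge-≢ top left λ ()) (cong₂ _∨_ (eqSEdge-≢ top right λ ()) eq)

    no-bottom : ∀ es → any (eqSEdge bottom) es ≡ false → any (eqSEdge bottom) (top ∷ left ∷ right ∷ es) ≡ false
    no-bottom es eq = cong₂ _∨_ (eqSEdge-≢ bottom top λ ())
      (cong₂ _∨_ (eqSEdge-≢ bottom left λ ()) (cong₂ _∨_ (eqSEdge-≢ bottom right λ ()) eq))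

  dedupE-last : dedupE (tileEdges x ++ []) ≡ bottom ∷ top ∷ left ∷ right ∷ []
  dedupE-last =
    trans (dedupE-keep {bottom} {top ∷ left ∷ right ∷ []} (no-bottom [] refl)) (cong (bottom ∷_)
    (trans (dedupE-keep {top} {left ∷ right ∷ []} (no-top [] refl)) (cong (top ∷_)
    (dedupE-keep {left} {right ∷ []} (no-left [] refl)))))

  -- `dedupE` keeps the last copy of an edge, so the shared edge is dropped here and survives as an
  -- edge of the next tile. Each tile but the last thus contributes three edges of its own.
  dedupE-east : ∀ {es} → All (λ e → AboveE e (suc a , b)) es → any (eqSEdge right) es ≡ true →
    dedupE (tileEdges x ++ es) ≡ bottom ∷ top ∷ left ∷ dedupE es
  dedupE-east {es} ab r∈ =
    trans (dedupE-keep {bottom} {top ∷ left ∷ right ∷ es} (no-bottom es (absent bottom refl))) (cong (bottom ∷_)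
    (trans (dedupE-keep {top} {left ∷ right ∷ es} (no-top es (absent top refl))) (cong (top ∷_)
    (trans (dedupE-keep {left} {right ∷ es} (no-left es (absent left refl))) (cong (left ∷_)
    (dedupE-drop {right} {es} r∈))))))
    where
    absent : ∀ e → proj₁ (proj₁ e) ≡ a → any (eqSEdge e) es ≡ false
    absent e eq = any-absent {e} (All.map (λ { ((l , _) , _) refl → ℕP.<-irrefl (sym eq) l }) ab)

  dedupE-north : ∀ {es} → All (λ e → AboveE e (a , suc b)) es → any (eqSEdge top) es ≡ true →
    dedupE (tileEdges x ++ es) ≡ bottom ∷ left ∷ right ∷ dedupE es
  dedupE-north {es} ab t∈ =
    trans (dedupE-keep {bottom} {top ∷ left ∷ right ∷ es} (no-bottom es (absent bottom refl))) (cong (bottom ∷_)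
    (trans (dedupE-drop {top} {left ∷ right ∷ es} (trans (cong (λ z → eqSEdge top left ∨ eqSEdge top right ∨ z) t∈) (trans (cong (eqSEdge top left ∨_) (BoolP.∨-zeroʳ (eqSEdge top right))) (BoolP.∨-zeroʳ (eqSEdge top left)))))
    (trans (dedupE-keep {left} {right ∷ es} (no-left es (absent left refl))) (cong (left ∷_)
    (dedupE-keep {right} {es} (absent right refl))))))
    where
    absent : ∀ e → proj₂ (proj₁ e) ≡ b → any (eqSEdge e) es ≡ false
    absent e eq = any-absent {e} (All.map (λ { ((_ , l) , _) refl → ℕP.<-irrefl (sym eq) l }) ab)

any-tile : ∀ x es → any (eqSEdge (farEdge x E)) (tileEdges x ++ es) ≡ true × any (eqSEdge (farEdge x N)) (tileEdges x ++ es) ≡ true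
any-tile x@(a , b) es = third , cong (_∨ any (eqSEdge (farEdge x N)) (top ∷ left ∷ right ∷ es)) (eqSEdge-refl (farEdge x N))
  where
  bottom top left right : SEdge
  bottom = ((a , b) , (suc a , b))
  top = ((a , suc b) , (suc a , suc b))
  left = ((a , b) , (a , suc b))
  right = ((suc a , b) , (suc a , suc b))
  third : any (eqSEdge left) (bottom ∷ top ∷ left ∷ right ∷ es) ≡ true
  third = trans (cong (λ z → eqSEdge left bottom ∨ eqSEdge left top ∨ z ∨ any (eqSEdge left) (right ∷ es)) (eqSEdge-refl left))
    (trans (cong (eqSEdge left bottom ∨_) (BoolP.∨-zeroʳ (eqSEdge left top))) (BoolP.∨-zeroʳ (eqSEdge left bottom)))

-- The exit edge of a tile is the west or the south edge of its successor; its presence there is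
-- what triggers the removal of the earlier copy.
any-first : ∀ x d ds → any (eqSEdge (farEdge x E)) (concatMap tileEdges (tilesOf x (d ∷ ds))) ≡ true ×
                     any (eqSEdge (farEdge x N)) (concatMap tileEdges (tilesOf x (d ∷ ds))) ≡ true
any-first x d [] = any-tile x []
any-first x d (d′ ∷ ds) = any-tile x (concatMap tileEdges (tilesOf (move x d) (d′ ∷ ds)))

rotate₃ : ∀ {A : Set} (u v w : A) {xs ys} → xs ↭ ys → u ∷ v ∷ w ∷ xs ↭ w ∷ u ∷ v ∷ ys
rotate₃ u v w π = Perm.trans (Perm.prep u (Perm.swap v w π)) (Perm.swap u w Perm.refl)

edges↭pathEdges : ∀ x d ds → dedupE (concatMap tileEdges (tilesOf x (d ∷ ds))) ↭ pathEdges x (d ∷ ds)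
edges↭pathEdges x@(a , b) E [] = Perm.trans (Perm.↭-reflexive (dedupE-last a b)) (rotate₃ _ _ _ Perm.refl)
edges↭pathEdges x@(a , b) N [] = Perm.trans (Perm.↭-reflexive (dedupE-last a b)) (Perm.prep _ (Perm.trans (Perm.swap _ _ Perm.refl) (Perm.prep _ (Perm.swap _ _ Perm.refl))))
edges↭pathEdges x@(a , b) E (d′ ∷ ds) = Perm.trans
  (Perm.↭-reflexive (dedupE-east a b (tileEdges-above (move x E) (d′ ∷ ds)) (proj₁ (any-first (move x E) d′ ds))))
  (rotate₃ _ _ _ (edges↭pathEdges (move x E) d′ ds))
edges↭pathEdges x@(a , b) N (d′ ∷ ds) = Perm.trans
  (Perm.↭-reflexive (dedupE-north a b (tileEdges-above (move x N) (d′ ∷ ds)) (proj₂ (any-first (move x N) d′ ds))))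
  (Perm.prep _ (Perm.prep _ (Perm.prep _ (edges↭pathEdges (move x N) d′ ds))))

all-absorb : ∀ {A : Set} (_==_ : A → A → Bool) → (∀ u v → (u == v) ≡ true → u ≡ v) →
  ∀ (g : A → Bool) e es → any (e ==_) es ≡ true → g e ∧ all g es ≡ all g es
all-absorb _==_ sound g e (e′ ∷ es) eq with e == e′ in h
... | true rewrite sound e e′ h with g e′
...   | true = refl
...   | false = refl
all-absorb _==_ sound g e (e′ ∷ es) eq | false with g e | all-absorb _==_ sound g e es eq
... | true | _ = refl
... | false | ih rewrite sym ih = sym (BoolP.∧-zeroʳ (g e′))

all-dedupV : ∀ g vs → all g (dedupV vs) ≡ all g vs
all-dedupV g [] = refl
all-dedupV g (v ∷ vs) with any (eqSPt v) vs in eq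
... | true = trans (all-dedupV g vs) (sym (all-absorb eqSPt eqSPt-true g v vs eq))
... | false = cong (g v ∧_) (all-dedupV g vs)

all-dedupE : ∀ g es → all g (dedupE es) ≡ all g es
all-dedupE g [] = refl
all-dedupE g (e ∷ es) with any (eqSEdge e) es in eq
... | true = trans (all-dedupE g es) (sym (all-absorb eqSEdge eqSEdge-true g e es eq))
... | false = cong (g e ∧_) (all-dedupE g es)

module _ (f : SPt → Bool) where
  private
    both : SEdge → Bool
    both e = all f (proj₁ e ∷ proj₂ e ∷ [])

    north : ∀ v u z w → ((v ∧ (z ∧ true)) ∧ (u ∧ (w ∧ true)) ∧ (v ∧ (u ∧ true)) ∧ (z ∧ (w ∧ true)) ∧ true) ≡ (v ∧ z ∧ u ∧ w ∧ true)
    north false u z w = refl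
    north true false false w = refl
    north true false true w = refl
    north true true false w = refl
    north true true true false = refl
    north true true true true = refl

    east : ∀ v u z w → ((v ∧ (z ∧ true)) ∧ (u ∧ (w ∧ true)) ∧ (v ∧ (u ∧ true)) ∧ (z ∧ (w ∧ true)) ∧ true) ≡ (v ∧ u ∧ z ∧ w ∧ true)
    east false u z w = refl
    east true false false w = refl
    east true false true w = refl
    east true true false w = refl
    east true true true false = refl
    east true true true true = refl

    -- The hypothesis holds because the exit edge is also an edge of the next tile.
    merge-east : ∀ v u z w r → (z ∧ (w ∧ true)) ∧ r ≡ r →
      ((v ∧ (z ∧ true)) ∧ (u ∧ (w ∧ true)) ∧ (v ∧ (u ∧ true)) ∧ (z ∧ (w ∧ true)) ∧ r) ≡ (v ∧ u ∧ r)
    merge-east false u z w r h = refl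
    merge-east true u true true r h with u
    ... | true = refl
    ... | false = refl
    merge-east true u false w r refl = sym (BoolP.∧-zeroʳ u)
    merge-east true u true false r refl with u
    ... | true = refl
    ... | false = refl

    merge-north : ∀ v u z w r → (u ∧ (w ∧ true)) ∧ r ≡ r →
      ((v ∧ (z ∧ true)) ∧ (u ∧ (w ∧ true)) ∧ (v ∧ (u ∧ true)) ∧ (z ∧ (w ∧ true)) ∧ r) ≡ (v ∧ z ∧ r)
    merge-north false u z w r h = refl
    merge-north true true false w r h = refl
    merge-north true true true true r h = refl
    merge-north true true true false r refl = refl
    merge-north true false false w r refl = refl
    merge-north true false true w r refl = refl

  all-pathVerts : ∀ x d ds → all both (concatMap tileEdges (tilesOf x (d ∷ ds))) ≡ all f (pathVerts x (d ∷ ds))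
  all-pathVerts (a , b) E [] = east (f (a , b)) (f (a , suc b)) (f (suc a , b)) (f (suc a , suc b))
  all-pathVerts (a , b) N [] = north (f (a , b)) (f (a , suc b)) (f (suc a , b)) (f (suc a , suc b))
  all-pathVerts x@(a , b) E (d′ ∷ ds) = trans
    (merge-east (f (a , b)) (f (a , suc b)) (f (suc a , b)) (f (suc a , suc b)) (all both (concatMap tileEdges (tilesOf (move x E) (d′ ∷ ds))))
      (all-absorb eqSEdge eqSEdge-true both (farEdge (move x E) E) (concatMap tileEdges (tilesOf (move x E) (d′ ∷ ds))) (proj₁ (any-first (move x E) d′ ds))))
    (cong (λ r → f x ∧ f (a , suc b) ∧ r) (all-pathVerts (move x E) d′ ds))
  all-pathVerts x@(a , b) N (d′ ∷ ds) = trans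
    (merge-north (f (a , b)) (f (a , suc b)) (f (suc a , b)) (f (suc a , suc b)) (all both (concatMap tileEdges (tilesOf (move x N) (d′ ∷ ds))))
      (all-absorb eqSEdge eqSEdge-true both (farEdge (move x N) N) (concatMap tileEdges (tilesOf (move x N) (d′ ∷ ds))) (proj₂ (any-first (move x N) d′ ds))))
    (cong (λ r → f x ∧ f (suc a , b) ∧ r) (all-pathVerts (move x N) d′ ds))

  all-vertices : ∀ x d ds → all f (vertices (dedupE (concatMap tileEdges (tilesOf x (d ∷ ds))))) ≡ all f (pathVerts x (d ∷ ds))
  all-vertices x d ds = begin
    all f (vertices es) ≡⟨ all-dedupV f (concatMap ends es) ⟩
    all f (concatMap ends es) ≡⟨ all-concatMap f ends es ⟩
    all both es ≡⟨ all-dedupE both (concatMap tileEdges (tilesOf x (d ∷ ds))) ⟩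
    all both (concatMap tileEdges (tilesOf x (d ∷ ds))) ≡⟨ all-pathVerts x d ds ⟩
    all f (pathVerts x (d ∷ ds)) ∎
    where
    open ≡-Reasoning
    ends : SEdge → List SPt
    ends e = proj₁ e ∷ proj₂ e ∷ []
    es = dedupE (concatMap tileEdges (tilesOf x (d ∷ ds)))

-- Transfer matrices of a sequence of turns

stepsFrom : Dir → List Bool → List Dir
stepsFrom a [] = []
stepsFrom a (b ∷ bs) = turnIf b a ∷ stepsFrom (turnIf b a) bs

-- The two counts differ in whether the ends of the entry edge are already matched.
covered uncovered : Bool → SPt → Dir → List Bool → ℕ
covered c x a bs = let ds = stepsFrom a bs in matchingCount (λ _ → c) (farEdge x a ∷ []) (pathVerts x ds) (glueOf x ds) (pathEdges x ds)
uncovered c x a bs = let ds = stepsFrom a bs in matchingCount (λ _ → c) [] (pathVerts x ds) (glueOf x ds) (pathEdges x ds)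

-- acts on columns (uncovered , covered)
turnMat : Bool → Mat
turnMat false = mat (+ 1) (+ 1) (+ 1) (+ 0)
turnMat true = mat (+ 1) (+ 1) (+ 0) (+ 1)

bitsMat : List Bool → Mat
bitsMat bs = ∏ (map turnMat bs)

-- The entries of the matrix applied to the column (1 , c): behind the last tile there is one
-- completion if the exit ends are free, and if they are covered there is one only when c waives the
-- condition on e′.
row₁ row₂ : Mat → Bool → ℤ
row₁ (mat a b _ _) c = a ℤ.+ (if c then b else + 0)
row₂ (mat _ _ a b) c = a ℤ.+ (if c then b else + 0)

module Step (x : SPt) (d : Dir) {vs : List SPt} {es : List SEdge} {g : SEdge}
  (av : All (Above (move x d)) vs) (ae : All (λ e → AboveE e (move x d)) es) (ag : AboveE g (move x d)) where
  open TileAt x d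

  private
    bV : All Beyond vs
    bV = All.map (above⇒beyond x d) av
    bE : All BeyondE es
    bE = All.map (λ (u , v) → above⇒beyond x d u , above⇒beyond x d v) ae
    bg : BeyondE g
    bg = above⇒beyond x d (proj₁ ag) , above⇒beyond x d (proj₂ ag)

  next : (List SEdge → Bool) → List SEdge → ℕ
  next H W = matchingCount H W (x ∷ far₂ x d ∷ vs) g (farEdge x d ∷ (x , move x d) ∷ (far₂ x d , corner x) ∷ es)

  rest : Bool → List SEdge → ℕ
  rest c W = matchingCount (λ _ → c) W vs g es

  next-uncovered : ∀ {H c₁ c₂} → (∀ {M} → All BeyondE M → H (far ∷ M) ≡ c₁) → (∀ {M} → All BeyondE M → H (side₁ ∷ side₂ ∷ M) ≡ c₂) →
    next H [] ≡ rest c₁ [] + rest c₂ (exit ∷ [])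
  next-uncovered = TileAt.uncovered x d bV bE bg

  next-straight : ∀ {c} → next (λ _ → c) (far ∷ []) ≡ rest c []
  next-straight {c} = covered-straight bV bE bg {λ _ → c} (λ _ → refl)

  next-turn : ∀ {c} → next (λ _ → c) (side₁ ∷ []) ≡ rest c (exit ∷ [])
  next-turn {c} = covered-turn bV bE bg {λ _ → c} (λ _ → refl)

entry-turn : ∀ x a → farEdge x a ≡ (x , move x (flipDir a))
entry-turn x E = refl
entry-turn x N = refl

far-move : ∀ x d → farEdge (move x d) d ≡ (move x d , corner x)
far-move x E = refl
far-move x N = refl

sideEdge-exit : ∀ x d → sideEdge x d ≡ (move x d , corner x)
sideEdge-exit x E = refl
sideEdge-exit x N = refl

module Rec (x : SPt) (a : Dir) (b b′ : Bool) (bs : List Bool) where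
  d = turnIf b a
  ds = stepsFrom d (b′ ∷ bs)
  open Step x d (pathVerts-above (move x d) ds) (pathEdges-above (move x d) ds)
    (glueOf-above (move x d) (turnIf b′ d) (stepsFrom (turnIf b′ d) bs)) public

  rest-covered : ∀ c → rest c ((move x d , corner x) ∷ []) ≡ covered c (move x d) d (b′ ∷ bs)
  rest-covered c = cong (λ e → matchingCount (λ _ → c) (e ∷ []) (pathVerts (move x d) ds) (glueOf (move x d) ds) (pathEdges (move x d) ds)) (sym (far-move x d))

module Last (x : SPt) (d : Dir) where
  private
    e = (move x d , corner x)
    above-s = above-refl (move x d)
    above-t = above-exit x d
  open Step x d {move x d ∷ corner x ∷ []} {e ∷ []} {e} (above-s ∷ above-t ∷ []) ((above-s , above-t) ∷ []) (above-s , above-t) public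
  open TileAt x d

  rest-uncovered : ∀ c → rest c [] ≡ 1
  rest-uncovered = last-uncovered

  rest-covered : ∀ c → rest c (e ∷ []) ≡ (if c then 1 else 0)
  rest-covered = last-covered

straight-step : ∀ x a b′ bs c →
  covered c x a (false ∷ b′ ∷ bs) ≡ uncovered c (move x a) a (b′ ∷ bs)
straight-step x a b′ bs c = Rec.next-straight x a false b′ bs

turn-step : ∀ x a b′ bs c →
  covered c x a (true ∷ b′ ∷ bs) ≡ covered c (move x (flipDir a)) (flipDir a) (b′ ∷ bs)
turn-step x a b′ bs c = trans
  (cong (λ e → next (λ _ → c) (e ∷ [])) (entry-turn x a))
  (trans (next-turn {c}) (rest-covered c))
  where open Rec x a true b′ bs

uncovered-step : ∀ x a b b′ bs c → let d = turnIf b a in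
  uncovered c x a (b ∷ b′ ∷ bs) ≡ uncovered c (move x d) d (b′ ∷ bs) + covered c (move x d) d (b′ ∷ bs)
uncovered-step x a b b′ bs c = trans (next-uncovered {λ _ → c} {c} {c} (λ _ → refl) (λ _ → refl)) (cong (λ n → rest c [] + n) (rest-covered c))
  where open Rec x a b b′ bs

row₁-turn : ∀ b A c → row₁ (turnMat b · A) c ≡ row₁ A c ℤ.+ row₂ A c
row₁-turn false (mat m n o p) false = lem m o
  where
  lem : ∀ m o → (+ 1 ℤ.* m ℤ.+ + 1 ℤ.* o) ℤ.+ + 0 ≡ (m ℤ.+ + 0) ℤ.+ (o ℤ.+ + 0)
  lem = ℤSolver.solve-∀
row₁-turn false (mat m n o p) true = lem m n o p
  where
  lem : ∀ m n o p → (+ 1 ℤ.* m ℤ.+ + 1 ℤ.* o) ℤ.+ (+ 1 ℤ.* n ℤ.+ + 1 ℤ.* p) ≡ (m ℤ.+ n) ℤ.+ (o ℤ.+ p)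
  lem = ℤSolver.solve-∀
row₁-turn true (mat m n o p) false = row₁-turn false (mat m n o p) false
row₁-turn true (mat m n o p) true = row₁-turn false (mat m n o p) true

row₂-straight : ∀ A c → row₂ (turnMat false · A) c ≡ row₁ A c
row₂-straight (mat m n o p) false = lem m o
  where
  lem : ∀ m o → (+ 1 ℤ.* m ℤ.+ + 0 ℤ.* o) ℤ.+ + 0 ≡ m ℤ.+ + 0
  lem = ℤSolver.solve-∀
row₂-straight (mat m n o p) true = lem m n o p
  where
  lem : ∀ m n o p → (+ 1 ℤ.* m ℤ.+ + 0 ℤ.* o) ℤ.+ (+ 1 ℤ.* n ℤ.+ + 0 ℤ.* p) ≡ m ℤ.+ n
  lem = ℤSolver.solve-∀

row₂-turn : ∀ A c → row₂ (turnMat true · A) c ≡ row₂ A c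
row₂-turn (mat m n o p) false = lem m o
  where
  lem : ∀ m o → (+ 0 ℤ.* m ℤ.+ + 1 ℤ.* o) ℤ.+ + 0 ≡ o ℤ.+ + 0
  lem = ℤSolver.solve-∀
row₂-turn (mat m n o p) true = lem m n o p
  where
  lem : ∀ m n o p → (+ 0 ℤ.* m ℤ.+ + 1 ℤ.* o) ℤ.+ (+ 0 ℤ.* n ℤ.+ + 1 ℤ.* p) ≡ o ℤ.+ p
  lem = ℤSolver.solve-∀

uncovered-last : ∀ x a b c → uncovered c x a (b ∷ []) ≡ 1 + (if c then 1 else 0)
uncovered-last x a b c = trans (cong (λ e → matchingCount (λ _ → c) [] (pathVerts x (d ∷ [])) e (farEdge x d ∷ (x , move x d) ∷ (far₂ x d , corner x) ∷ e ∷ [])) (sideEdge-exit x d))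
  (trans (next-uncovered {λ _ → c} {c} {c} (λ _ → refl) (λ _ → refl)) (cong₂ _+_ (rest-uncovered c) (rest-covered c)))
  where
  d = turnIf b a
  open Last x d

covered-last : ∀ x a b c → covered c x a (b ∷ []) ≡ (if b then (if c then 1 else 0) else 1)
covered-last x a false c = trans (cong (λ e → matchingCount (λ _ → c) (farEdge x a ∷ []) (pathVerts x (a ∷ [])) e (farEdge x a ∷ (x , move x a) ∷ (far₂ x a , corner x) ∷ e ∷ [])) (sideEdge-exit x a))
  (trans (next-straight {c}) (rest-uncovered c))
  where open Last x a
covered-last x a true c = trans (cong₂ (λ e e′ → matchingCount (λ _ → c) (e′ ∷ []) (pathVerts x (d ∷ [])) e (farEdge x d ∷ (x , move x d) ∷ (far₂ x d , corner x) ∷ e ∷ [])) (sideEdge-exit x d) (entry-turn x a))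
  (trans (next-turn {c}) (rest-covered c))
  where
  d = flipDir a
  open Last x d

transfer : ∀ x a b bs c → let A = bitsMat (b ∷ bs) in
  + uncovered c x a (b ∷ bs) ≡ row₁ A c × + covered c x a (b ∷ bs) ≡ row₂ A c
transfer x a b [] c = last b c
  where
  last : ∀ b c → + uncovered c x a (b ∷ []) ≡ row₁ (bitsMat (b ∷ [])) c × + covered c x a (b ∷ []) ≡ row₂ (bitsMat (b ∷ [])) c
  last true true = cong +_ (uncovered-last x a true true) , cong +_ (covered-last x a true true)
  last true false = cong +_ (uncovered-last x a true false) , cong +_ (covered-last x a true false)
  last false true = cong +_ (uncovered-last x a false true) , cong +_ (covered-last x a false true)
  last false false = cong +_ (uncovered-last x a false false) , cong +_ (covered-last x a false false)
transfer x a b (b′ ∷ bs) c = row₁-part , row₂-part b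
  where
  open ≡-Reasoning
  A = bitsMat (b′ ∷ bs)
  row₁-part : + uncovered c x a (b ∷ b′ ∷ bs) ≡ row₁ (turnMat b · A) c
  row₁-part = begin
    + uncovered c x a (b ∷ b′ ∷ bs) ≡⟨ cong +_ (uncovered-step x a b b′ bs c) ⟩
    + uncovered c (move x d) d (b′ ∷ bs) ℤ.+ + covered c (move x d) d (b′ ∷ bs)
      ≡⟨ cong₂ ℤ._+_ (proj₁ (transfer (move x d) d b′ bs c)) (proj₂ (transfer (move x d) d b′ bs c)) ⟩
    row₁ A c ℤ.+ row₂ A c ≡⟨ sym (row₁-turn b A c) ⟩
    row₁ (turnMat b · A) c ∎
    where d = turnIf b a
  row₂-part : ∀ b → + covered c x a (b ∷ b′ ∷ bs) ≡ row₂ (turnMat b · A) c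
  row₂-part false = trans (cong +_ (straight-step x a b′ bs c))
    (trans (proj₁ (transfer (move x a) a b′ bs c)) (sym (row₂-straight A c)))
  row₂-part true = trans (cong +_ (turn-step x a b′ bs c))
    (trans (proj₂ (transfer (move x (flipDir a)) (flipDir a) b′ bs c)) (sym (row₂-turn A c)))

rootedMatching-↭ : ∀ {H V g} → (∀ {M M′} → M ↭ M′ → H M ≡ H M′) →
  ∀ {M M′} → M ↭ M′ → rootedMatching H [] V g M ≡ rootedMatching H [] V g M′
rootedMatching-↭ {H} {V} {g} hH {M} {M′} π = cong₂ _∧_
  (all-cong {Q = λ _ → SPt} (λ {v} _ → cong (_≡ᵇ 1) (count-↭ (v ∈ᵉ_) π)) (All.universal (λ v → v) V))
  (cong₂ _∨_ (hH π) (any-↭ (eqSEdge g) π))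

origin : SPt
origin = (0 , 0)

-- This tests for the glued edge e, the west side of the first tile. No later edge can equal e, so
-- the test becomes a constant once the first tile is decided.
rooted : List SEdge → Bool
rooted M = any (eqSEdge (farEdge origin E)) M

goodMatchings : ∀ d ds → goodMatchingCount (bandFromSteps (d ∷ ds)) ≡
  matchingCount rooted [] (pathVerts origin (d ∷ ds)) (glueOf origin (d ∷ ds)) (pathEdges origin (d ∷ ds))
goodMatchings d ds = begin
  length (filterᵇ (isGoodMatching B) (subsets (edges B))) ≡⟨ length-filterᵇ (isGoodMatching B) (subsets (edges B)) ⟩
  countSub (isGoodMatching B) (edges B) ≡⟨ countSub-cong {Q = λ _ → SEdge} (λ {M} _ → same M) (All.universal (λ e → e) (edges B)) ⟩
  countSub f (edges B) ≡⟨ countSub-↭ (edges↭pathEdges origin d ds) f (rootedMatching-↭ {rooted} {V} {glue′ B} (any-↭ (eqSEdge (farEdge origin E)))) ⟩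
  countSub f (pathEdges origin (d ∷ ds)) ∎
  where
  open ≡-Reasoning
  B = bandFromSteps (d ∷ ds)
  V = pathVerts origin (d ∷ ds)
  f = rootedMatching rooted [] V (glue′ B)
  same : ∀ M → isGoodMatching B M ≡ f M
  same M = cong (_∧ (rooted M ∨ any (eqSEdge (glue′ B)) M))
    (trans (all-vertices (λ v → length (filterᵇ (v ∈ᵉ_) M) ≡ᵇ 1) origin d ds)
      (all-cong {Q = λ _ → SPt} (λ {v} _ → cong (_≡ᵇ 1) (length-filterᵇ (v ∈ᵉ_) M)) (All.universal (λ v → v) V)))

-- When the snake leaves the first tile straight on, e is the far edge. Choosing it leaves the exit
-- ends free and waives e′; otherwise both sides are chosen and e′ is required. The cyclic condition
-- thus turns the sum of the two counts into a trace.
trace-false : ∀ A → row₁ A true ℤ.+ row₂ A false ≡ tr (turnMat false · A)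
trace-false (mat m n o p) = lem m n o p
  where
  lem : ∀ m n o p → (m ℤ.+ n) ℤ.+ (o ℤ.+ + 0) ≡ (+ 1 ℤ.* m ℤ.+ + 1 ℤ.* o) ℤ.+ (+ 1 ℤ.* n ℤ.+ + 0 ℤ.* p)
  lem = ℤSolver.solve-∀

-- After a turn e is one of the two sides, so now the choice of both sides waives e′ and the choice
-- of the far edge requires it.
trace-true : ∀ A → row₁ A false ℤ.+ row₂ A true ≡ tr (turnMat true · A)
trace-true (mat m n o p) = lem m n o p
  where
  lem : ∀ m n o p → (m ℤ.+ + 0) ℤ.+ (o ℤ.+ p) ≡ (+ 1 ℤ.* m ℤ.+ + 1 ℤ.* o) ℤ.+ (+ 0 ℤ.* n ℤ.+ + 1 ℤ.* p)
  lem = ℤSolver.solve-∀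

goodMatchingCount-trace : ∀ b b′ bs →
  + goodMatchingCount (bandFromSteps (stepsFrom E (b ∷ b′ ∷ bs))) ≡ tr (bitsMat (b ∷ b′ ∷ bs))
goodMatchingCount-trace b b′ bs = begin
  + goodMatchingCount (bandFromSteps (stepsFrom E (b ∷ b′ ∷ bs)))
    ≡⟨ cong +_ (goodMatchings (turnIf b E) (stepsFrom (turnIf b E) (b′ ∷ bs))) ⟩
  + matchingCount rooted [] (pathVerts origin ds) (glueOf origin ds) (pathEdges origin ds) ≡⟨ split b ⟩
  tr (turnMat b · A) ∎
  where
  open ≡-Reasoning
  A = bitsMat (b′ ∷ bs)
  ds = stepsFrom E (b ∷ b′ ∷ bs)
  absent : ∀ s → ∀ {M} → All (TileAt.BeyondE origin s) M → rooted M ≡ false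
  absent s bM = any-absent {farEdge origin E} (All.map (λ ((ne , _) , _) → ne) bM)
  split : ∀ b → let ds = stepsFrom E (b ∷ b′ ∷ bs) in
    + matchingCount rooted [] (pathVerts origin ds) (glueOf origin ds) (pathEdges origin ds) ≡ tr (turnMat b · A)
  split false = begin
    + next rooted [] ≡⟨ cong +_ (next-uncovered {rooted} {true} {false} (λ _ → refl) (absent E)) ⟩
    + rest true [] ℤ.+ + rest false ((move origin E , corner origin) ∷ [])
      ≡⟨ cong₂ ℤ._+_ (proj₁ (transfer (move origin E) E b′ bs true))
           (trans (cong +_ (rest-covered false)) (proj₂ (transfer (move origin E) E b′ bs false))) ⟩
    row₁ A true ℤ.+ row₂ A false ≡⟨ trace-false A ⟩
    tr (turnMat false · A) ∎
    where open Rec origin E false b′ bs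
  split true = begin
    + next rooted [] ≡⟨ cong +_ (next-uncovered {rooted} {false} {true} (absent N) (λ _ → refl)) ⟩
    + rest false [] ℤ.+ + rest true ((move origin N , corner origin) ∷ [])
      ≡⟨ cong₂ ℤ._+_ (proj₁ (transfer (move origin N) N b′ bs false))
           (trans (cong +_ (rest-covered true)) (proj₂ (transfer (move origin N) N b′ bs true))) ⟩
    row₁ A false ℤ.+ row₂ A true ≡⟨ trace-true A ⟩
    tr (turnMat true · A) ∎
    where open Rec origin E true b′ bs

-- Half-lattice words

-- The letter `false` is a half-lattice step up, `true` a step to the right.
Word : Set
Word = List Bool

-- The first component is the parity of x + y, which every letter flips; the second is the parity of
-- x, which only a step to the right flips.
Parity : Set
Parity = Bool × Bool

infixl 6 _⊕_
_⊕_ : Parity → Parity → Parity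
(a , b) ⊕ (c , d) = (a xor c) , (b xor d)

𝟎 : Parity
𝟎 = false , false

letter : Bool → Parity
letter l = true , l

parity : Word → Parity
parity [] = 𝟎
parity (l ∷ w) = letter l ⊕ parity w

⊕-assoc : ∀ u v w → (u ⊕ v) ⊕ w ≡ u ⊕ (v ⊕ w)
⊕-assoc (a , b) (c , d) (e , f) = cong₂ _,_ (BoolP.xor-assoc a c e) (BoolP.xor-assoc b d f)

⊕-comm : ∀ u v → u ⊕ v ≡ v ⊕ u
⊕-comm (a , b) (c , d) = cong₂ _,_ (BoolP.xor-comm a c) (BoolP.xor-comm b d)

⊕-self : ∀ u → u ⊕ u ≡ 𝟎
⊕-self (a , b) = cong₂ _,_ (BoolP.xor-same a) (BoolP.xor-same b)

⊕-identityʳ : ∀ u → u ⊕ 𝟎 ≡ u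
⊕-identityʳ (a , b) = cong₂ _,_ (BoolP.xor-identityʳ a) (BoolP.xor-identityʳ b)

⊕-cancel : ∀ u v → u ⊕ (u ⊕ v) ≡ v
⊕-cancel u v = trans (sym (⊕-assoc u u v)) (cong (_⊕ v) (⊕-self u))

⊕-cancelʳ : ∀ u v → (u ⊕ v) ⊕ u ≡ v
⊕-cancelʳ u v = trans (⊕-comm (u ⊕ v) u) (⊕-cancel u v)

parity-++ : ∀ w w′ → parity (w ++ w′) ≡ parity w ⊕ parity w′
parity-++ [] w′ = refl
parity-++ (l ∷ w) w′ = trans (cong (letter l ⊕_) (parity-++ w w′)) (sym (⊕-assoc (letter l) (parity w) (parity w′)))

-- The half-integer lattice path crosses one line x + y = c/2 per letter; the matrix of a crossing
-- depends only on the parities of c and of the abscissa.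
Φ : Parity → Bool → Mat
Φ (false , false) false = mat -[1+ 0 ] -[1+ 3 ] (+ 0) -[1+ 0 ]
Φ (false , false) true = mat -[1+ 0 ] -[1+ 1 ] (+ 0) -[1+ 0 ]
Φ (true , false) false = mat (+ 0) (+ 1) -[1+ 0 ] -[1+ 0 ]
Φ (true , false) true = mat (+ 0) -[1+ 0 ] (+ 1) (+ 1)
Φ (true , true) false = mat (+ 1) (+ 0) (+ 2) (+ 1)
Φ (true , true) true = mat (+ 0) (+ 1) -[1+ 0 ] -[1+ 2 ]
Φ (false , true) false = mat (+ 1) (+ 1) (+ 1) (+ 2)
Φ (false , true) true = mat (+ 0) (+ 1) -[1+ 0 ] (+ 3)

hol : Parity → Word → Mat
hol u [] = 1ᴹ
hol u (l ∷ w) = Φ u l · hol (u ⊕ letter l) w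

hol-++ : ∀ u w w′ → hol u (w ++ w′) ≡ hol u w · hol (u ⊕ parity w) w′
hol-++ u [] w′ = sym (trans (·-identityˡ (hol (u ⊕ 𝟎) w′)) (cong (λ v → hol v w′) (⊕-identityʳ u)))
hol-++ u (l ∷ w) w′ = begin
  Φ u l · hol (u ⊕ letter l) (w ++ w′) ≡⟨ cong (Φ u l ·_) (hol-++ (u ⊕ letter l) w w′) ⟩
  Φ u l · (hol (u ⊕ letter l) w · hol ((u ⊕ letter l) ⊕ parity w) w′) ≡⟨ sym (·-assoc (Φ u l) (hol (u ⊕ letter l) w) (hol ((u ⊕ letter l) ⊕ parity w) w′)) ⟩
  (Φ u l · hol (u ⊕ letter l) w) · hol ((u ⊕ letter l) ⊕ parity w) w′
    ≡⟨ cong (λ v → (Φ u l · hol (u ⊕ letter l) w) · hol v w′) (⊕-assoc u (letter l) (parity w)) ⟩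
  hol u (l ∷ w) · hol (u ⊕ parity (l ∷ w)) w′ ∎
  where open ≡-Reasoning

hol-split : ∀ w₁ w₂ u v → u ⊕ parity w₁ ≡ v → hol u (w₁ ++ w₂) ≡ hol u w₁ · hol v w₂
hol-split w₁ w₂ u v eq = trans (hol-++ u w₁ w₂) (cong (λ z → hol u w₁ · hol z w₂) eq)

closedTrace : Word → ℤ
closedTrace w = tr (hol 𝟎 (w ++ w))

WordPair : Word → Word → Set
WordPair w₁ w₂ = let v₁ = parity w₁ ; v₂ = parity w₂ in
  Holonomy (hol 𝟎 w₁) (hol v₁ w₁) (hol v₂ w₁) (hol (v₁ ⊕ v₂) w₁) (hol 𝟎 w₂) (hol v₁ w₂) (hol v₂ w₂) (hol (v₁ ⊕ v₂) w₂)

wordPair-init : WordPair (false ∷ []) (true ∷ [])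
wordPair-init = holonomy-init

holonomy-cong : ∀ {a b c d e f g h a′ b′ c′ d′ e′ f′ g′ h′} →
  a ≡ a′ → b ≡ b′ → c ≡ c′ → d ≡ d′ → e ≡ e′ → f ≡ f′ → g ≡ g′ → h ≡ h′ →
  Holonomy a b c d e f g h → Holonomy a′ b′ c′ d′ e′ f′ g′ h′
holonomy-cong refl refl refl refl refl refl refl refl H = H

module _ {w₁ w₂ : Word} (H : WordPair w₁ w₂) where
  private
    v₁ = parity w₁
    v₂ = parity w₂
    w₁₂ = w₁ ++ w₂
    v₁₂≡ : parity w₁₂ ≡ v₁ ⊕ v₂
    v₁₂≡ = parity-++ w₁ w₂

    split = hol-split w₁ w₂

    z₀ : hol 𝟎 w₁₂ ≡ hol 𝟎 w₁ · hol v₁ w₂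
    z₀ = split 𝟎 v₁ refl
    z₁ : hol v₁ w₁₂ ≡ hol v₁ w₁ · hol 𝟎 w₂
    z₁ = split v₁ 𝟎 (⊕-self v₁)
    z₃ : hol (v₁ ⊕ v₂) w₁₂ ≡ hol (v₁ ⊕ v₂) w₁ · hol v₂ w₂
    z₃ = split (v₁ ⊕ v₂) v₂ (⊕-cancelʳ v₁ v₂)
    z₂ : hol v₂ w₁₂ ≡ hol v₂ w₁ · hol (v₁ ⊕ v₂) w₂
    z₂ = split v₂ (v₁ ⊕ v₂) (⊕-comm v₂ v₁)
    v₁v₁₂ : v₁ ⊕ parity w₁₂ ≡ v₂
    v₁v₁₂ = trans (cong (v₁ ⊕_) v₁₂≡) (⊕-cancel v₁ v₂)
    v₁₂v₂ : parity w₁₂ ⊕ v₂ ≡ v₁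
    v₁₂v₂ = trans (cong (_⊕ v₂) v₁₂≡) (trans (cong (_⊕ v₂) (⊕-comm v₁ v₂)) (⊕-cancelʳ v₂ v₁))

  wordPairˡ : WordPair w₁ w₁₂
  wordPairˡ = holonomy-cong refl refl
    (cong (λ v → hol v w₁) (sym v₁₂≡)) (cong (λ v → hol v w₁) (sym v₁v₁₂))
    (sym z₀) (sym z₁) (trans (sym z₃) (cong (λ v → hol v w₁₂) (sym v₁₂≡))) (trans (sym z₂) (cong (λ v → hol v w₁₂) (sym v₁v₁₂)))
    (holonomyˡ H)

  wordPairʳ : WordPair w₁₂ w₂
  wordPairʳ = holonomy-cong
    (sym z₀) (trans (sym z₃) (cong (λ v → hol v w₁₂) (sym v₁₂≡))) (sym z₂) (trans (sym z₁) (cong (λ v → hol v w₁₂) (sym v₁₂v₂)))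
    refl (cong (λ v → hol v w₂) (sym v₁₂≡)) refl (cong (λ v → hol v w₂) (sym v₁₂v₂))
    (holonomyʳ H)

  closedTrace-++ : closedTrace w₁₂ ≡ tr ((hol 𝟎 w₁ · hol v₁ w₂) · (hol (v₁ ⊕ v₂) w₁ · hol v₂ w₂))
  closedTrace-++ = cong tr (trans (hol-++ 𝟎 w₁₂ w₁₂) (cong₂ _·_ z₀ (trans (cong (λ v → hol v w₁₂) v₁₂≡) z₃)))

closedTrace-split : ∀ w → closedTrace w ≡ tr (hol 𝟎 w · hol (parity w) w)
closedTrace-split w = cong tr (hol-++ 𝟎 w w)

module _ {w₁ w₂ : Word} (H : WordPair w₁ w₂) where
  private
    v₁ = parity w₁
    v₂ = parity w₂
    w₁₂ = w₁ ++ w₂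
    v₁₂≡ : parity w₁₂ ≡ v₁ ⊕ v₂
    v₁₂≡ = parity-++ w₁ w₂
    split = hol-split w₁ w₂

  closedTraceˡ : closedTrace (w₁ ++ w₁₂) ≡ closedTrace w₁ ℤ.* closedTrace w₁₂ ℤ.+ ℤ.- closedTrace w₂ ℤ.+ -[1+ 2 ]
  closedTraceˡ = begin
    closedTrace (w₁ ++ w₁₂) ≡⟨ closedTrace-++ (wordPairˡ H) ⟩
    tr ((hol 𝟎 w₁ · hol v₁ w₁₂) · (hol (v₁ ⊕ parity w₁₂) w₁ · hol (parity w₁₂) w₁₂))
      ≡⟨ cong₂ (λ A B → tr ((hol 𝟎 w₁ · A) · B)) (split v₁ 𝟎 (⊕-self v₁))
          (cong₂ _·_ (cong (λ v → hol v w₁) (trans (cong (v₁ ⊕_) v₁₂≡) (⊕-cancel v₁ v₂)))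
                     (trans (cong (λ v → hol v w₁₂) v₁₂≡) (split (v₁ ⊕ v₂) v₂ (⊕-cancelʳ v₁ v₂)))) ⟩
    tr ((hol 𝟎 w₁ · (hol v₁ w₁ · hol 𝟎 w₂)) · (hol v₂ w₁ · (hol (v₁ ⊕ v₂) w₁ · hol v₂ w₂))) ≡⟨ traceˡ H ⟩
    _ ≡⟨ cong₂ (λ a b → a ℤ.+ ℤ.- b ℤ.+ -[1+ 2 ]) (sym (cong₂ ℤ._*_ (closedTrace-split w₁) (closedTrace-++ H))) (sym (closedTrace-split w₂)) ⟩
    closedTrace w₁ ℤ.* closedTrace w₁₂ ℤ.+ ℤ.- closedTrace w₂ ℤ.+ -[1+ 2 ] ∎
    where open ≡-Reasoning

  closedTraceʳ : closedTrace (w₁₂ ++ w₂) ≡ closedTrace w₂ ℤ.* closedTrace w₁₂ ℤ.+ ℤ.- closedTrace w₁ ℤ.+ -[1+ 2 ]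
  closedTraceʳ = begin
    closedTrace (w₁₂ ++ w₂) ≡⟨ closedTrace-++ (wordPairʳ H) ⟩
    tr ((hol 𝟎 w₁₂ · hol (parity w₁₂) w₂) · (hol (parity w₁₂ ⊕ v₂) w₁₂ · hol v₂ w₂))
      ≡⟨ cong₂ (λ A B → tr (A · (B · hol v₂ w₂))) (cong₂ _·_ (split 𝟎 v₁ refl) (cong (λ v → hol v w₂) v₁₂≡))
          (trans (cong (λ v → hol v w₁₂) (trans (cong (_⊕ v₂) v₁₂≡) (trans (cong (_⊕ v₂) (⊕-comm v₁ v₂)) (⊕-cancelʳ v₂ v₁)))) (split v₁ 𝟎 (⊕-self v₁))) ⟩
    tr (((hol 𝟎 w₁ · hol v₁ w₂) · hol (v₁ ⊕ v₂) w₂) · ((hol v₁ w₁ · hol 𝟎 w₂) · hol v₂ w₂)) ≡⟨ traceʳ H ⟩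
    _ ≡⟨ cong₂ (λ a b → a ℤ.+ ℤ.- b ℤ.+ -[1+ 2 ]) (sym (cong₂ ℤ._*_ (closedTrace-split w₂) (closedTrace-++ H))) (sym (closedTrace-split w₁)) ⟩
    closedTrace w₂ ℤ.* closedTrace w₁₂ ℤ.+ ℤ.- closedTrace w₁ ℤ.+ -[1+ 2 ] ∎
    where open ≡-Reasoning

-- Turns at the second tile of a diagonal crossing, both tiles of the next crossing and the first tile of the
-- following diagonal crossing; x is the parity of the abscissa.
blockBit : Bool → Bool → Bool → Bool × Bool × Bool × Bool
blockBit false false false = true , true , false , false
blockBit false false true = true , true , false , true
blockBit false true false = true , false , true , true
blockBit false true true = false , false , true , true
blockBit true false false = false , false , true , true
blockBit true false true = true , false , true , true
blockBit true true false = true , true , false , true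
blockBit true true true = true , true , false , false

Pairs : Set
Pairs = List (Bool × Bool)

flat : Pairs → Word
flat [] = []
flat ((l , l′) ∷ ps) = l ∷ l′ ∷ flat ps

blocks : Bool → Pairs → Word
blocks x [] = []
blocks x ((l , l′) ∷ ps) = let (a , b , c , d) = blockBit x l l′ in a ∷ b ∷ c ∷ d ∷ blocks ((x xor l) xor l′) ps

-- A block ends with the first turn of the following diagonal crossing, while a crossing sequence
-- starts with both turns of its first diagonal. The same bits are therefore read one place out of
-- step, the missing first one being supplied as `prev`.
turns : Bool → Bool → Pairs → Word
turns prev x [] = []
turns prev x ((l , l′) ∷ ps) = let (a , b , c , d) = blockBit x l l′ in prev ∷ a ∷ b ∷ c ∷ turns d ((x xor l) xor l′) ps

lastTurn : Bool → Bool → Pairs → Bool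
lastTurn prev x [] = prev
lastTurn prev x ((l , l′) ∷ ps) = lastTurn (proj₂ (proj₂ (proj₂ (blockBit x l l′)))) ((x xor l) xor l′) ps

turns-blocks : ∀ prev x ps → turns prev x ps ++ lastTurn prev x ps ∷ [] ≡ prev ∷ blocks x ps
turns-blocks prev x [] = refl
turns-blocks prev x ((l , l′) ∷ ps) = let (a , b , c , d) = blockBit x l l′ in
  cong (λ w → prev ∷ a ∷ b ∷ c ∷ w) (turns-blocks d ((x xor l) xor l′) ps)

-- change of basis at the even positions with odd abscissa
gauge : Bool → Mat
gauge false = 1ᴹ
gauge true = mat (+ 0) -[1+ 0 ] -[1+ 0 ] (+ 0)

gauge² : ∀ x → gauge x · gauge x ≡ 1ᴹ
gauge² false = refl
gauge² true = refl

blockMat : Bool → Bool → Bool → Mat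
blockMat x l l′ = let (a , b , c , d) = blockBit x l l′ in bitsMat (a ∷ b ∷ c ∷ d ∷ [])

-- Four tile matrices equal two letter matrices up to the change of basis. The determinant explains
-- the form of `gauge`: `turnMat false` has determinant -1, and the blocks with an odd number of
-- straight tiles are exactly those that change the parity of the abscissa.
blockMat-gauge : ∀ x l l′ → blockMat x l l′ · gauge ((x xor l) xor l′) ≡ gauge x · (Φ (false , x) l · Φ (true , x xor l) l′)
blockMat-gauge false false false = refl
blockMat-gauge false false true = refl
blockMat-gauge false true false = refl
blockMat-gauge false true true = refl
blockMat-gauge true false false = refl
blockMat-gauge true false true = refl
blockMat-gauge true true false = refl
blockMat-gauge true true true = refl

bitsMat-++ : ∀ bs bs′ → bitsMat (bs ++ bs′) ≡ bitsMat bs · bitsMat bs′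
bitsMat-++ bs bs′ = trans (cong ∏ (ListP.map-++ turnMat bs bs′)) (∏-++ (map turnMat bs) (map turnMat bs′))

abscissa : Bool → Pairs → Bool
abscissa x [] = x
abscissa x ((l , l′) ∷ ps) = abscissa ((x xor l) xor l′) ps

blocks-hol : ∀ x ps → bitsMat (blocks x ps) · gauge (abscissa x ps) ≡ gauge x · hol (false , x) (flat ps)
blocks-hol x [] = trans (·-identityˡ (gauge x)) (sym (·-identityʳ (gauge x)))
blocks-hol x ((l , l′) ∷ ps) = begin
  bitsMat (block ++ blocks y ps) · g ≡⟨ cong (_· g) (bitsMat-++ block (blocks y ps)) ⟩
  (blockMat x l l′ · bitsMat (blocks y ps)) · g ≡⟨ ·-assoc (blockMat x l l′) (bitsMat (blocks y ps)) g ⟩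
  blockMat x l l′ · (bitsMat (blocks y ps) · g) ≡⟨ cong (blockMat x l l′ ·_) (blocks-hol y ps) ⟩
  blockMat x l l′ · (gauge y · hol (false , y) (flat ps)) ≡⟨ sym (·-assoc (blockMat x l l′) (gauge y) (hol (false , y) (flat ps))) ⟩
  (blockMat x l l′ · gauge y) · hol (false , y) (flat ps) ≡⟨ cong (_· hol (false , y) (flat ps)) (blockMat-gauge x l l′) ⟩
  (gauge x · (Φ (false , x) l · Φ (true , x xor l) l′)) · hol (false , y) (flat ps)
    ≡⟨ reassoc ((` gauge x ⊙ (` Φ (false , x) l ⊙ ` Φ (true , x xor l) l′)) ⊙ ` hol (false , y) (flat ps))
         (` gauge x ⊙ (` Φ (false , x) l ⊙ (` Φ (true , x xor l) l′ ⊙ ` hol (false , y) (flat ps)))) refl ⟩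
  gauge x · (Φ (false , x) l · (Φ (true , x xor l) l′ · hol (false , y) (flat ps))) ∎
  where
  open ≡-Reasoning
  y = (x xor l) xor l′
  g = gauge (abscissa y ps)
  block = let (a , b , c , d) = blockBit x l l′ in a ∷ b ∷ c ∷ d ∷ []

-- Moving the leading turn to the end under the trace realigns the sequence with whole blocks. Since
-- the abscissa parity returns to its initial value, the two changes of basis at the ends are equal
-- and cancel.
turns-trace : ∀ t x p ps → lastTurn t x (p ∷ ps) ≡ t → abscissa x (p ∷ ps) ≡ x →
  tr (bitsMat (turns t x (p ∷ ps))) ≡ tr (hol (false , x) (flat (p ∷ ps)))
turns-trace t x p@(l , l′) ps eqt eqx = begin
  tr (turnMat t · bitsMat tail) ≡⟨ tr-comm (turnMat t) (bitsMat tail) ⟩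
  tr (bitsMat tail · turnMat t) ≡⟨ cong (λ Z → tr (bitsMat tail · Z)) (sym (·-identityʳ (turnMat t))) ⟩
  tr (bitsMat tail · bitsMat (t ∷ [])) ≡⟨ cong tr (sym (bitsMat-++ tail (t ∷ []))) ⟩
  tr (bitsMat (tail ++ t ∷ [])) ≡⟨ cong (λ z → tr (bitsMat z)) (trans (cong (λ z → tail ++ z ∷ []) (sym eqt)) (ListP.∷-injectiveʳ (turns-blocks t x (p ∷ ps)))) ⟩
  tr B ≡⟨ cong tr (trans (sym (·-identityʳ B)) (cong (B ·_) (sym (gauge² x)))) ⟩
  tr (B · (gauge x · gauge x)) ≡⟨ cong tr (sym (·-assoc B (gauge x) (gauge x))) ⟩
  tr ((B · gauge x) · gauge x) ≡⟨ cong (λ z → tr (z · gauge x)) (trans (cong (λ z → B · gauge z) (sym eqx)) (blocks-hol x (p ∷ ps))) ⟩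
  tr ((gauge x · D) · gauge x) ≡⟨ tr-comm (gauge x · D) (gauge x) ⟩
  tr (gauge x · (gauge x · D)) ≡⟨ cong tr (sym (·-assoc (gauge x) (gauge x) D)) ⟩
  tr ((gauge x · gauge x) · D) ≡⟨ cong (λ z → tr (z · D)) (gauge² x) ⟩
  tr (1ᴹ · D) ≡⟨ cong tr (·-identityˡ D) ⟩
  tr D ∎
  where
  open ≡-Reasoning
  tail = let (a , b , c , d) = blockBit x l l′ in a ∷ b ∷ c ∷ turns d ((x xor l) xor l′) ps
  B = bitsMat (blocks x (p ∷ ps))
  D = hol (false , x) (flat (p ∷ ps))

complement : Pairs → Pairs
complement = map (λ (l , l′) → not l , not l′)

-- Reflection in the main diagonal exchanges the two letters. A cell on an integer antidiagonal has
-- coordinates of opposite parity, so exchanging them negates `x`. Fans around a vertex are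
-- preserved, hence so are the turns.
turns-complement : ∀ t x ps → turns t (not x) (complement ps) ≡ turns t x ps
turns-complement t x [] = refl
turns-complement t x ((l , l′) ∷ ps) = onBlock x l l′
  where
  onBlock : ∀ x l l′ → turns t (not x) ((not l , not l′) ∷ complement ps) ≡ turns t x ((l , l′) ∷ ps)
  onBlock false false false = cong (λ w → _ ∷ _ ∷ _ ∷ _ ∷ w) (turns-complement _ _ ps)
  onBlock false false true = cong (λ w → _ ∷ _ ∷ _ ∷ _ ∷ w) (turns-complement _ _ ps)
  onBlock false true false = cong (λ w → _ ∷ _ ∷ _ ∷ _ ∷ w) (turns-complement _ _ ps)
  onBlock false true true = cong (λ w → _ ∷ _ ∷ _ ∷ _ ∷ w) (turns-complement _ _ ps)
  onBlock true false false = cong (λ w → _ ∷ _ ∷ _ ∷ _ ∷ w) (turns-complement _ _ ps)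
  onBlock true false true = cong (λ w → _ ∷ _ ∷ _ ∷ _ ∷ w) (turns-complement _ _ ps)
  onBlock true true false = cong (λ w → _ ∷ _ ∷ _ ∷ _ ∷ w) (turns-complement _ _ ps)
  onBlock true true true = cong (λ w → _ ∷ _ ∷ _ ∷ _ ∷ w) (turns-complement _ _ ps)

-- The crossing sequence begins with the first diagonal after the origin, two letters into the word;
-- those two letters appear at its end.
tr-rotate : ∀ a b w → parity (a ∷ b ∷ w) ≡ 𝟎 → tr (hol (false , a xor b) (w ++ a ∷ b ∷ [])) ≡ tr (hol 𝟎 (a ∷ b ∷ w))
tr-rotate a b w eq = begin
  tr (hol u (w ++ s)) ≡⟨ cong tr (hol-++ u w s) ⟩
  tr (hol u w · hol (u ⊕ parity w) s) ≡⟨ cong (λ v → tr (hol u w · hol v s)) u-back ⟩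
  tr (hol u w · hol 𝟎 s) ≡⟨ tr-comm (hol u w) (hol 𝟎 s) ⟩
  tr (hol 𝟎 s · hol u w) ≡⟨ cong (λ v → tr (hol 𝟎 s · hol v w)) (sym s-parity) ⟩
  tr (hol 𝟎 s · hol (𝟎 ⊕ parity s) w) ≡⟨ cong tr (sym (hol-++ 𝟎 s w)) ⟩
  tr (hol 𝟎 (a ∷ b ∷ w)) ∎
  where
  open ≡-Reasoning
  u : Parity
  u = false , a xor b
  s : Word
  s = a ∷ b ∷ []
  s-parity : parity s ≡ u
  s-parity = cong (λ z → false , a xor z) (BoolP.xor-identityʳ b)
  u-back : u ⊕ parity w ≡ 𝟎
  u-back = trans (cong (_⊕ parity w) (sym s-parity)) (trans (sym (parity-++ s w)) eq)

-- Christoffel paths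

-- (x , y) lies on or just above the line of slope p/q through the origin, at vertical distance < (p + q)/q.
Inside : ℕ → ℕ → ℕ → ℕ → Set
Inside p q x y = p * x ≤ q * y × q * y < p * x + (p + q)

data Path (Q : ℕ → ℕ → Set) : ℕ → ℕ → Word → ℕ → ℕ → Set where
  nil : ∀ {x y} → Q x y → Path Q x y [] x y
  up : ∀ {x y w x′ y′} → Q x y → Path Q x (suc y) w x′ y′ → Path Q x y (false ∷ w) x′ y′
  right : ∀ {x y w x′ y′} → Q x y → Path Q (suc x) y w x′ y′ → Path Q x y (true ∷ w) x′ y′

module _ {Q : ℕ → ℕ → Set} where
  path-mono : ∀ {x y w x′ y′} → Path Q x y w x′ y′ → x ≤ x′ × y ≤ y′
  path-mono (nil _) = ℕP.≤-refl , ℕP.≤-refl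
  path-mono (up _ π) = proj₁ (path-mono π) , ℕP.<⇒≤ (proj₂ (path-mono π))
  path-mono (right _ π) = ℕP.<⇒≤ (proj₁ (path-mono π)) , proj₂ (path-mono π)

  path-head : ∀ {x y w x′ y′} → Path Q x y w x′ y′ → Q x y
  path-head (nil q) = q
  path-head (up q _) = q
  path-head (right q _) = q

  path-++ : ∀ {x y w x′ y′ w′ x″ y″} → Path Q x y w x′ y′ → Path Q x′ y′ w′ x″ y″ → Path Q x y (w ++ w′) x″ y″
  path-++ (nil _) ρ = ρ
  path-++ (up q π) ρ = up q (path-++ π ρ)
  path-++ (right q π) ρ = right q (path-++ π ρ)

  path-shift : ∀ {Q′ : ℕ → ℕ → Set} (a b : ℕ) {x y w x′ y′} →
    (∀ {u v} → u ≤ x′ → v ≤ y′ → Q u v → Q′ (u + a) (v + b)) → Path Q x y w x′ y′ → Path Q′ (x + a) (y + b) w (x′ + a) (y′ + b)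
  path-shift a b h π@(nil q) = nil (h ℕP.≤-refl ℕP.≤-refl q)
  path-shift a b h π@(up q π′) = let (l , m) = path-mono π in up (h l m q) (path-shift a b h π′)
  path-shift a b h π@(right q π′) = let (l , m) = path-mono π in right (h l m q) (path-shift a b h π′)

  path-map : ∀ {Q′ : ℕ → ℕ → Set} {x y w x′ y′} →
    (∀ {u v} → u ≤ x′ → v ≤ y′ → Q u v → Q′ u v) → Path Q x y w x′ y′ → Path Q′ x y w x′ y′
  path-map h π@(nil q) = nil (h ℕP.≤-refl ℕP.≤-refl q)
  path-map h π@(up q π′) = let (l , m) = path-mono π in up (h l m q) (path-map h π′)
  path-map h π@(right q π′) = let (l , m) = path-mono π in right (h l m q) (path-map h π′)

  -- Passes from the upper left corner (x , y + 1) of a half-lattice cell to the index (x , y) of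
  -- the cell.
  path-lower : ∀ {x y w x′ y′} → Path Q x (suc y) w x′ (suc y′) → Path (λ a b → Q a (suc b)) x y w x′ y′
  path-lower (nil q) = nil q
  path-lower (up q π) = up q (path-lower π)
  path-lower (right q π) = right q (path-lower π)

  path-mirror : ∀ {x y w x′ y′} → Path Q x y w x′ y′ → Path (λ a b → Q b a) y x (map not w) y′ x′
  path-mirror (nil q) = nil q
  path-mirror (up q π) = right q (path-mirror π)
  path-mirror (right q π) = up q (path-mirror π)

factors-positive : ∀ a b {c} → a * b ≡ c + 1 → 1 ≤ a × 1 ≤ b
factors-positive zero b {c} eq = ⊥-elim (ℕP.0≢1+n (trans eq (ℕP.+-comm c 1)))
factors-positive (suc a) zero {c} eq = ⊥-elim (ℕP.0≢1+n (trans (sym (ℕP.*-zeroʳ a)) (trans eq (ℕP.+-comm c 1))))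
factors-positive (suc a) (suc b) eq = s≤s z≤n , s≤s z≤n

module Farey (p₁ q₁ p₂ q₂ : ℕ) (det : p₁ * q₂ ≡ p₂ * q₁ + 1) where
  private
    n₁ = p₁ + q₁
    n₂ = p₂ + q₂

    factors = factors-positive p₁ q₂ det

    n₁-pos : 1 ≤ n₁
    n₁-pos = ℕP.≤-trans (proj₁ factors) (ℕP.m≤m+n p₁ q₁)

    n₂-pos : 1 ≤ n₂
    n₂-pos = ℕP.≤-trans (proj₂ factors) (ℕP.m≤n+m q₂ p₂)

    cancel-≤ : ∀ {n a b} → 1 ≤ n → n * a ≤ n * b → a ≤ b
    cancel-≤ {suc n} _ = ℕP.*-cancelˡ-≤ (suc n)

    cancel-< : ∀ n {a b} → n * a < n * b → a < b
    cancel-< n {a} {b} = ℕP.*-cancelˡ-< n a b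

    -- For d the defect q₁y − p₁x: the defects with respect to the two slopes are proportional up to x + y.
    first-defect : ∀ x y d → q₁ * y ≡ p₁ * x + d → n₁ * (q₂ * y) ≡ n₁ * (p₂ * x) + (n₂ * d + (x + y))
    first-defect x y d eq = begin
      n₁ * (q₂ * y) ≡⟨ l₁ p₁ q₁ q₂ y ⟩
      (p₁ * q₂) * y + q₂ * (q₁ * y) ≡⟨ cong₂ (λ a b → a * y + q₂ * b) det eq ⟩
      (p₂ * q₁ + 1) * y + q₂ * (p₁ * x + d) ≡⟨ l₂ p₁ q₁ p₂ q₂ x y d ⟩
      p₂ * (q₁ * y) + y + (p₁ * q₂) * x + q₂ * d ≡⟨ cong₂ (λ a b → p₂ * a + y + b * x + q₂ * d) eq det ⟩
      p₂ * (p₁ * x + d) + y + (p₂ * q₁ + 1) * x + q₂ * d ≡⟨ l₃ p₁ q₁ p₂ q₂ x y d ⟩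
      n₁ * (p₂ * x) + (n₂ * d + (x + y)) ∎
      where
      open ≡-Reasoning
      l₁ : ∀ p₁ q₁ q₂ y → (p₁ + q₁) * (q₂ * y) ≡ (p₁ * q₂) * y + q₂ * (q₁ * y)
      l₁ = ℕSolver.solve-∀
      l₂ : ∀ p₁ q₁ p₂ q₂ x y d → (p₂ * q₁ + 1) * y + q₂ * (p₁ * x + d) ≡ p₂ * (q₁ * y) + y + (p₁ * q₂) * x + q₂ * d
      l₂ = ℕSolver.solve-∀
      l₃ : ∀ p₁ q₁ p₂ q₂ x y d → p₂ * (p₁ * x + d) + y + (p₂ * q₁ + 1) * x + q₂ * d ≡ (p₁ + q₁) * (p₂ * x) + ((p₂ + q₂) * d + (x + y))
      l₃ = ℕSolver.solve-∀

    second-defect : ∀ x y d → q₂ * y ≡ p₂ * x + d → n₂ * (q₁ * y) + (x + y) ≡ n₂ * (p₁ * x) + n₁ * d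
    second-defect x y d eq = begin
      n₂ * (q₁ * y) + (x + y) ≡⟨ l₁ q₁ p₂ q₂ x y ⟩
      (p₂ * q₁ + 1) * y + q₁ * (q₂ * y) + x ≡⟨ cong₂ (λ a b → a * y + q₁ * b + x) (sym det) eq ⟩
      (p₁ * q₂) * y + q₁ * (p₂ * x + d) + x ≡⟨ l₂ p₁ q₁ p₂ q₂ x y d ⟩
      p₁ * (q₂ * y) + (p₂ * q₁ + 1) * x + q₁ * d ≡⟨ cong₂ (λ a b → p₁ * a + b * x + q₁ * d) eq (sym det) ⟩
      p₁ * (p₂ * x + d) + (p₁ * q₂) * x + q₁ * d ≡⟨ l₃ p₁ q₁ p₂ q₂ x d ⟩
      n₂ * (p₁ * x) + n₁ * d ∎
      where
      open ≡-Reasoning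
      l₁ : ∀ q₁ p₂ q₂ x y → (p₂ + q₂) * (q₁ * y) + (x + y) ≡ (p₂ * q₁ + 1) * y + q₁ * (q₂ * y) + x
      l₁ = ℕSolver.solve-∀
      l₂ : ∀ p₁ q₁ p₂ q₂ x y d → (p₁ * q₂) * y + q₁ * (p₂ * x + d) + x ≡ p₁ * (q₂ * y) + (p₂ * q₁ + 1) * x + q₁ * d
      l₂ = ℕSolver.solve-∀
      l₃ : ∀ p₁ q₁ p₂ q₂ x d → p₁ * (p₂ * x + d) + (p₁ * q₂) * x + q₁ * d ≡ (p₂ + q₂) * (p₁ * x) + (p₁ + q₁) * d
      l₃ = ℕSolver.solve-∀

  defect : ∀ p q x y → Inside p q x y → ∃ λ d → q * y ≡ p * x + d × d < p + q
  defect p q x y (l , u) = q * y ℕ.∸ p * x , sym (ℕP.m+[n∸m]≡n l) ,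
    ℕP.+-cancelˡ-< (p * x) _ _ (subst (_< p * x + (p + q)) (sym (ℕP.m+[n∸m]≡n l)) u)

  -- Along the first word x + y ≤ n₁, and `first-defect` then confines the defect q₂y - p₂x between
  -- 0 and n₂. Adding the defect of the first slope, which is less than n₁, gives the strip of the
  -- mediant.
  inside-first : ∀ {x y} → x ≤ q₁ → y ≤ p₁ → Inside p₁ q₁ x y → Inside (p₁ + p₂) (q₁ + q₂) x y
  inside-first {x} {y} x≤ y≤ ins with defect p₁ q₁ x y ins
  ... | d , eq , d< = lower , upper
    where
    open ℕP.≤-Reasoning
    low₂ : p₂ * x ≤ q₂ * y
    low₂ = cancel-≤ n₁-pos (subst (n₁ * (p₂ * x) ≤_) (sym (first-defect x y d eq)) (ℕP.m≤m+n _ _))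
    lower : (p₁ + p₂) * x ≤ (q₁ + q₂) * y
    lower = subst₂ _≤_ (sym (ℕP.*-distribʳ-+ x p₁ p₂)) (sym (ℕP.*-distribʳ-+ y q₁ q₂)) (ℕP.+-mono-≤ (proj₁ ins) low₂)
    rearrange : ∀ a n₁ n₂ d c → suc (n₁ * a + (n₂ * d + c)) + n₂ ≡ suc (n₁ * a + (n₂ * suc d + c))
    rearrange = ℕSolver.solve-∀
    collect : ∀ a n₁ n₂ → n₁ * a + (n₂ * n₁ + n₁) ≡ n₁ * (a + n₂ + 1)
    collect = ℕSolver.solve-∀
    high₂ : q₂ * y < p₂ * x + n₂ + 1
    high₂ = cancel-< n₁ (begin-strict
      n₁ * (q₂ * y) ≡⟨ first-defect x y d eq ⟩
      n₁ * (p₂ * x) + (n₂ * d + (x + y)) <⟨ ℕP.m<m+n _ n₂-pos ⟩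
      n₁ * (p₂ * x) + (n₂ * d + (x + y)) + n₂ ≡⟨ ℕP.suc-injective (rearrange (p₂ * x) n₁ n₂ d (x + y)) ⟩
      n₁ * (p₂ * x) + (n₂ * suc d + (x + y))
        ≤⟨ ℕP.+-monoʳ-≤ (n₁ * (p₂ * x)) (ℕP.+-mono-≤ (ℕP.*-monoʳ-≤ n₂ d<) (subst (x + y ≤_) (ℕP.+-comm q₁ p₁) (ℕP.+-mono-≤ x≤ y≤))) ⟩
      n₁ * (p₂ * x) + (n₂ * n₁ + n₁) ≡⟨ collect (p₂ * x) n₁ n₂ ⟩
      n₁ * (p₂ * x + n₂ + 1) ∎)
    sum : ∀ n₁ p₁ p₂ q₂ x → (p₁ * x + n₁) + (p₂ * x + (p₂ + q₂)) ≡ (p₁ + p₂) * x + (n₁ + (p₂ + q₂))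
    sum = ℕSolver.solve-∀
    regroup : ∀ p₁ q₁ p₂ q₂ → (p₁ + q₁) + (p₂ + q₂) ≡ (p₁ + p₂) + (q₁ + q₂)
    regroup = ℕSolver.solve-∀
    upper : (q₁ + q₂) * y < (p₁ + p₂) * x + ((p₁ + p₂) + (q₁ + q₂))
    upper = begin-strict
      (q₁ + q₂) * y ≡⟨ ℕP.*-distribʳ-+ y q₁ q₂ ⟩
      q₁ * y + q₂ * y <⟨ ℕP.+-mono-<-≤ (proj₂ ins) (ℕ.s≤s⁻¹ (subst (q₂ * y <_) (ℕP.+-comm (p₂ * x + n₂) 1) high₂)) ⟩
      (p₁ * x + n₁) + (p₂ * x + n₂) ≡⟨ sum n₁ p₁ p₂ q₂ x ⟩
      (p₁ + p₂) * x + (n₁ + n₂) ≡⟨ cong (λ z → (p₁ + p₂) * x + z) (regroup p₁ q₁ p₂ q₂) ⟩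
      (p₁ + p₂) * x + ((p₁ + p₂) + (q₁ + q₂)) ∎

  -- Shifting the origin to (q₁ , p₁) adds p₁q₂ - p₂q₁ = 1 to the mediant defect. This compensates
  -- for the defect of the first slope, which `second-defect` bounds only by -1 from below.
  inside-second : ∀ {x y} → x ≤ q₂ → y ≤ p₂ → Inside p₂ q₂ x y → Inside (p₁ + p₂) (q₁ + q₂) (x + q₁) (y + p₁)
  inside-second {x} {y} x≤ y≤ ins with defect p₂ q₂ x y ins
  ... | d , eq , d< = lower , upper
    where
    open ℕP.≤-Reasoning
    lhs : ∀ p₁ p₂ q₁ x → (p₁ + p₂) * (x + q₁) ≡ (p₁ * x + p₂ * x) + (p₁ * q₁ + p₂ * q₁)
    lhs = ℕSolver.solve-∀
    rhs : (q₁ + q₂) * (y + p₁) ≡ (q₁ * y + 1 + q₂ * y) + (p₁ * q₁ + p₂ * q₁)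
    rhs = trans (r₁ q₁ q₂ p₁ y) (trans (cong (λ z → q₁ * y + q₂ * y + (p₁ * q₁ + z)) det) (r₂ (q₁ * y) (q₂ * y) (p₁ * q₁) (p₂ * q₁)))
      where
      r₁ : ∀ q₁ q₂ p₁ y → (q₁ + q₂) * (y + p₁) ≡ q₁ * y + q₂ * y + (p₁ * q₁ + p₁ * q₂)
      r₁ = ℕSolver.solve-∀
      r₂ : ∀ a b c e → a + b + (c + (e + 1)) ≡ (a + 1 + b) + (c + e)
      r₂ = ℕSolver.solve-∀
    distrib-suc : ∀ n a → n * a + n ≡ n * (a + 1)
    distrib-suc = ℕSolver.solve-∀
    low₁ : p₁ * x ≤ q₁ * y + 1
    low₁ = cancel-≤ n₂-pos (begin
      n₂ * (p₁ * x) ≤⟨ ℕP.m≤m+n _ (n₁ * d) ⟩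
      n₂ * (p₁ * x) + n₁ * d ≡⟨ sym (second-defect x y d eq) ⟩
      n₂ * (q₁ * y) + (x + y) ≤⟨ ℕP.+-monoʳ-≤ (n₂ * (q₁ * y)) (subst (x + y ≤_) (ℕP.+-comm q₂ p₂) (ℕP.+-mono-≤ x≤ y≤)) ⟩
      n₂ * (q₁ * y) + n₂ ≡⟨ distrib-suc n₂ (q₁ * y) ⟩
      n₂ * (q₁ * y + 1) ∎)
    lower : (p₁ + p₂) * (x + q₁) ≤ (q₁ + q₂) * (y + p₁)
    lower = subst₂ _≤_ (sym (lhs p₁ p₂ q₁ x)) (sym rhs) (ℕP.+-monoˡ-≤ (p₁ * q₁ + p₂ * q₁) (ℕP.+-mono-≤ low₁ (proj₁ ins)))
    collect : ∀ a n₁ n₂ d → (n₂ * a + n₁ * d) + n₁ ≡ n₂ * a + n₁ * suc d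
    collect = ℕSolver.solve-∀
    collect′ : ∀ a n₁ n₂ → n₂ * a + n₁ * n₂ ≡ n₂ * (a + n₁)
    collect′ = ℕSolver.solve-∀
    high₁ : q₁ * y < p₁ * x + n₁
    high₁ = cancel-< n₂ (begin-strict
      n₂ * (q₁ * y) ≤⟨ ℕP.m≤m+n _ (x + y) ⟩
      n₂ * (q₁ * y) + (x + y) ≡⟨ second-defect x y d eq ⟩
      n₂ * (p₁ * x) + n₁ * d <⟨ ℕP.m<m+n _ n₁-pos ⟩
      (n₂ * (p₁ * x) + n₁ * d) + n₁ ≡⟨ collect (p₁ * x) n₁ n₂ d ⟩
      n₂ * (p₁ * x) + n₁ * suc d ≤⟨ ℕP.+-monoʳ-≤ (n₂ * (p₁ * x)) (ℕP.*-monoʳ-≤ n₁ d<) ⟩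
      n₂ * (p₁ * x) + n₁ * n₂ ≡⟨ collect′ (p₁ * x) n₁ n₂ ⟩
      n₂ * (p₁ * x + n₁) ∎)
    sum : ∀ p₁ q₁ p₂ q₂ x c → ((p₁ * x + (p₁ + q₁)) + (p₂ * x + (p₂ + q₂))) + c ≡ ((p₁ * x + p₂ * x) + c) + ((p₁ + p₂) + (q₁ + q₂))
    sum = ℕSolver.solve-∀
    upper : (q₁ + q₂) * (y + p₁) < (p₁ + p₂) * (x + q₁) + ((p₁ + p₂) + (q₁ + q₂))
    upper = begin-strict
      (q₁ + q₂) * (y + p₁) ≡⟨ rhs ⟩
      (q₁ * y + 1 + q₂ * y) + (p₁ * q₁ + p₂ * q₁)
        <⟨ ℕP.+-monoˡ-< (p₁ * q₁ + p₂ * q₁) (ℕP.+-mono-≤-< (subst (_≤ p₁ * x + n₁) (ℕP.+-comm 1 (q₁ * y)) high₁) (proj₂ ins)) ⟩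
      ((p₁ * x + n₁) + (p₂ * x + n₂)) + (p₁ * q₁ + p₂ * q₁) ≡⟨ sum p₁ q₁ p₂ q₂ x (p₁ * q₁ + p₂ * q₁) ⟩
      ((p₁ * x + p₂ * x) + (p₁ * q₁ + p₂ * q₁)) + ((p₁ + p₂) + (q₁ + q₂))
        ≡⟨ cong (_+ ((p₁ + p₂) + (q₁ + q₂))) (sym (lhs p₁ p₂ q₁ x)) ⟩
      (p₁ + p₂) * (x + q₁) + ((p₁ + p₂) + (q₁ + q₂)) ∎

-- A step up adds q to q·y - p·x and a step to the right subtracts p. In a strip with p + q values
-- exactly one of the two steps stays inside, so the word is forced: it is the upper Christoffel
-- word.
SlopePath : ℕ → ℕ → Word → Set
SlopePath p q w = Path (Inside p q) 0 0 w q p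

slopePath-mediant : ∀ {p₁ q₁ p₂ q₂ w₁ w₂} → p₁ * q₂ ≡ p₂ * q₁ + 1 →
  SlopePath p₁ q₁ w₁ → SlopePath p₂ q₂ w₂ → SlopePath (p₁ + p₂) (q₁ + q₂) (w₁ ++ w₂)
slopePath-mediant {p₁} {q₁} {p₂} {q₂} {w₁} {w₂} det π₁ π₂ =
  path-++ (path-map inside-first π₁)
    (subst₂ (Path (Inside (p₁ + p₂) (q₁ + q₂)) q₁ p₁ w₂) (ℕP.+-comm q₂ q₁) (ℕP.+-comm p₂ p₁) (path-shift q₁ p₁ inside-second π₂))
  where open Farey p₁ q₁ p₂ q₂ det

slopePath-∞ : SlopePath 1 0 (false ∷ [])
slopePath-∞ = up (z≤n , s≤s z≤n) (nil (z≤n , s≤s z≤n))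

slopePath-0 : SlopePath 0 1 (true ∷ [])
slopePath-0 = right (z≤n , s≤s z≤n) (nil (z≤n , s≤s z≤n))

-- Crossings of a line

div-mod : ∀ n {x k r} → x ≡ r + k * n → r < n → x /′ n ≡ k × x %′ n ≡ r
div-mod (suc n) {k = k} {r} refl r<n = quotient , trans (DivMod.[m+kn]%n≡m%n r k (suc n)) (DivMod.m<n⇒m%n≡m r<n)
  where
  quotient : (r + k * suc n) DivMod./ suc n ≡ k
  quotient = trans (DivMod.+-distrib-/-∣ʳ r (divides k refl))
    (cong₂ _+_ (DivMod.m<n⇒m/n≡0 r<n) (DivMod.m*n/n≡m k (suc n)))

rem-zero : ∀ n m → 1 ≤ n → (m * n) /′ n ≡ m × ((m * n) %′ n ≡ᵇ 0) ≡ true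
rem-zero n m n>0 = let (a , b) = div-mod n {m * n} {m} {0} refl n>0 in a , cong (_≡ᵇ 0) b

rem-nonzero : ∀ n k → 1 ≤ n → (∀ m → k ≢ m * n) → (k %′ n ≡ᵇ 0) ≡ false
rem-nonzero (suc n) k _ h with k DivMod.% suc n in eq
... | zero = ⊥-elim (h (k DivMod./ suc n) (trans (DivMod.m≡m%n+[m/n]*n k (suc n)) (cong (_+ (k DivMod./ suc n) * suc n) eq)))
... | suc _ = refl

<ᵇ-true : ∀ {m n} → m < n → (m <ᵇ n) ≡ true
<ᵇ-true {zero} {suc n} _ = refl
<ᵇ-true {suc m} {suc n} (s≤s h) = <ᵇ-true h

<ᵇ-false : ∀ {m n} → n ≤ m → (m <ᵇ n) ≡ false
<ᵇ-false {m} {zero} _ = refl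
<ᵇ-false {suc m} {suc n} (s≤s h) = <ᵇ-false h

pick-less : ∀ s t n (a b c d : Pt) → t < n → pick s t n a b c d ≡ a
pick-less s t n a b c d h rewrite <ᵇ-true h = refl

pick-greater : ∀ s t n (a b c d : Pt) → n < t → pick s t n a b c d ≡ b
pick-greater s t n a b c d h rewrite <ᵇ-false (ℕP.<⇒≤ h) | <ᵇ-true h = refl

pick-tieL : ∀ n (a b c d : Pt) → pick L n n a b c d ≡ c
pick-tieL n a b c d rewrite <ᵇ-false (ℕP.≤-refl {n}) = refl

pick-tieR : ∀ n (a b c d : Pt) → pick R n n a b c d ≡ d
pick-tieR n a b c d rewrite <ᵇ-false (ℕP.≤-refl {n}) = refl

-- The names fit `R`; for `L` they are interchanged. A half-lattice point on the line lies to the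
-- left of the curve pushed right, and to the right of the curve pushed left.
Weak Strict : Side → ℕ → ℕ → Set
Weak L = _<_
Weak R = _≤_
Strict L = _≤_
Strict R = _<_

-- `pick` breaks ties according to the side; these are the resulting closed/open conditions.
pick-less′ : ∀ s t n (a b : Pt) → Strict s t n → pick s t n a b a b ≡ a
pick-less′ R t n a b h = pick-less R t n a b a b h
pick-less′ L t n a b h with ℕP.m≤n⇒m<n∨m≡n h
... | inj₁ h′ = pick-less L t n a b a b h′
... | inj₂ refl = pick-tieL n a b a b

pick-greater′ : ∀ s t n (a b : Pt) → Weak s n t → pick s t n a b a b ≡ b
pick-greater′ L t n a b h = pick-greater L t n a b a b h
pick-greater′ R t n a b h with ℕP.m≤n⇒m<n∨m≡n h
... | inj₁ h′ = pick-greater R t n a b a b h′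
... | inj₂ refl = pick-tieR n a b a b

pick-less″ : ∀ s t n (a b : Pt) → Weak s t n → pick s t n a b b a ≡ a
pick-less″ L t n a b h = pick-less L t n a b b a h
pick-less″ R t n a b h with ℕP.m≤n⇒m<n∨m≡n h
... | inj₁ h′ = pick-less R t n a b b a h′
... | inj₂ refl = pick-tieR n a b b a

pick-greater″ : ∀ s t n (a b : Pt) → Strict s n t → pick s t n a b b a ≡ b
pick-greater″ R t n a b h = pick-greater R t n a b b a h
pick-greater″ L t n a b h with ℕP.m≤n⇒m<n∨m≡n h
... | inj₁ h′ = pick-greater L t n a b b a h′
... | inj₂ refl = pick-tieL n a b b a

strict-shiftˡ : ∀ s {u n α β} → Strict s β α → u + α ≡ n + β → Strict s u n
strict-shiftˡ R {u} {n} {α} h eq = ℕP.+-cancelʳ-< α u n (subst (_< n + α) (sym eq) (ℕP.+-monoʳ-< n h))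
strict-shiftˡ L {u} {n} {α} h eq = ℕP.+-cancelʳ-≤ α u n (subst (_≤ n + α) (sym eq) (ℕP.+-monoʳ-≤ n h))

weak-shiftˡ : ∀ s {u n α β} → Weak s β α → u + α ≡ n + β → Weak s u n
weak-shiftˡ L {u} {n} {α} h eq = ℕP.+-cancelʳ-< α u n (subst (_< n + α) (sym eq) (ℕP.+-monoʳ-< n h))
weak-shiftˡ R {u} {n} {α} h eq = ℕP.+-cancelʳ-≤ α u n (subst (_≤ n + α) (sym eq) (ℕP.+-monoʳ-≤ n h))

double : ℕ → ℕ
double zero = zero
double (suc n) = suc (suc (double n))

double-≡ : ∀ n → double n ≡ n + n
double-≡ zero = refl
double-≡ (suc n) = cong suc (trans (cong suc (double-≡ n)) (sym (ℕP.+-suc n n)))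

-- The half-lattice cell (x , y), between the half-lattice points (x , y + 1) and (x + 1 , y), meets the line.
Cell : Side → ℕ → ℕ → ℕ → ℕ → Set
Cell s p q x y = Weak s (p * x) (q * suc y) × Strict s (q * y) (p * suc x)

cellX cellY : Bool → ℕ → ℕ
cellX false a = double a
cellX true a = suc (double a)
cellY false b = suc (double b)
cellY true b = double b

dSeg : ℕ → ℕ → Seg
dSeg a b = (pt (suc a) b , pt a (suc b))

dNear : Bool → ℕ → ℕ → Pt
dNear false a b = pt a (suc b)
dNear true a b = pt (suc a) b

vSeg hSeg : ℕ → ℕ → Seg
vSeg a b = (pt (suc a) b , pt (suc a) (suc b))
hSeg a b = (pt a (suc b) , pt (suc a) (suc b))

strict⇒≤ : ∀ s {m n} → Strict s m n → m ≤ n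
strict⇒≤ L h = h
strict⇒≤ R = ℕP.<⇒≤

weak⇒≤ : ∀ s {m n} → Weak s m n → m ≤ n
weak⇒≤ L = ℕP.<⇒≤
weak⇒≤ R h = h

module Crossings (s : Side) (p q : ℕ) where

  -- the line separates the lattice points (a , b + 1) and (a + 1 , b)
  Between : ℕ → ℕ → Set
  Between a b = p * a < q * suc b × q * b < p * suc a

  module _ {a b : ℕ} (btw : Between a b) where
    private
      r = q * suc b ∸ p * a
      r-eq : p * a + r ≡ q * suc b
      r-eq = ℕP.m+[n∸m]≡n (ℕP.<⇒≤ (proj₁ btw))

      r< : r < p + q
      r< = ℕP.+-cancelˡ-< (p * a) r (p + q) (subst₂ _<_ (sym r-eq) (lem p q a) (subst (_< p * suc a + q) (trans (ℕP.+-comm (q * b) q) (sym (ℕP.*-suc q b))) (ℕP.+-monoˡ-< q (proj₂ btw))))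
        where
        lem : ∀ p q a → p * suc a + q ≡ p * a + (p + q)
        lem = ℕSolver.solve-∀

      dm : (q * suc (a + b)) /′ (p + q) ≡ a × (q * suc (a + b)) %′ (p + q) ≡ r
      dm = div-mod (p + q) (trans (l₁ q a b) (trans (cong (_+ q * a) (sym r-eq)) (l₂ p q a r))) r<
        where
        l₁ : ∀ q a b → q * suc (a + b) ≡ q * suc b + q * a
        l₁ = ℕSolver.solve-∀
        l₂ : ∀ p q a r → (p * a + r) + q * a ≡ r + a * (p + q)
        l₂ = ℕSolver.solve-∀

      -- Comparing 2r with p + q asks which half of the diagonal is hit. By this equation it amounts
      -- to comparing the line with the midpoint (2a + 1 , 2b + 1) in half-lattice units, which is
      -- what a cell condition does.
      balance : 2 * r + p * suc (double a) ≡ (p + q) + q * suc (double b)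
      balance rewrite double-≡ a | double-≡ b = trans (l₁ p a r) (trans (cong (λ z → z + z + p) r-eq) (l₂ p q b))
        where
        l₁ : ∀ p a r → 2 * r + p * suc (a + a) ≡ (p * a + r) + (p * a + r) + p
        l₁ = ℕSolver.solve-∀
        l₂ : ∀ p q b → q * suc b + q * suc b + p ≡ (p + q) + q * suc (b + b)
        l₂ = ℕSolver.solve-∀

      seg-eq : (pt (suc a) (suc (a + b) ∸ a ∸ 1) , pt a (suc (a + b) ∸ a)) ≡ dSeg a b
      seg-eq rewrite trans (cong (_∸ a) (sym (ℕP.+-suc a b))) (ℕP.m+n∸m≡n a (suc b)) = refl

    diag-crossing : ∀ x → Cell s p q (cellX x a) (cellY x b) → diagCross s p q (suc (a + b)) ≡ (dSeg a b , dNear x a b)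
    diag-crossing x cell rewrite proj₁ dm | proj₂ dm = begin
      (sg , pick s (2 * r) (p + q) (proj₂ sg) (proj₁ sg) (proj₂ sg) (proj₁ sg))
        ≡⟨ cong (λ sg → sg , pick s (2 * r) (p + q) (proj₂ sg) (proj₁ sg) (proj₂ sg) (proj₁ sg)) seg-eq ⟩
      (dSeg a b , pick s (2 * r) (p + q) (pt a (suc b)) (pt (suc a) b) (pt a (suc b)) (pt (suc a) b))
        ≡⟨ cong (dSeg a b ,_) (near x cell) ⟩
      (dSeg a b , dNear x a b) ∎
      where
      open ≡-Reasoning
      sg : Seg
      sg = (pt (suc a) (suc (a + b) ∸ a ∸ 1) , pt a (suc (a + b) ∸ a))
      near : ∀ x → Cell s p q (cellX x a) (cellY x b) → pick s (2 * r) (p + q) (pt a (suc b)) (pt (suc a) b) (pt a (suc b)) (pt (suc a) b) ≡ dNear x a b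
      near false (_ , h) = pick-less′ s (2 * r) (p + q) (pt a (suc b)) (pt (suc a) b) (strict-shiftˡ s h balance)
      near true (h , _) = pick-greater′ s (2 * r) (p + q) (pt a (suc b)) (pt (suc a) b) (weak-shiftˡ s h (sym balance))

  module _ {a b : ℕ} (btw : Between a b) (btw′ : Between (suc a) b) where
    private
      r = p * suc a ∸ q * b
      r-eq : q * b + r ≡ p * suc a
      r-eq = ℕP.m+[n∸m]≡n (ℕP.<⇒≤ (proj₂ btw))

      r< : r < q
      r< = ℕP.+-cancelˡ-< (q * b) r q (subst₂ _<_ (sym r-eq) (trans (ℕP.*-suc q b) (ℕP.+-comm q (q * b))) (proj₁ btw′))

      dm : (p * suc a) /′ q ≡ b × (p * suc a) %′ q ≡ r
      dm = div-mod q (trans (sym r-eq) (trans (ℕP.+-comm (q * b) r) (cong (λ z → r + z) (ℕP.*-comm q b)))) r<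

      balance : 2 * r + q * suc (double b) ≡ q + p * suc (suc (double a))
      balance rewrite double-≡ a | double-≡ b = trans (l₁ q b r) (trans (cong (λ z → z + z + q) r-eq) (l₂ p q a))
        where
        l₁ : ∀ q b r → 2 * r + q * suc (b + b) ≡ (q * b + r) + (q * b + r) + q
        l₁ = ℕSolver.solve-∀
        l₂ : ∀ p q a → p * suc a + p * suc a + q ≡ q + p * suc (suc (a + a))
        l₂ = ℕSolver.solve-∀

      vert-eq : vertCross s p q (suc a) ≡ (vSeg a b , pick s (2 * r) q (pt (suc a) b) (pt (suc a) (suc b)) (pt (suc a) (suc b)) (pt (suc a) b))
      vert-eq rewrite proj₁ dm | proj₂ dm = refl

    vert-crossing-below : Weak s (p * suc (suc (double a))) (q * suc (double b)) → vertCross s p q (suc a) ≡ (vSeg a b , pt (suc a) b)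
    vert-crossing-below h = trans vert-eq (cong (vSeg a b ,_) (pick-less″ s (2 * r) q (pt (suc a) b) (pt (suc a) (suc b)) (weak-shiftˡ s h balance)))

    vert-crossing-above : Strict s (q * suc (double b)) (p * suc (suc (double a))) → vertCross s p q (suc a) ≡ (vSeg a b , pt (suc a) (suc b))
    vert-crossing-above h = trans vert-eq (cong (vSeg a b ,_) (pick-greater″ s (2 * r) q (pt (suc a) b) (pt (suc a) (suc b)) (strict-shiftˡ s h (sym balance))))

  module _ {a b : ℕ} (btw : Between a b) (btw′ : Between a (suc b)) where
    private
      r = q * suc b ∸ p * a
      r-eq : p * a + r ≡ q * suc b
      r-eq = ℕP.m+[n∸m]≡n (ℕP.<⇒≤ (proj₁ btw))

      r< : r < p
      r< = ℕP.+-cancelˡ-< (p * a) r p (subst₂ _<_ (sym r-eq) (trans (ℕP.*-suc p a) (ℕP.+-comm p (p * a))) (proj₂ btw′))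

      dm : (q * suc b) /′ p ≡ a × (q * suc b) %′ p ≡ r
      dm = div-mod p (trans (sym r-eq) (trans (ℕP.+-comm (p * a) r) (cong (λ z → r + z) (ℕP.*-comm p a)))) r<

      balance : 2 * r + p * suc (double a) ≡ p + q * suc (suc (double b))
      balance rewrite double-≡ a | double-≡ b = trans (l₁ p a r) (trans (cong (λ z → z + z + p) r-eq) (l₂ p q b))
        where
        l₁ : ∀ p a r → 2 * r + p * suc (a + a) ≡ (p * a + r) + (p * a + r) + p
        l₁ = ℕSolver.solve-∀
        l₂ : ∀ p q b → q * suc b + q * suc b + p ≡ p + q * suc (suc (b + b))
        l₂ = ℕSolver.solve-∀

      hor-eq : horCross s p q (suc b) ≡ (hSeg a b , pick s (2 * r) p (pt a (suc b)) (pt (suc a) (suc b)) (pt a (suc b)) (pt (suc a) (suc b)))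
      hor-eq rewrite proj₁ dm | proj₂ dm = refl

    hor-crossing-left : Strict s (q * suc (suc (double b))) (p * suc (double a)) → horCross s p q (suc b) ≡ (hSeg a b , pt a (suc b))
    hor-crossing-left h = trans hor-eq (cong (hSeg a b ,_) (pick-less′ s (2 * r) p (pt a (suc b)) (pt (suc a) (suc b)) (strict-shiftˡ s h balance)))

    hor-crossing-right : Weak s (p * suc (double a)) (q * suc (suc (double b))) → horCross s p q (suc b) ≡ (hSeg a b , pt (suc a) (suc b))
    hor-crossing-right h = trans hor-eq (cong (hSeg a b ,_) (pick-greater′ s (2 * r) p (pt a (suc b)) (pt (suc a) (suc b)) (weak-shiftˡ s h (sym balance))))

-- Crossing times along the segment

rng : ℕ → ℕ → List ℕ
rng a zero = []
rng a (suc k) = a ∷ rng (suc a) k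

applyUpTo-rng : ∀ (f : ℕ → ℕ) a k → (∀ i → f i ≡ a + i) → applyUpTo f k ≡ rng a k
applyUpTo-rng f a zero h = refl
applyUpTo-rng f a (suc k) h = cong₂ _∷_ (trans (h 0) (ℕP.+-identityʳ a))
  (applyUpTo-rng (λ i → f (suc i)) (suc a) k (λ i → trans (h (suc i)) (ℕP.+-suc a i)))

rng-++ : ∀ a k l → rng a (k + l) ≡ rng a k ++ rng (a + k) l
rng-++ a zero l = cong (λ z → rng z l) (sym (ℕP.+-identityʳ a))
rng-++ a (suc k) l = cong (a ∷_) (trans (rng-++ (suc a) k l) (cong (λ z → rng (suc a) k ++ rng z l) (sym (ℕP.+-suc a k))))

module _ {A : Set} (g : ℕ → List A) where
  concatMap-++ : ∀ xs ys → concatMap g (xs ++ ys) ≡ concatMap g xs ++ concatMap g ys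
  concatMap-++ [] ys = refl
  concatMap-++ (x ∷ xs) ys = trans (cong (g x ++_) (concatMap-++ xs ys)) (sym (ListP.++-assoc (g x) (concatMap g xs) (concatMap g ys)))

  concatMap-empty : ∀ a l → (∀ k → a ≤ k → k < a + l → g k ≡ []) → concatMap g (rng a l) ≡ []
  concatMap-empty a zero h = refl
  concatMap-empty a (suc l) h = cong₂ _++_ (h a ℕP.≤-refl (ℕP.m<m+n a (s≤s z≤n)))
    (concatMap-empty (suc a) l (λ k a≤k k< → h k (ℕP.<⇒≤ a≤k) (subst (k <_) (sym (ℕP.+-suc a l)) k<)))

  concatMap-single : ∀ a l t → a ≤ t → t < a + l → (∀ k → a ≤ k → k < a + l → k ≢ t → g k ≡ []) → concatMap g (rng a l) ≡ g t
  concatMap-single a zero t a≤t t< h = ⊥-elim (ℕP.<⇒≱ t< (subst (_≤ t) (sym (ℕP.+-identityʳ a)) a≤t))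
  concatMap-single a (suc l) t a≤t t< h with a ℕP.≟ t
  ... | yes refl = trans (cong (g a ++_) (concatMap-empty (suc a) l
          (λ k a≤k k< → h k (ℕP.<⇒≤ a≤k) (subst (k <_) (sym (ℕP.+-suc a l)) k<) (λ { refl → ℕP.<-irrefl refl a≤k }))))
          (ListP.++-identityʳ (g a))
  ... | no a≢t = trans (cong (_++ concatMap g (rng (suc a) l)) (h a ℕP.≤-refl (ℕP.m<m+n a (s≤s z≤n)) a≢t))
          (concatMap-single (suc a) l t (ℕP.≤∧≢⇒< a≤t a≢t) (subst (t <_) (ℕP.+-suc a l) t<)
            (λ k a≤k k< → h k (ℕP.<⇒≤ a≤k) (subst (k <_) (sym (ℕP.+-suc a l)) k<)))

-- By coprimality (u , v) is a multiple k of (q , p); positivity excludes k = 0 and the upper bound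
-- excludes k ≥ 1.
no-lattice-point : ∀ {p q} → Coprime p q → 1 ≤ q → ∀ u v → p * u ≡ q * v → 1 ≤ u + v → u + v < p + q → ⊥
no-lattice-point {p} {q@(suc _)} cop _ u v eq pos small with Coprimality.coprime-divisor {q} {p} {u} (Coprimality.sym cop) (divides v (trans eq (ℕP.*-comm q v)))
... | divides k refl = contra k v-eq pos small
  where
  v-eq : v ≡ k * p
  v-eq = ℕP.*-cancelˡ-≡ v (k * p) q (trans (sym eq) (lem p k q))
    where
    lem : ∀ p k q → p * (k * q) ≡ q * (k * p)
    lem = ℕSolver.solve-∀
  contra : ∀ k → v ≡ k * p → 1 ≤ k * q + v → k * q + v < p + q → ⊥
  contra zero refl ()
  contra (suc k) refl _ h = ℕP.<⇒≱ h (subst (_≤ suc k * q + suc k * p) (ℕP.+-comm q p) (ℕP.+-mono-≤ (ℕP.m≤m+n q (k * q)) (ℕP.m≤m+n p (k * p))))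

-- From the half of a diagonal nearer its upper left end (`false`) only two steps to the right lead
-- across a vertical segment; from the other half a single one suffices.
isVert : Bool → Bool → Bool → Bool
isVert false l l′ = l ∧ l′
isVert true l l′ = l ∨ l′

wSeg : Bool → ℕ → ℕ → Seg
wSeg true = vSeg
wSeg false = hSeg

wNear : Bool → Bool → ℕ → ℕ → Bool → Pt
wNear x l a b true = if x ∧ l then pt (suc a) b else pt (suc a) (suc b)
wNear x l a b false = if x ∨ l then pt (suc a) (suc b) else pt a (suc b)

wCross : Bool → Bool → Bool → ℕ → ℕ → Crossing
wCross x l l′ a b = let v = isVert x l l′ in (wSeg v a b , wNear x l a b v)

nextX : Bool → Bool → Bool → Bool
nextX x l l′ = (x xor l) xor l′

nextA nextB : Bool → ℕ → ℕ
nextA v a = if v then suc a else a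
nextB v b = if v then b else suc b

walk : Bool → ℕ → ℕ → Pairs → List Crossing
walk x a b [] = []
walk x a b ((l , l′) ∷ ps) = let v = isVert x l l′ in
  (dSeg a b , dNear x a b) ∷ wCross x l l′ a b ∷ walk (nextX x l l′) (nextA v a) (nextB v b) ps

module Events (s : Side) (p q : ℕ) (p>0 : 1 ≤ p) (q>0 : 1 ≤ q) (cop : Coprime p q) where
  open Crossings s p q

  private
    n = p + q
    -- In the time unit of `crossAt` the lines x + y = m, x = m and y = m are crossed at the times
    -- m·D, m·V and m·H.
    D = p * q
    V = p * (p + q)
    H = q * (p + q)
    g : ℕ → List Crossing
    g = crossAt s p q

    n>0 : 1 ≤ n
    n>0 = ℕP.≤-trans p>0 (ℕP.m≤m+n p q)
    D>0 : 1 ≤ D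
    D>0 = ℕP.*-mono-≤ p>0 q>0
    V>0 : 1 ≤ V
    V>0 = ℕP.*-mono-≤ p>0 n>0
    H>0 : 1 ≤ H
    H>0 = ℕP.*-mono-≤ q>0 n>0

    half-≤ : ∀ u v → u + u ≤ v + v → u ≤ v
    half-≤ u v h = ℕP.*-cancelˡ-≤ 2 (subst₂ _≤_ (two u) (two v) h)
      where
      two : ∀ u → u + u ≡ 2 * u
      two = ℕSolver.solve-∀

    dbl : ∀ m a → m * double a ≡ m * a + m * a
    dbl m a = trans (cong (m *_) (double-≡ a)) (ℕP.*-distribˡ-+ m a a)

    widen : ∀ m a → m * double a ≤ m * suc (double a)
    widen m a = ℕP.*-monoʳ-≤ m (ℕP.n≤1+n _)

  -- Halving the cell conditions gives both bounds in weak form. Equality would put a lattice point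
  -- on the line strictly before (q , p), which coprimality forbids.
  cell⇒between : ∀ x {a b} → suc (a + b) < n → Cell s p q (cellX x a) (cellY x b) → Between a b
  cell⇒between x {a} {b} c<n cell = ℕP.≤∧≢⇒< (le₁ x cell) ne₁ , ℕP.≤∧≢⇒< (le₂ x cell) ne₂
    where
    le₁ : ∀ x → Cell s p q (cellX x a) (cellY x b) → p * a ≤ q * suc b
    le₁ false (h , _) = half-≤ _ _ (subst₂ _≤_ (dbl p a) (dbl q (suc b)) (weak⇒≤ s h))
    le₁ true (h , _) = half-≤ _ _ (subst₂ _≤_ (dbl p a) (dbl q (suc b))
      (ℕP.≤-trans (widen p a) (ℕP.≤-trans (weak⇒≤ s h) (ℕP.*-monoʳ-≤ q (ℕP.n≤1+n _)))))
    le₂ : ∀ x → Cell s p q (cellX x a) (cellY x b) → q * b ≤ p * suc a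
    le₂ true (_ , h) = half-≤ _ _ (subst₂ _≤_ (dbl q b) (dbl p (suc a)) (strict⇒≤ s h))
    le₂ false (_ , h) = half-≤ _ _ (subst₂ _≤_ (dbl q b) (dbl p (suc a))
      (ℕP.≤-trans (widen q b) (ℕP.≤-trans (strict⇒≤ s h) (ℕP.*-monoʳ-≤ p (ℕP.n≤1+n _)))))
    ne₁ : p * a ≢ q * suc b
    ne₁ eq = no-lattice-point cop q>0 a (suc b) eq (subst (1 ≤_) (sym (ℕP.+-suc a b)) (s≤s z≤n)) (subst (_< n) (sym (ℕP.+-suc a b)) c<n)
    ne₂ : q * b ≢ p * suc a
    ne₂ eq = no-lattice-point cop q>0 (suc a) b (sym eq) (s≤s z≤n) c<n

  module _ {a b : ℕ} (btw : Between a b) where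
    private
      c = suc (a + b)
      l₁ : ∀ p q a b → q * suc b + q * a ≡ q * suc (a + b)
      l₁ = ℕSolver.solve-∀
      l₂ : ∀ p q a → p * a + q * a ≡ a * (p + q)
      l₂ = ℕSolver.solve-∀
      l₃ : ∀ p q a b → q * b + q * suc a ≡ q * suc (a + b)
      l₃ = ℕSolver.solve-∀
      l₄ : ∀ p q b → q * b + p * b ≡ b * (p + q)
      l₄ = ℕSolver.solve-∀
      l₅ : ∀ p q a b → p * suc a + p * b ≡ p * suc (a + b)
      l₅ = ℕSolver.solve-∀
      l₆ : ∀ p q a b → p * a + p * suc b ≡ p * suc (a + b)
      l₆ = ℕSolver.solve-∀

    an<qc : a * n < q * c
    an<qc = subst₂ _<_ (l₂ p q a) (l₁ p q a b) (ℕP.+-monoˡ-< (q * a) (proj₁ btw))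
    qc<an : q * c < suc a * n
    qc<an = subst₂ _<_ (l₃ p q a b) (l₂ p q (suc a)) (ℕP.+-monoˡ-< (q * suc a) (proj₂ btw))
    bn<pc : b * n < p * c
    bn<pc = subst₂ _<_ (l₄ p q b) (l₅ p q a b) (ℕP.+-monoˡ-< (p * b) (proj₂ btw))
    pc<bn : p * c < suc b * n
    pc<bn = subst₂ _<_ (l₆ p q a b) (l₄ p q (suc b)) (ℕP.+-monoˡ-< (p * suc b) (proj₁ btw))

  private
    cD-p : ∀ c → c * D ≡ p * (q * c)
    cD-p c = lem p q c
      where
      lem : ∀ p q c → c * (p * q) ≡ p * (q * c)
      lem = ℕSolver.solve-∀
    cD-q : ∀ c → c * D ≡ q * (p * c)
    cD-q c = lem p q c
      where
      lem : ∀ p q c → c * (p * q) ≡ q * (p * c)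
      lem = ℕSolver.solve-∀
    mV : ∀ m → m * V ≡ p * (m * n)
    mV m = lem p n m
      where
      lem : ∀ p n m → m * (p * n) ≡ p * (m * n)
      lem = ℕSolver.solve-∀
    mH : ∀ m → m * H ≡ q * (m * n)
    mH m = lem q n m
      where
      lem : ∀ p n m → m * (p * n) ≡ p * (m * n)
      lem = ℕSolver.solve-∀

    cancel-≤ : ∀ {k u v} → 1 ≤ k → k * u ≤ k * v → u ≤ v
    cancel-≤ {suc k} _ = ℕP.*-cancelˡ-≤ (suc k)
    cancel-< : ∀ k {u v} → k * u < k * v → u < v
    cancel-< k {u} {v} = ℕP.*-cancelˡ-< k u v
    cancelʳ-< : ∀ k {u v} → u * k < v * k → u < v
    cancelʳ-< k {u} {v} = ℕP.*-cancelʳ-< k u v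
    mono-< : ∀ {k u v} → 1 ≤ k → u < v → k * u < k * v
    mono-< {suc k} _ = ℕP.*-monoʳ-< (suc k)

  module _ {a b : ℕ} (btw : Between a b) where
    private
      c = suc (a + b)
    V-after : ∀ {m} → c * D ≤ m * V → a < m
    V-after {m} h = cancelʳ-< n (ℕP.<-≤-trans (an<qc btw) (cancel-≤ p>0 (subst₂ _≤_ (cD-p c) (mV m) h)))
    V-before : ∀ {m} → m * V ≤ c * D → m ≤ a
    V-before {m} h = ℕ.s≤s⁻¹ (cancelʳ-< n (ℕP.≤-<-trans (cancel-≤ p>0 (subst₂ _≤_ (mV m) (cD-p c) h)) (qc<an btw)))
    H-after : ∀ {m} → c * D ≤ m * H → b < m
    H-after {m} h = cancelʳ-< n (ℕP.<-≤-trans (bn<pc btw) (cancel-≤ q>0 (subst₂ _≤_ (cD-q c) (mH m) h)))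
    H-before : ∀ {m} → m * H ≤ c * D → m ≤ b
    H-before {m} h = ℕ.s≤s⁻¹ (cancelʳ-< n (ℕP.≤-<-trans (cancel-≤ q>0 (subst₂ _≤_ (mH m) (cD-q c) h)) (pc<bn btw)))
    V-time : c * D < suc a * V
    V-time = subst₂ _<_ (sym (cD-p c)) (sym (mV (suc a))) (mono-< p>0 (qc<an btw))
    V-time′ : a * V < c * D
    V-time′ = subst₂ _<_ (sym (mV a)) (sym (cD-p c)) (mono-< p>0 (an<qc btw))
    H-time : c * D < suc b * H
    H-time = subst₂ _<_ (sym (cD-q c)) (sym (mH (suc b))) (mono-< q>0 (pc<bn btw))
    H-time′ : b * H < c * D
    H-time′ = subst₂ _<_ (sym (mH b)) (sym (cD-q c)) (mono-< q>0 (bn<pc btw))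

  at-none : ∀ k → (∀ m → k ≢ m * V) → (∀ m → k ≢ m * H) → (∀ m → k ≢ m * D) → g k ≡ []
  at-none k hV hH hD rewrite rem-nonzero V k V>0 hV | rem-nonzero H k H>0 hH | rem-nonzero D k D>0 hD = refl

  at-V : ∀ m → g (m * V) ≡ vertCross s p q m ∷ []
  at-V m rewrite proj₂ (rem-zero V m V>0) | proj₁ (rem-zero V m V>0) = refl

  at-H : ∀ m → (∀ m′ → m * H ≢ m′ * V) → g (m * H) ≡ horCross s p q m ∷ []
  at-H m hV rewrite rem-nonzero V (m * H) V>0 hV | proj₂ (rem-zero H m H>0) | proj₁ (rem-zero H m H>0) = refl

  at-D : ∀ m → (∀ m′ → m * D ≢ m′ * V) → (∀ m′ → m * D ≢ m′ * H) → g (m * D) ≡ diagCross s p q m ∷ []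
  at-D m hV hH rewrite rem-nonzero V (m * D) V>0 hV | rem-nonzero H (m * D) H>0 hH | proj₂ (rem-zero D m D>0) | proj₁ (rem-zero D m D>0) = refl

  diag-event : ∀ {a b} → Between a b → g (suc (a + b) * D) ≡ diagCross s p q (suc (a + b)) ∷ []
  diag-event btw = at-D _
    (λ m eq → ℕP.<⇒≱ (V-after btw {m} (ℕP.≤-reflexive eq)) (V-before btw (ℕP.≤-reflexive (sym eq))))
    (λ m eq → ℕP.<⇒≱ (H-after btw {m} (ℕP.≤-reflexive eq)) (H-before btw (ℕP.≤-reflexive (sym eq))))

  private
    between-D : ∀ c k → suc (c * D) ≤ k → k < suc c * D → ∀ m → k ≢ m * D
    between-D c k lo hi m refl = ℕP.<⇒≱ (ℕP.*-cancelʳ-< D c m lo) (ℕ.s≤s⁻¹ (ℕP.*-cancelʳ-< D m (suc c) hi))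

    D-end : ∀ c → suc (c * D) + (D ∸ 1) ≡ suc c * D
    D-end c = trans (sym (ℕP.+-suc (c * D) (D ∸ 1))) (trans (cong (λ z → c * D + z) (ℕP.m+[n∸m]≡n D>0)) (ℕP.+-comm (c * D) D))

  gap : ℕ → List Crossing
  gap c = concatMap g (rng (suc (c * D)) (D ∸ 1))

  -- A vertical line m met in this gap satisfies a < m ≤ a + 1, whereas a horizontal one would need
  -- b < m ≤ b; so the gap holds one crossing only.
  gap-vert : ∀ {a b} → Between a b → Between (suc a) b → gap (suc (a + b)) ≡ vertCross s p q (suc a) ∷ []
  gap-vert {a} {b} btw btw′ = trans
    (concatMap-single g (suc (c * D)) (D ∸ 1) (suc a * V) (V-time btw) (subst (suc a * V <_) (sym (D-end c)) (V-time′ btw′)) others)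
    (at-V (suc a))
    where
    c = suc (a + b)
    others : ∀ k → suc (c * D) ≤ k → k < suc (c * D) + (D ∸ 1) → k ≢ suc a * V → g k ≡ []
    others k lo hi ne = at-none k
      (λ { m refl → ne (cong (_* V) (ℕP.≤-antisym (V-before btw′ {m} (ℕP.<⇒≤ hi′)) (V-after btw {m} (ℕP.<⇒≤ lo)))) })
      (λ { m refl → ℕP.<⇒≱ (H-after btw {m} (ℕP.<⇒≤ lo)) (H-before btw′ {m} (ℕP.<⇒≤ hi′)) })
      (between-D c k lo hi′)
      where
      hi′ : k < suc c * D
      hi′ = subst (k <_) (D-end c) hi

  gap-hor : ∀ {a b} → Between a b → Between a (suc b) → gap (suc (a + b)) ≡ horCross s p q (suc b) ∷ []
  gap-hor {a} {b} btw btw′ = trans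
    (concatMap-single g (suc (c * D)) (D ∸ 1) (suc b * H) (H-time btw) (subst (suc b * H <_) (sym (trans (D-end c) c′)) (H-time′ btw′)) others)
    (at-H (suc b) (λ m → noV (suc b * H) (H-time btw) (subst (suc b * H <_) (sym c′) (H-time′ btw′)) m))
    where
    c = suc (a + b)
    c′ : suc c * D ≡ suc (a + suc b) * D
    c′ = cong (λ z → suc z * D) (sym (ℕP.+-suc a b))
    noV : ∀ k → suc (c * D) ≤ k → k < suc c * D → ∀ m → k ≢ m * V
    noV k lo hi m refl = ℕP.<⇒≱ (V-after btw {m} (ℕP.<⇒≤ lo)) (V-before btw′ {m} (ℕP.<⇒≤ (subst (k <_) c′ hi)))
    others : ∀ k → suc (c * D) ≤ k → k < suc (c * D) + (D ∸ 1) → k ≢ suc b * H → g k ≡ []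
    others k lo hi ne = at-none k (noV k lo hi′)
      (λ { m refl → ne (cong (_* H) (ℕP.≤-antisym (H-before btw′ {m} (ℕP.<⇒≤ (subst (k <_) c′ hi′))) (H-after btw {m} (ℕP.<⇒≤ lo)))) })
      (between-D c k lo hi′)
      where
      hi′ : k < suc c * D
      hi′ = subst (k <_) (D-end c) hi

  -- two multiples of n lie at least n apart, while q and p are at most n
  gap-last : ∀ c → suc c ≡ n → gap c ≡ []
  gap-last c sc≡n = concatMap-empty g (suc (c * D)) (D ∸ 1) (λ k lo hi → none k lo (subst (k <_) (D-end c) hi))
    where
    stuck : ∀ u m → u ≤ n → u * c < m * n → m * n < u * suc c → ⊥
    stuck u m u≤n lo hi = ℕP.<⇒≱ m<u (ℕ.s≤s⁻¹ (cancelʳ-< n (ℕP.<-≤-trans (subst (_< m * n + n) lem (ℕP.+-mono-<-≤ lo u≤n)) (ℕP.≤-reflexive (ℕP.+-comm (m * n) n)))))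
      where
      m<u : m < u
      m<u = cancelʳ-< n (subst (λ z → m * n < u * z) sc≡n hi)
      lem : u * c + u ≡ u * n
      lem = trans (ℕP.+-comm (u * c) u) (trans (sym (ℕP.*-suc u c)) (cong (u *_) sc≡n))
    none : ∀ k → suc (c * D) ≤ k → k < suc c * D → g k ≡ []
    none k lo hi = at-none k
      (λ { m refl → stuck q m (ℕP.m≤n+m q p) (cancel-< p (subst₂ _<_ (cD-p c) (mV m) lo)) (cancel-< p (subst₂ _<_ (mV m) (cD-p (suc c)) hi)) })
      (λ { m refl → stuck p m (ℕP.m≤m+n p q) (cancel-< q (subst₂ _<_ (cD-q c) (mH m) lo)) (cancel-< q (subst₂ _<_ (mH m) (cD-q (suc c)) hi)) })
      (between-D c k lo hi)

  gap-first : gap 0 ≡ []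
  gap-first = concatMap-empty g 1 (D ∸ 1) (λ k lo hi → none k lo (subst (k <_) (D-end 0) hi))
    where
    stuck : ∀ u m → u ≤ n → 0 < m * n → m * n < u * 1 → ⊥
    stuck u zero u≤n () hi
    stuck u (suc m) u≤n lo hi = ℕP.<⇒≱ (subst (n + m * n <_) (ℕP.*-identityʳ u) hi) (ℕP.≤-trans u≤n (ℕP.m≤m+n n (m * n)))
    pos : ∀ u v → 1 ≤ u * v → 0 < v
    pos u zero h = ⊥-elim (ℕP.<-irrefl (sym (ℕP.*-zeroʳ u)) h)
    pos u (suc v) h = s≤s z≤n
    none : ∀ k → 1 ≤ k → k < 1 * D → g k ≡ []
    none k lo hi = at-none k
      (λ { m refl → stuck q m (ℕP.m≤n+m q p) (pos p (m * n) (subst (1 ≤_) (mV m) lo)) (cancel-< p (subst₂ _<_ (mV m) (cD-p 1) hi)) })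
      (λ { m refl → stuck p m (ℕP.m≤m+n p q) (pos q (m * n) (subst (1 ≤_) (mH m) lo)) (cancel-< q (subst₂ _<_ (mH m) (cD-q 1) hi)) })
      (between-D 0 k lo hi)

double-injective : ∀ a b → double a ≡ double b → a ≡ b
double-injective zero zero _ = refl
double-injective (suc a) (suc b) eq = cong suc (double-injective a b (ℕP.suc-injective (ℕP.suc-injective eq)))

double-parity : ∀ a b → double a ≢ suc (double b)
double-parity zero b ()
double-parity (suc a) zero ()
double-parity (suc a) (suc b) eq = double-parity a b (ℕP.suc-injective (ℕP.suc-injective eq))

path-length : ∀ {Q x y w x′ y′} → Path Q x y w x′ y′ → length w + (x + y) ≡ x′ + y′
path-length (nil _) = refl
path-length {x = x} {y} (up {w = w} _ π) = trans (trans (sym (ℕP.+-suc (length w) (x + y))) (cong (λ z → length w + z) (sym (ℕP.+-suc x y)))) (path-length π)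
path-length {x = x} {y} (right {w = w} _ π) = trans (sym (ℕP.+-suc (length w) (x + y))) (path-length π)

length-flat : ∀ ps → length (flat ps) ≡ double (length ps)
length-flat [] = refl
length-flat (_ ∷ ps) = cong (λ n → suc (suc n)) (length-flat ps)

-- The cell in which the doubled path arrives at the lattice point (q , p), passing it on the given side.
endX endY : Side → ℕ → ℕ → ℕ
endX R p q = double q
endX L p q = suc (double (q ∸ 1))
endY R p q = suc (double (p ∸ 1))
endY L p q = double p

cornerD cornerW : Side → ℕ → ℕ → Crossing
cornerD L p q = ((pt q p , pt (q ∸ 1) (suc p)) , pt q p)
cornerD R p q = ((pt q p , pt (suc q) (p ∸ 1)) , pt q p)
cornerW L p q = ((pt q p , pt q (suc p)) , pt q p)
cornerW R p q = ((pt q p , pt (suc q) p) , pt q p)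

-- The side on which the lattice point is passed forces the last letter: up on the left, right on
-- the right, since the other step would leave the cells met by the curve. Hence the first of the
-- three corner segments is the crossing that completes the last pair of letters, and the other two
-- remain.
arrival : ∀ s p q → 1 ≤ p → 1 ≤ q → ∀ x a b l l′ {X Y X′ Y′} → Path (Cell s p q) X Y (l ∷ l′ ∷ []) X′ Y′ →
  X ≡ cellX x a → Y ≡ cellY x b → X′ ≡ endX s p q → Y′ ≡ endY s p q →
  cornerCross s p q ≡ wCross x l l′ a b ∷ cornerD s p q ∷ cornerW s p q ∷ []
arrival R (suc p) (suc q) _ _ x a b l false π eX eY eX′ eY′ = ⊥-elim (last-up l π eX′ eY′)
  where
  impossible : suc p * double (suc q) ≤ suc q * suc (double p) → ⊥
  impossible h = ℕP.<⇒≱ (ℕP.*-monoʳ-< (suc q) {suc (double p)} {double (suc p)} ℕP.≤-refl) (subst (_≤ suc q * suc (double p)) lem h)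
    where
    lem : suc p * double (suc q) ≡ suc q * double (suc p)
    lem rewrite double-≡ p | double-≡ q = poly p q
      where
      poly : ∀ p q → suc p * suc (suc (q + q)) ≡ suc q * suc (suc (p + p))
      poly = ℕSolver.solve-∀
  last-up : ∀ l {X Y X′ Y′} → Path (Cell R (suc p) (suc q)) X Y (l ∷ false ∷ []) X′ Y′ → X′ ≡ double (suc q) → Y′ ≡ suc (double p) → ⊥
  last-up false (up _ (up (h , _) (nil _))) refl eY = impossible (subst (λ z → suc p * double (suc q) ≤ suc q * z) eY h)
  last-up true (right _ (up (h , _) (nil _))) refl eY = impossible (subst (λ z → suc p * double (suc q) ≤ suc q * z) eY h)
arrival R (suc p) (suc q) _ _ x a b false true (up _ (right _ (nil _))) eX eY eX′ eY′ = by-x x eX eY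
  where
  by-x : ∀ x → _ ≡ cellX x a → _ ≡ cellY x b → _ ≡ wCross x false true a b ∷ cornerD R (suc p) (suc q) ∷ cornerW R (suc p) (suc q) ∷ []
  by-x false eX eY = ⊥-elim (double-parity a q (trans (sym eX) (ℕP.suc-injective eX′)))
  by-x true eX eY with double-injective a q (ℕP.suc-injective (trans (sym eX) (ℕP.suc-injective eX′))) | double-injective b p (trans (sym eY) (ℕP.suc-injective eY′))
  ... | refl | refl = refl
arrival R (suc p) (suc q) _ _ x a b true true (right _ (right _ (nil _))) eX eY eX′ eY′ = by-x x eX eY
  where
  by-x : ∀ x → _ ≡ cellX x a → _ ≡ cellY x b → _ ≡ wCross x true true a b ∷ cornerD R (suc p) (suc q) ∷ cornerW R (suc p) (suc q) ∷ []
  by-x true eX eY = ⊥-elim (double-parity q a (trans (sym (ℕP.suc-injective (ℕP.suc-injective eX′))) eX))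
  by-x false eX eY with double-injective a q (trans (sym eX) (ℕP.suc-injective (ℕP.suc-injective eX′))) | double-injective b p (ℕP.suc-injective (trans (sym eY) eY′))
  ... | refl | refl = refl
arrival L (suc p) (suc q) _ _ x a b l true π eX eY eX′ eY′ = ⊥-elim (last-right l π eX′ eY′)
  where
  impossible : suc q * double (suc p) ≤ suc p * suc (double q) → ⊥
  impossible h = ℕP.<⇒≱ (ℕP.*-monoʳ-< (suc p) {suc (double q)} {double (suc q)} ℕP.≤-refl) (subst (_≤ suc p * suc (double q)) lem h)
    where
    lem : suc q * double (suc p) ≡ suc p * double (suc q)
    lem rewrite double-≡ p | double-≡ q = poly q p
      where
      poly : ∀ p q → suc p * suc (suc (q + q)) ≡ suc q * suc (suc (p + p))
      poly = ℕSolver.solve-∀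
  last-right : ∀ l {X Y X′ Y′} → Path (Cell L (suc p) (suc q)) X Y (l ∷ true ∷ []) X′ Y′ → X′ ≡ suc (double q) → Y′ ≡ double (suc p) → ⊥
  last-right false (up _ (right (_ , h) (nil _))) eX refl = impossible (subst (λ z → suc q * double (suc p) ≤ suc p * z) eX h)
  last-right true (right _ (right (_ , h) (nil _))) eX refl = impossible (subst (λ z → suc q * double (suc p) ≤ suc p * z) eX h)
arrival L (suc p) (suc q) _ _ x a b false false (up _ (up _ (nil _))) eX eY eX′ eY′ = by-x x eX eY
  where
  by-x : ∀ x → _ ≡ cellX x a → _ ≡ cellY x b → _ ≡ wCross x false false a b ∷ cornerD L (suc p) (suc q) ∷ cornerW L (suc p) (suc q) ∷ []
  by-x false eX eY = ⊥-elim (double-parity a q (trans (sym eX) eX′))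
  by-x true eX eY with double-injective a q (ℕP.suc-injective (trans (sym eX) eX′)) | double-injective b p (trans (sym eY) (ℕP.suc-injective (ℕP.suc-injective eY′)))
  ... | refl | refl = refl
arrival L (suc p) (suc q) _ _ x a b true false (right _ (up _ (nil _))) eX eY eX′ eY′ = by-x x eX eY
  where
  by-x : ∀ x → _ ≡ cellX x a → _ ≡ cellY x b → _ ≡ wCross x true false a b ∷ cornerD L (suc p) (suc q) ∷ cornerW L (suc p) (suc q) ∷ []
  by-x true eX eY = ⊥-elim (double-parity b p (trans (sym eY) (ℕP.suc-injective eY′)))
  by-x false eX eY with double-injective a q (trans (sym eX) (ℕP.suc-injective eX′)) | double-injective b p (ℕP.suc-injective (trans (sym eY) (ℕP.suc-injective eY′)))
  ... | refl | refl = refl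

module CrossingSequence (s : Side) (p q : ℕ) (p>0 : 1 ≤ p) (q>0 : 1 ≤ q) (cop : Coprime p q) where
  open Crossings s p q
  open Events s p q p>0 q>0 cop

  private
    n = p + q
    D = p * q
    g : ℕ → List Crossing
    g = crossAt s p q
    D>0 : 1 ≤ D
    D>0 = ℕP.*-mono-≤ p>0 q>0

  -- Of the eight combinations of `x`, `l` and `l′` only the kind of segment crossed matters to the
  -- inductions.
  data StepView (x l l′ : Bool) (a b : ℕ) (w : Word) (X′ Y′ : ℕ) : Set where
    vert : isVert x l l′ ≡ true → (Between a b → Between (suc a) b → vertCross s p q (suc a) ≡ wCross x l l′ a b) →
      Path (Cell s p q) (cellX (nextX x l l′) (suc a)) (cellY (nextX x l l′) b) w X′ Y′ → StepView x l l′ a b w X′ Y′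
    hor : isVert x l l′ ≡ false → (Between a b → Between a (suc b) → horCross s p q (suc b) ≡ wCross x l l′ a b) →
      Path (Cell s p q) (cellX (nextX x l l′) a) (cellY (nextX x l l′) (suc b)) w X′ Y′ → StepView x l l′ a b w X′ Y′

  -- The condition at the intermediate cell, on the half-integer antidiagonal between the two
  -- diagonals, decides on which side of the orbifold point the segment is crossed.
  stepView : ∀ x l l′ a b {w X′ Y′} → Path (Cell s p q) (cellX x a) (cellY x b) (l ∷ l′ ∷ w) X′ Y′ → StepView x l l′ a b w X′ Y′
  stepView false false false a b (up _ (up m π)) = hor refl (λ β β′ → hor-crossing-left β β′ (proj₂ m)) π
  stepView false false true a b (up _ (right m π)) = hor refl (λ β β′ → hor-crossing-left β β′ (proj₂ m)) π
  stepView false true false a b (right _ (up m π)) = hor refl (λ β β′ → hor-crossing-right β β′ (proj₁ m)) π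
  stepView false true true a b (right _ (right m π)) = vert refl (λ β β′ → vert-crossing-above β β′ (proj₂ m)) π
  stepView true false false a b (up _ (up m π)) = hor refl (λ β β′ → hor-crossing-right β β′ (proj₁ m)) π
  stepView true false true a b (up _ (right m π)) = vert refl (λ β β′ → vert-crossing-above β β′ (proj₂ m)) π
  stepView true true false a b (right _ (up m π)) = vert refl (λ β β′ → vert-crossing-below β β′ (proj₁ m)) π
  stepView true true true a b (right _ (right m π)) = vert refl (λ β β′ → vert-crossing-below β β′ (proj₁ m)) π

  private
    unroll : ∀ c k → concatMap g (rng (c * D) (suc k * D)) ≡ g (c * D) ++ gap c ++ concatMap g (rng (suc c * D) (k * D))
    unroll c k = begin
      concatMap g (rng (c * D) (D + k * D)) ≡⟨ cong (concatMap g) (rng-++ (c * D) D (k * D)) ⟩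
      concatMap g (rng (c * D) D ++ rng (c * D + D) (k * D)) ≡⟨ concatMap-++ g (rng (c * D) D) _ ⟩
      concatMap g (rng (c * D) D) ++ concatMap g (rng (c * D + D) (k * D))
        ≡⟨ cong₂ (λ u v → concatMap g (rng (c * D) u) ++ concatMap g (rng v (k * D))) (sym (ℕP.m+[n∸m]≡n D>0)) (ℕP.+-comm (c * D) D) ⟩
      (g (c * D) ++ gap c) ++ concatMap g (rng (suc c * D) (k * D)) ≡⟨ ListP.++-assoc (g (c * D)) (gap c) _ ⟩
      g (c * D) ++ gap c ++ concatMap g (rng (suc c * D) (k * D)) ∎
      where open ≡-Reasoning

    tail : List Crossing
    tail = cornerD s p q ∷ cornerW s p q ∷ []

  walk-crossings : ∀ x a b r ps → Path (Cell s p q) (cellX x a) (cellY x b) (flat (r ∷ ps)) (endX s p q) (endY s p q) →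
    suc (a + b) + length (r ∷ ps) ≡ n →
    concatMap g (rng (suc (a + b) * D) (length (r ∷ ps) * D)) ++ cornerCross s p q ≡ walk x a b (r ∷ ps) ++ tail
  walk-crossings x a b (l , l′) ps π len = begin
    concatMap g (rng (c * D) (suc (length ps) * D)) ++ cornerCross s p q ≡⟨ cong (_++ cornerCross s p q) (unroll c (length ps)) ⟩
    (g (c * D) ++ gap c ++ later) ++ cornerCross s p q
      ≡⟨ cong (λ z → (z ++ gap c ++ later) ++ cornerCross s p q) (trans (diag-event btw) (cong (_∷ []) (diag-crossing btw x (path-head π)))) ⟩
    (dSeg a b , dNear x a b) ∷ ((gap c ++ later) ++ cornerCross s p q) ≡⟨ cong ((dSeg a b , dNear x a b) ∷_) (rest ps len π) ⟩
    walk x a b ((l , l′) ∷ ps) ++ tail ∎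
    where
    open ≡-Reasoning
    c = suc (a + b)
    later = concatMap g (rng (suc c * D) (length ps * D))
    btw : Between a b
    btw = cell⇒between x (subst (c <_) len (ℕP.m<m+n c (s≤s z≤n))) (path-head π)
    next : List Crossing
    next = let v = isVert x l l′ in walk (nextX x l l′) (nextA v a) (nextB v b) ps

    rest : ∀ ps → c + suc (length ps) ≡ n → Path (Cell s p q) (cellX x a) (cellY x b) (flat ((l , l′) ∷ ps)) (endX s p q) (endY s p q) →
      (gap c ++ concatMap g (rng (suc c * D) (length ps * D))) ++ cornerCross s p q ≡
      wCross x l l′ a b ∷ (let v = isVert x l l′ in walk (nextX x l l′) (nextA v a) (nextB v b) ps) ++ tail
    -- After the last diagonal no line is crossed before the lattice point, and the pending vertical
    -- or horizontal crossing is the first corner segment.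
    rest [] len π = trans (cong (λ z → (z ++ []) ++ cornerCross s p q) (gap-last c (trans (ℕP.+-comm 1 c) len)))
      (arrival s p q p>0 q>0 x a b l l′ π refl refl refl refl)
    rest (r ∷ ps) len π with stepView x l l′ a b π
    ... | vert v cross π′ rewrite v = begin
      (gap c ++ concatMap g (rng (suc c * D) (suc (length ps) * D))) ++ cornerCross s p q
        ≡⟨ cong (λ z → (z ++ concatMap g (rng (suc c * D) (suc (length ps) * D))) ++ cornerCross s p q)
             (trans (gap-vert btw btw′) (cong (_∷ []) (cross btw btw′))) ⟩
      _ ∷ (concatMap g (rng (suc c * D) (suc (length ps) * D)) ++ cornerCross s p q)
        ≡⟨ cong (_ ∷_) (walk-crossings (nextX x l l′) (suc a) b r ps π′ len′) ⟩
      _ ∷ walk (nextX x l l′) (suc a) b (r ∷ ps) ++ tail ∎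
      where
      len′ : suc (suc a + b) + length (r ∷ ps) ≡ n
      len′ = trans (sym (ℕP.+-suc c (suc (length ps)))) len
      btw′ : Between (suc a) b
      btw′ = cell⇒between (nextX x l l′) (subst (suc (suc a + b) <_) len′ (ℕP.m<m+n _ (s≤s z≤n))) (path-head π′)
    ... | hor v cross π′ rewrite v = begin
      (gap c ++ concatMap g (rng (suc c * D) (suc (length ps) * D))) ++ cornerCross s p q
        ≡⟨ cong (λ z → (z ++ concatMap g (rng (suc c * D) (suc (length ps) * D))) ++ cornerCross s p q)
             (trans (gap-hor btw btw′) (cong (_∷ []) (cross btw btw′))) ⟩
      wc ∷ (concatMap g (rng (suc c * D) (suc (length ps) * D)) ++ cornerCross s p q)
        ≡⟨ cong (λ z → wc ∷ (concatMap g (rng (suc z * D) (suc (length ps) * D)) ++ cornerCross s p q)) (sym (ℕP.+-suc a b)) ⟩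
      wc ∷ (concatMap g (rng (suc (a + suc b) * D) (suc (length ps) * D)) ++ cornerCross s p q)
        ≡⟨ cong (wc ∷_) (walk-crossings (nextX x l l′) a (suc b) r ps π′ len′) ⟩
      wc ∷ walk (nextX x l l′) a (suc b) (r ∷ ps) ++ tail ∎
      where
      wc : Crossing
      wc = (hSeg a b , wNear x l a b false)
      len′ : suc (a + suc b) + length (r ∷ ps) ≡ n
      len′ = trans (cong (λ z → suc z + length (r ∷ ps)) (ℕP.+-suc a b)) (trans (sym (ℕP.+-suc c (suc (length ps)))) len)
      btw′ : Between a (suc b)
      btw′ = cell⇒between (nextX x l l′) (subst (suc (a + suc b) <_) len′ (ℕP.m<m+n _ (s≤s z≤n))) (path-head π′)

  private
    total : ∀ d m → 1 ≤ d → 1 ≤ m → d * m ∸ 1 ≡ (d ∸ 1) + (m ∸ 1) * d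
    total (suc d) (suc m) _ _ = lem d m
      where
      lem : ∀ d m → m + d * suc m ≡ d + m * suc d
      lem = ℕSolver.solve-∀

  crossingSeq-walk : ∀ x r ps → Path (Cell s p q) (cellX x 0) (cellY x 0) (flat (r ∷ ps)) (endX s p q) (endY s p q) →
    1 + length (r ∷ ps) ≡ n → crossingSeq s p q ≡ walk x 0 0 (r ∷ ps) ++ tail
  crossingSeq-walk x r ps π len = begin
    concatMap g (map suc (upTo (D * n ∸ 1))) ++ cornerCross s p q
      ≡⟨ cong (λ z → concatMap g z ++ cornerCross s p q) times ⟩
    concatMap g (rng 1 (D ∸ 1) ++ rng D (k * D)) ++ cornerCross s p q
      ≡⟨ cong (_++ cornerCross s p q) (trans (concatMap-++ g (rng 1 (D ∸ 1)) (rng D (k * D))) (cong (_++ concatMap g (rng D (k * D))) gap-first)) ⟩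
    concatMap g (rng D (k * D)) ++ cornerCross s p q
      ≡⟨ cong (λ z → concatMap g (rng z (k * D)) ++ cornerCross s p q) (sym (ℕP.*-identityˡ D)) ⟩
    concatMap g (rng (1 * D) (k * D)) ++ cornerCross s p q ≡⟨ walk-crossings x 0 0 r ps π len ⟩
    walk x 0 0 (r ∷ ps) ++ tail ∎
    where
    open ≡-Reasoning
    k = length (r ∷ ps)
    times : map suc (upTo (D * n ∸ 1)) ≡ rng 1 (D ∸ 1) ++ rng D (k * D)
    times = begin
      map suc (upTo (D * n ∸ 1)) ≡⟨ ListP.map-applyUpTo id suc (D * n ∸ 1) ⟩
      applyUpTo suc (D * n ∸ 1) ≡⟨ applyUpTo-rng suc 1 (D * n ∸ 1) (λ _ → refl) ⟩
      rng 1 (D * n ∸ 1) ≡⟨ cong (rng 1) (trans (total D n D>0 (ℕP.≤-trans p>0 (ℕP.m≤m+n p q))) (cong (λ z → (D ∸ 1) + (z ∸ 1) * D) (sym len))) ⟩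
      rng 1 ((D ∸ 1) + k * D) ≡⟨ rng-++ 1 (D ∸ 1) (k * D) ⟩
      rng 1 (D ∸ 1) ++ rng (1 + (D ∸ 1)) (k * D) ≡⟨ cong (λ z → rng 1 (D ∸ 1) ++ rng z (k * D)) (ℕP.m+[n∸m]≡n D>0) ⟩
      rng 1 (D ∸ 1) ++ rng D (k * D) ∎

-- Turns of the band graph

eqPt-refl : ∀ v → eqPt v v ≡ true
eqPt-refl (a , b) with a ℤP.≟ a | b ℤP.≟ b
... | yes _ | yes _ = refl
... | yes _ | no ne = ⊥-elim (ne refl)
... | no ne | _ = ⊥-elim (ne refl)

eqPt-≢ : ∀ {u v} → u ≢ v → eqPt u v ≡ false
eqPt-≢ {a , b} {c , d} ne with a ℤP.≟ c | b ℤP.≟ d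
... | yes refl | yes refl = ⊥-elim (ne refl)
... | yes _ | no _ = refl
... | no _ | _ = refl

∈-fst : ∀ v w → (v ∈ˢ (v , w)) ≡ true
∈-fst v w = cong (_∨ eqPt v w) (eqPt-refl v)

∈-snd : ∀ v w → (v ∈ˢ (w , v)) ≡ true
∈-snd v w = trans (cong (eqPt v w ∨_) (eqPt-refl v)) (BoolP.∨-zeroʳ (eqPt v w))

∉ : ∀ v e → v ≢ proj₁ e → v ≢ proj₂ e → (v ∈ˢ e) ≡ false
∉ v (u , w) n m = cong₂ _∨_ (eqPt-≢ {v} {u} n) (eqPt-≢ {v} {w} m)

tileTurns : Seg → List Crossing → Seg → List Bool
tileTurns pr [] nx = []
tileTurns pr ((e , v) ∷ []) nx = (v ∈ˢ pr) ∷ (v ∈ˢ nx) ∷ []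
tileTurns pr ((e , v) ∷ c ∷ cs) nx = (v ∈ˢ pr) ∷ (v ∈ˢ proj₁ c) ∷ tileTurns e (c ∷ cs) nx

tileSteps-turns : ∀ d pr cs nx → tileSteps d (withNeighbours pr cs nx) ≡ stepsFrom d (tileTurns pr cs nx)
tileSteps-turns d pr [] nx = refl
tileSteps-turns d pr ((e , v) ∷ []) nx = refl
tileSteps-turns d pr ((e , v) ∷ c ∷ cs) nx = cong (λ ds → _ ∷ _ ∷ ds) (tileSteps-turns _ e (c ∷ cs) nx)

turn₁ turn₂ turn₃ turn₄ : Bool → Bool → Bool → Bool
turn₁ x l l′ = proj₁ (blockBit x l l′)
turn₂ x l l′ = proj₁ (proj₂ (blockBit x l l′))
turn₃ x l l′ = proj₁ (proj₂ (proj₂ (blockBit x l l′)))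
turn₄ x l l′ = proj₂ (proj₂ (proj₂ (blockBit x l l′)))

module _ (a b : ℕ) where
  d∈w : ∀ x l l′ → (dNear x a b ∈ˢ wSeg (isVert x l l′) a b) ≡ turn₁ x l l′
  d∈w false false l′ = trans (∈-fst (pt a (suc b)) (pt (suc a) (suc b))) (eq l′)
    where
    eq : ∀ l′ → true ≡ turn₁ false false l′
    eq false = refl
    eq true = refl
  d∈w false true false = ∈-fst (pt a (suc b)) (pt (suc a) (suc b))
  d∈w false true true = ∉ (dNear false a b) (vSeg a b) (λ ()) (λ ())
  d∈w true false false = ∉ (dNear true a b) (hSeg a b) (λ ()) (λ ())
  d∈w true false true = ∈-fst (pt (suc a) b) (pt (suc a) (suc b))
  d∈w true true false = ∈-fst (pt (suc a) b) (pt (suc a) (suc b))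
  d∈w true true true = ∈-fst (pt (suc a) b) (pt (suc a) (suc b))

  w∈d : ∀ x l l′ → (wNear x l a b (isVert x l l′) ∈ˢ dSeg a b) ≡ turn₂ x l l′
  w∈d false false false = ∈-snd (pt a (suc b)) (pt (suc a) b)
  w∈d false false true = ∈-snd (pt a (suc b)) (pt (suc a) b)
  w∈d false true false = ∉ (pt (suc a) (suc b)) (dSeg a b) (λ ()) (λ ())
  w∈d false true true = ∉ (pt (suc a) (suc b)) (dSeg a b) (λ ()) (λ ())
  w∈d true false false = ∉ (pt (suc a) (suc b)) (dSeg a b) (λ ()) (λ ())
  w∈d true false true = ∉ (pt (suc a) (suc b)) (dSeg a b) (λ ()) (λ ())
  w∈d true true false = ∈-fst (pt (suc a) b) (pt a (suc b))
  w∈d true true true = ∈-fst (pt (suc a) b) (pt a (suc b))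

  w∈d′ : ∀ x l l′ → let v = isVert x l l′ in (wNear x l a b v ∈ˢ dSeg (nextA v a) (nextB v b)) ≡ turn₃ x l l′
  w∈d′ false false false = ∉ (pt a (suc b)) (dSeg a (suc b)) (λ ()) (λ ())
  w∈d′ false false true = ∉ (pt a (suc b)) (dSeg a (suc b)) (λ ()) (λ ())
  w∈d′ false true false = ∈-fst (pt (suc a) (suc b)) (pt a (suc (suc b)))
  w∈d′ false true true = ∈-snd (pt (suc a) (suc b)) (pt (suc (suc a)) b)
  w∈d′ true false false = ∈-fst (pt (suc a) (suc b)) (pt a (suc (suc b)))
  w∈d′ true false true = ∈-snd (pt (suc a) (suc b)) (pt (suc (suc a)) b)
  w∈d′ true true false = ∉ (pt (suc a) b) (dSeg (suc a) b) (λ ()) (λ ())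
  w∈d′ true true true = ∉ (pt (suc a) b) (dSeg (suc a) b) (λ ()) (λ ())

  d′∈w : ∀ x l l′ → let v = isVert x l l′ in (dNear (nextX x l l′) (nextA v a) (nextB v b) ∈ˢ wSeg v a b) ≡ turn₄ x l l′
  d′∈w false false false = ∉ (dNear false a (suc b)) (hSeg a b) (λ ()) (λ ())
  d′∈w false false true = ∈-snd (pt (suc a) (suc b)) (pt a (suc b))
  d′∈w false true false = ∈-snd (pt (suc a) (suc b)) (pt a (suc b))
  d′∈w false true true = ∈-snd (pt (suc a) (suc b)) (pt (suc a) b)
  d′∈w true false false = ∈-snd (pt (suc a) (suc b)) (pt a (suc b))
  d′∈w true false true = ∈-snd (pt (suc a) (suc b)) (pt (suc a) b)
  d′∈w true true false = ∈-snd (pt (suc a) (suc b)) (pt (suc a) b)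
  d′∈w true true true = ∉ (dNear true (suc a) b) (vSeg a b) (λ ()) (λ ())

finalA finalB : Bool → ℕ → ℕ → Pairs → ℕ
finalA x a b [] = a
finalA x a b ((l , l′) ∷ ps) = let v = isVert x l l′ in finalA (nextX x l l′) (nextA v a) (nextB v b) ps
finalB x a b [] = b
finalB x a b ((l , l′) ∷ ps) = let v = isVert x l l′ in finalB (nextX x l l′) (nextA v a) (nextB v b) ps

module _ (sD sW : Seg) (w : Pt) (nx : Seg) where
  -- The two corner crossings are passed separately because `cornerCross` may list the endpoints of
  -- the diagonal in the opposite order to `dSeg`; only incidence with `sD` is required.
  walk-turns : ∀ x a b ps pr → let x̂ = abscissa x ps ; â = finalA x a b ps ; b̂ = finalB x a b ps in
    (∀ u → (u ∈ˢ sD) ≡ (u ∈ˢ dSeg â b̂)) →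
    tileTurns pr (walk x a b ps ++ (sD , dNear x̂ â b̂) ∷ (sW , w) ∷ []) nx ≡
    turns (dNear x a b ∈ˢ pr) x ps ++
      lastTurn (dNear x a b ∈ˢ pr) x ps ∷ (dNear x̂ â b̂ ∈ˢ sW) ∷ (w ∈ˢ sD) ∷ (w ∈ˢ nx) ∷ []
  walk-turns x a b [] pr h = refl
  walk-turns x a b ((l , l′) ∷ ps) pr h = cong ((dNear x a b ∈ˢ pr) ∷_) (cong₂ _∷_ (d∈w a b x l l′)
    (onCrossing ps h (walk-turns (nextX x l l′) (nextA v a) (nextB v b) ps (wSeg v a b) h)))
    where
    v = isVert x l l′
    x′ = nextX x l l′
    a′ = nextA v a
    b′ = nextB v b
    t′ = dNear x′ a′ b′ ∈ˢ wSeg v a b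
    onCrossing : ∀ ps → let x̂ = abscissa x′ ps ; â = finalA x′ a′ b′ ps ; b̂ = finalB x′ a′ b′ ps
                            rest = (sD , dNear x̂ â b̂) ∷ (sW , w) ∷ []
                            end = (dNear x̂ â b̂ ∈ˢ sW) ∷ (w ∈ˢ sD) ∷ (w ∈ˢ nx) ∷ [] in
      (∀ u → (u ∈ˢ sD) ≡ (u ∈ˢ dSeg â b̂)) →
      tileTurns (wSeg v a b) (walk x′ a′ b′ ps ++ rest) nx ≡ turns t′ x′ ps ++ lastTurn t′ x′ ps ∷ end →
      tileTurns (dSeg a b) ((wSeg v a b , wNear x l a b v) ∷ walk x′ a′ b′ ps ++ rest) nx ≡
      turn₂ x l l′ ∷ turn₃ x l l′ ∷ turns (turn₄ x l l′) x′ ps ++ lastTurn (turn₄ x l l′) x′ ps ∷ end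
    onCrossing [] h ih = cong₂ _∷_ (w∈d a b x l l′) (cong₂ _∷_ (trans (h (wNear x l a b v)) (w∈d′ a b x l l′))
      (trans ih (cong (λ t → t ∷ (dNear x′ a′ b′ ∈ˢ sW) ∷ (w ∈ˢ sD) ∷ (w ∈ˢ nx) ∷ []) (d′∈w a b x l l′))))
    onCrossing (r ∷ ps) h ih = cong₂ _∷_ (w∈d a b x l l′) (cong₂ _∷_ (w∈d′ a b x l l′)
      (trans ih (cong (λ t → turns t x′ (r ∷ ps) ++ lastTurn t x′ (r ∷ ps) ∷ end) (d′∈w a b x l l′))))
      where
      end : List Bool
      end = (dNear (abscissa x′ (r ∷ ps)) (finalA x′ a′ b′ (r ∷ ps)) (finalB x′ a′ b′ (r ∷ ps)) ∈ˢ sW) ∷ (w ∈ˢ sD) ∷ (w ∈ˢ nx) ∷ []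

turns-++ : ∀ t x ps l l′ → let y = abscissa x ps in
  turns t x (ps ++ (l , l′) ∷ []) ≡ turns t x ps ++ lastTurn t x ps ∷ turn₁ y l l′ ∷ turn₂ y l l′ ∷ turn₃ y l l′ ∷ []
turns-++ t x [] l l′ = refl
turns-++ t x ((m , m′) ∷ ps) l l′ = cong (λ z → t ∷ turn₁ x m m′ ∷ turn₂ x m m′ ∷ turn₃ x m m′ ∷ z) (turns-++ (turn₄ x m m′) (nextX x m m′) ps l l′)

lastTurn-++ : ∀ t x ps l l′ → lastTurn t x (ps ++ (l , l′) ∷ []) ≡ turn₄ (abscissa x ps) l l′
lastTurn-++ t x [] l l′ = refl
lastTurn-++ t x ((m , m′) ∷ ps) l l′ = lastTurn-++ (turn₄ x m m′) (nextX x m m′) ps l l′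

cell-injective : ∀ x y {a b c d} → cellX x a ≡ cellX y c → cellY x b ≡ cellY y d → x ≡ y × a ≡ c × b ≡ d
cell-injective false false e f = refl , double-injective _ _ e , double-injective _ _ (ℕP.suc-injective f)
cell-injective false true e f = ⊥-elim (double-parity _ _ e)
cell-injective true false e f = ⊥-elim (double-parity _ _ (sym e))
cell-injective true true e f = refl , double-injective _ _ (ℕP.suc-injective e) , double-injective _ _ f

final-cell : ∀ s p q → 1 ≤ p → 1 ≤ q → Coprime p q → ∀ x a b ps {X Y} → Path (Cell s p q) (cellX x a) (cellY x b) (flat ps) X Y →
  cellX (abscissa x ps) (finalA x a b ps) ≡ X × cellY (abscissa x ps) (finalB x a b ps) ≡ Y
final-cell s p q p>0 q>0 cop x a b [] (nil _) = refl , refl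
final-cell s p q p>0 q>0 cop x a b ((l , l′) ∷ ps) π with CrossingSequence.stepView s p q p>0 q>0 cop x l l′ a b π
... | CrossingSequence.vert v _ π′ rewrite v = final-cell s p q p>0 q>0 cop (nextX x l l′) (suc a) b ps π′
... | CrossingSequence.hor v _ π′ rewrite v = final-cell s p q p>0 q>0 cop (nextX x l l′) a (suc b) ps π′

lastSeg-++ : ∀ cs c c′ → lastSeg (cs ++ c ∷ c′ ∷ []) ≡ proj₁ c′
lastSeg-++ [] c c′ = refl
lastSeg-++ (d ∷ []) c c′ = refl
lastSeg-++ (d ∷ d′ ∷ cs) c c′ = lastSeg-++ (d′ ∷ cs) c c′

-- the letter leaving the lattice point (q , p)
departure : Side → Bool
departure L = true
departure R = false

endState : Side → ℕ → ℕ → Bool × ℕ × ℕ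
endState R p q = false , q , p ∸ 1
endState L p q = true , q ∸ 1 , p

count-turns : ∀ t x r ps → + goodMatchingCount (bandFromSteps (stepsFrom E (turns t x (r ∷ ps)))) ≡ tr (bitsMat (turns t x (r ∷ ps)))
count-turns t x r ps = on-list (turns t x (r ∷ ps)) refl
  where
  on-list : ∀ bs {b b′ bs′} → bs ≡ b ∷ b′ ∷ bs′ → + goodMatchingCount (bandFromSteps (stepsFrom E bs)) ≡ tr (bitsMat bs)
  on-list _ {b} {b′} {bs′} refl = goodMatchingCount-trace b b′ bs′

abscissa-++ : ∀ x ps l l′ → abscissa x (ps ++ (l , l′) ∷ []) ≡ nextX (abscissa x ps) l l′
abscissa-++ x [] l l′ = refl
abscissa-++ x ((m , m′) ∷ ps) l l′ = abscissa-++ (nextX x m m′) ps l l′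

sub-self : ∀ m → + m ℤ.+ ℤ.- + m ≡ + 0
sub-self m = ℤP.+-inverseʳ (+ m)

suc-sub-self : ∀ m → + suc m ℤ.+ ℤ.- + m ≡ + 1
suc-sub-self m = trans (ℤP.+-assoc (+ 1) (+ m) (ℤ.- + m)) (cong (λ z → + 1 ℤ.+ z) (sub-self m))

previousSeg followingSeg : Side → ℕ → ℕ → Seg
previousSeg s p q = shiftSeg (ℤ.- + q) (ℤ.- + p) (proj₁ (cornerW s p q))
followingSeg s p q = shiftSeg (+ q) (+ p) (dSeg 0 0)

-- Translated back by one period, the last corner segment joins the origin to (1 , 0) on the right
-- side and to (0 , 1) on the left. The turn there is the fourth bit of the closing block.
firstTurn : ∀ s p q x → (dNear x 0 0 ∈ˢ previousSeg s p q) ≡ turn₄ (departure s) (departure s) x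
firstTurn R p q x rewrite sub-self p | sub-self q | suc-sub-self q = eq x
  where
  eq : ∀ x → (dNear x 0 0 ∈ˢ (pt 0 0 , pt 1 0)) ≡ turn₄ false false x
  eq false = refl
  eq true = refl
firstTurn L p q x rewrite sub-self p | sub-self q | suc-sub-self p = eq x
  where
  eq : ∀ x → (dNear x 0 0 ∈ˢ (pt 0 0 , pt 0 1)) ≡ turn₄ true true x
  eq false = refl
  eq true = refl

-- `turn-eq` and `abscissa-eq` say that the period closes up, in the turns and in the parity; these
-- are the hypotheses of `turns-trace`.
record PeriodicTurns (s : Side) (p q : ℕ) (x : Bool) (qs : Pairs) : Set where
  constructor periodicTurns
  field
    t : Bool
    count-eq : + mCirc s p q ≡ tr (bitsMat (turns t x qs))
    turn-eq : lastTurn t x qs ≡ t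
    abscissa-eq : abscissa x qs ≡ x

module _ (s : Side) {p q : ℕ} (p>0 : 1 ≤ p) (q>0 : 1 ≤ q) where
  private
    e = departure s

  corner-near : ∀ {x a b} → x ≡ e × (a , b) ≡ proj₂ (endState s p q) → proj₂ (cornerD s p q) ≡ dNear x a b
  corner-near {x} {a} {b} (refl , eq) = aux s p>0 q>0 eq
    where
    aux : ∀ s {p q} → 1 ≤ p → 1 ≤ q → (a , b) ≡ proj₂ (endState s p q) → proj₂ (cornerD s p q) ≡ dNear (departure s) a b
    aux R {suc p} _ _ refl = refl
    aux L {suc p} {suc q} _ _ refl = refl

  corner-seg : ∀ {a b} → (a , b) ≡ proj₂ (endState s p q) → ∀ u → (u ∈ˢ proj₁ (cornerD s p q)) ≡ (u ∈ˢ dSeg a b)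
  corner-seg {a} {b} eq u = aux s p>0 q>0 eq
    where
    aux : ∀ s {p q} → 1 ≤ p → 1 ≤ q → (a , b) ≡ proj₂ (endState s p q) → (u ∈ˢ proj₁ (cornerD s p q)) ≡ (u ∈ˢ dSeg a b)
    aux R {suc p} {q} _ _ refl = BoolP.∨-comm (eqPt u (pt q (suc p))) (eqPt u (pt (suc q) p))
    aux L {suc p} {suc q} _ _ refl = refl

  corner-turns : let (sD , v) = cornerD s p q ; (sW , w) = cornerW s p q in ∀ x →
    (v ∈ˢ sW) ≡ turn₁ e e x × (w ∈ˢ sD) ≡ turn₂ e e x × (w ∈ˢ followingSeg s p q) ≡ turn₃ e e x
  corner-turns = aux s
    where
    away : (pt q p ∈ˢ followingSeg s p q) ≡ false
    away = ∉ (pt q p) (followingSeg s p q) (λ ()) (λ ())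
    aux : ∀ s x → let (sD , v) = cornerD s p q ; (sW , w) = cornerW s p q ; e = departure s in
      (v ∈ˢ sW) ≡ turn₁ e e x × (w ∈ˢ sD) ≡ turn₂ e e x × (w ∈ˢ followingSeg s p q) ≡ turn₃ e e x
    aux R false = ∈-fst (pt q p) (pt (suc q) p) , ∈-fst (pt q p) (pt (suc q) (p ∸ 1)) , away
    aux R true = ∈-fst (pt q p) (pt (suc q) p) , ∈-fst (pt q p) (pt (suc q) (p ∸ 1)) , away
    aux L false = ∈-fst (pt q p) (pt q (suc p)) , ∈-fst (pt q p) (pt (q ∸ 1) (suc p)) , away
    aux L true = ∈-fst (pt q p) (pt q (suc p)) , ∈-fst (pt q p) (pt (q ∸ 1) (suc p)) , away

  module _ (cop : Coprime p q) (x : Bool) (r : Bool × Bool) (ps : Pairs)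
    (π : Path (Cell s p q) (cellX x 0) (cellY x 0) (flat (r ∷ ps)) (endX s p q) (endY s p q))
    (len : 1 + length (r ∷ ps) ≡ p + q) where
    open CrossingSequence s p q p>0 q>0 cop

    private
      qs : Pairs
      -- The two remaining corner crossings form one more pair: the letter `e` leaves the lattice
      -- point (q , p), and `x` is the letter leading on to the first cell of the next period.
      qs = r ∷ ps ++ (e , x) ∷ []
      t = dNear x 0 0 ∈ˢ previousSeg s p q
      x̂ = abscissa x (r ∷ ps)
      â = finalA x 0 0 (r ∷ ps)
      b̂ = finalB x 0 0 (r ∷ ps)
      sD = proj₁ (cornerD s p q)
      sW = proj₁ (cornerW s p q)
      w = proj₂ (cornerW s p q)
      nx = followingSeg s p q

      arrived : x̂ ≡ e × (â , b̂) ≡ proj₂ (endState s p q)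
      arrived = aux s (final-cell s p q p>0 q>0 cop x 0 0 (r ∷ ps) π)
        where
        aux : ∀ s → cellX x̂ â ≡ endX s p q × cellY x̂ b̂ ≡ endY s p q → x̂ ≡ departure s × (â , b̂) ≡ proj₂ (endState s p q)
        aux R (eX , eY) = let (i , j , k) = cell-injective x̂ false eX eY in i , cong₂ _,_ j k
        aux L (eX , eY) = let (i , j , k) = cell-injective x̂ true eX eY in i , cong₂ _,_ j k

      near-eq : proj₂ (cornerD s p q) ≡ dNear x̂ â b̂
      near-eq = corner-near arrived

    bandGraph-turns : bandGraph s p q ≡ bandFromSteps (stepsFrom E (turns t x qs))
    bandGraph-turns = cong bandFromSteps (begin
      tileSteps E (withNeighbours (shiftSeg (ℤ.- + q) (ℤ.- + p) (lastSeg cs)) cs (shiftSeg (+ q) (+ p) (headSeg cs)))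
        ≡⟨ cong (λ cs → tileSteps E (withNeighbours (shiftSeg (ℤ.- + q) (ℤ.- + p) (lastSeg cs)) cs (shiftSeg (+ q) (+ p) (headSeg cs)))) (crossingSeq-walk x r ps π len) ⟩
      tileSteps E (withNeighbours (shiftSeg (ℤ.- + q) (ℤ.- + p) (lastSeg ws)) ws nx)
        ≡⟨ cong (λ z → tileSteps E (withNeighbours (shiftSeg (ℤ.- + q) (ℤ.- + p) z) ws nx)) (lastSeg-++ (walk x 0 0 (r ∷ ps)) (cornerD s p q) (cornerW s p q)) ⟩
      tileSteps E (withNeighbours (previousSeg s p q) ws nx) ≡⟨ tileSteps-turns E (previousSeg s p q) ws nx ⟩
      stepsFrom E (tileTurns (previousSeg s p q) ws nx)
        ≡⟨ cong (λ v → stepsFrom E (tileTurns (previousSeg s p q) (walk x 0 0 (r ∷ ps) ++ (sD , v) ∷ (sW , w) ∷ []) nx)) near-eq ⟩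
      stepsFrom E (tileTurns (previousSeg s p q) (walk x 0 0 (r ∷ ps) ++ (sD , dNear x̂ â b̂) ∷ (sW , w) ∷ []) nx)
        ≡⟨ cong (stepsFrom E) (walk-turns sD sW w nx x 0 0 (r ∷ ps) (previousSeg s p q) (corner-seg (proj₂ arrived))) ⟩
      stepsFrom E (turns t x (r ∷ ps) ++ lastTurn t x (r ∷ ps) ∷ (dNear x̂ â b̂ ∈ˢ sW) ∷ (w ∈ˢ sD) ∷ (w ∈ˢ nx) ∷ [])
        ≡⟨ cong (λ z → stepsFrom E (turns t x (r ∷ ps) ++ lastTurn t x (r ∷ ps) ∷ z)) last-three ⟩
      stepsFrom E (turns t x (r ∷ ps) ++ lastTurn t x (r ∷ ps) ∷ turn₁ x̂ e x ∷ turn₂ x̂ e x ∷ turn₃ x̂ e x ∷ [])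
        ≡⟨ cong (stepsFrom E) (sym (turns-++ t x (r ∷ ps) e x)) ⟩
      stepsFrom E (turns t x qs) ∎)
      where
      open ≡-Reasoning
      cs = crossingSeq s p q
      ws = walk x 0 0 (r ∷ ps) ++ cornerD s p q ∷ cornerW s p q ∷ []
      last-three : (dNear x̂ â b̂ ∈ˢ sW) ∷ (w ∈ˢ sD) ∷ (w ∈ˢ nx) ∷ [] ≡ turn₁ x̂ e x ∷ turn₂ x̂ e x ∷ turn₃ x̂ e x ∷ []
      last-three = let (i , j , k) = corner-turns x in
        trans (cong₂ _∷_ (trans (cong (_∈ˢ sW) (sym near-eq)) i) (cong₂ _∷_ j (cong₂ _∷_ k refl)))
              (cong (λ y → turn₁ y e x ∷ turn₂ y e x ∷ turn₃ y e x ∷ []) (sym (proj₁ arrived)))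

    turns-periodic : lastTurn t x qs ≡ t
    turns-periodic = trans (lastTurn-++ t x (r ∷ ps) e x)
      (trans (cong (λ y → turn₄ y e x) (proj₁ arrived)) (sym (firstTurn s p q x)))

    abscissa-periodic : abscissa x qs ≡ x
    abscissa-periodic = trans (abscissa-++ x (r ∷ ps) e x) (trans (cong (λ y → nextX y e x) (proj₁ arrived)) (cong (_xor x) (BoolP.xor-same e)))

    mCirc-periodicTurns : PeriodicTurns s p q x (r ∷ ps ++ (e , x) ∷ [])
    mCirc-periodicTurns = periodicTurns t (trans (cong (λ B → + goodMatchingCount B) bandGraph-turns) (count-turns t x r (ps ++ (e , x) ∷ [])))
      turns-periodic abscissa-periodic

-- Matching counts as traces of closed words

flat-++ : ∀ ps qs → flat (ps ++ qs) ≡ flat ps ++ flat qs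
flat-++ [] qs = refl
flat-++ ((l , l′) ∷ ps) qs = cong (λ w → l ∷ l′ ∷ w) (flat-++ ps qs)

flat-complement : ∀ ps → flat (complement ps) ≡ map not (flat ps)
flat-complement [] = refl
flat-complement ((l , l′) ∷ ps) = cong (λ w → not l ∷ not l′ ∷ w) (flat-complement ps)

pair-up : ∀ k w → length w ≡ double k → Σ[ ps ∈ Pairs ] flat ps ≡ w × length ps ≡ k
pair-up zero [] _ = [] , refl , refl
pair-up (suc k) (l ∷ l′ ∷ w) eq =
  let (ps , e , f) = pair-up k w (ℕP.suc-injective (ℕP.suc-injective eq)) in (l , l′) ∷ ps , cong (λ w → l ∷ l′ ∷ w) e , cong suc f

lastTurn-complement : ∀ t x ps → lastTurn t (not x) (complement ps) ≡ lastTurn t x ps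
lastTurn-complement t x [] = refl
lastTurn-complement t x ((l , l′) ∷ ps) = onBlock x l l′
  where
  onBlock : ∀ x l l′ → lastTurn t (not x) ((not l , not l′) ∷ complement ps) ≡ lastTurn t x ((l , l′) ∷ ps)
  onBlock false false false = lastTurn-complement _ _ ps
  onBlock false false true = lastTurn-complement _ _ ps
  onBlock false true false = lastTurn-complement _ _ ps
  onBlock false true true = lastTurn-complement _ _ ps
  onBlock true false false = lastTurn-complement _ _ ps
  onBlock true false true = lastTurn-complement _ _ ps
  onBlock true true false = lastTurn-complement _ _ ps
  onBlock true true true = lastTurn-complement _ _ ps

abscissa-complement : ∀ x ps → abscissa (not x) (complement ps) ≡ not (abscissa x ps)
abscissa-complement x [] = refl
abscissa-complement x ((l , l′) ∷ ps) = trans (cong (λ y → abscissa y (complement ps)) (flip x l l′)) (abscissa-complement (nextX x l l′) ps)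
  where
  flip : ∀ x l l′ → nextX (not x) (not l) (not l′) ≡ not (nextX x l l′)
  flip false false false = refl
  flip false false true = refl
  flip false true false = refl
  flip false true true = refl
  flip true false false = refl
  flip true false true = refl
  flip true true false = refl
  flip true true true = refl

inside-period : ∀ p q {u v} → Inside p q u v → Inside p q (u + q) (v + p)
inside-period p q {u} {v} (l , h) =
  subst₂ _≤_ (e₁ p q u) (e₂ p q v) (ℕP.+-monoˡ-≤ (p * q) l) ,
  subst₂ _<_ (e₂ p q v) (e₃ p q u) (ℕP.+-monoˡ-< (p * q) h)
  where
  e₁ : ∀ p q u → p * u + p * q ≡ p * (u + q)
  e₁ = ℕSolver.solve-∀
  e₂ : ∀ p q v → q * v + p * q ≡ q * (v + p)
  e₂ = ℕSolver.solve-∀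
  e₃ : ∀ p q u → p * u + (p + q) + p * q ≡ p * (u + q) + (p + q)
  e₃ = ℕSolver.solve-∀

-- A first step to the right would fall below the line because p > 0, so the word starts with up,
-- and the second letter selects the half of the first diagonal.
first-letters : ∀ {p q w X Y} → 1 ≤ p → Path (Inside p q) 0 0 w X Y → 2 ≤ Y →
  Σ[ l ∈ Bool ] Σ[ w′ ∈ Word ] w ≡ false ∷ l ∷ w′ × Path (Inside p q) (cellX l 0) (suc (cellY l 0)) w′ X Y
first-letters p>0 (up _ (up _ π)) h = false , _ , refl , π
first-letters p>0 (up _ (right _ π)) h = true , _ , refl , π
first-letters p>0 (up _ (nil _)) (s≤s ())
first-letters {p} {q} p>0 (right _ π) h = ⊥-elim (ℕP.<⇒≱ (subst (0 <_) (sym (ℕP.*-identityʳ p)) p>0) (subst (p * 1 ≤_) (ℕP.*-zeroʳ q) (proj₁ (path-head π))))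

record Loop (p q : ℕ) (w : Word) : Set where
  field
    l : Bool
    r : Bool × Bool
    ps : Pairs
    path : Path (Inside p q) (cellX l 0) (suc (cellY l 0)) (flat (r ∷ ps)) (double q) (double p)
    len : 1 + length (r ∷ ps) ≡ p + q
    trace : tr (hol (false , l) (flat (r ∷ ps ++ (false , l) ∷ []))) ≡ closedTrace w

-- The strip is invariant under translation by (q , p), so the path of w can be repeated. Two copies
-- reach (2q , 2p), which is the lattice point (q , p) in half-lattice units; the first two letters
-- are cut off and reattached at the end.
loop : ∀ {p q w} → 1 ≤ p → 1 ≤ q → SlopePath p q w → Loop p q w
loop {p@(suc p′)} {q} {w} p>0 q>0 π with first-letters p>0 doubled (s≤s (s≤s z≤n))
  where
  doubled : Path (Inside p q) 0 0 (w ++ w) (double q) (double p)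
  doubled = subst₂ (Path (Inside p q) 0 0 (w ++ w)) (sym (double-≡ q)) (sym (double-≡ p))
    (path-++ π (path-shift q p (λ _ _ → inside-period p q) π))
... | l , w′ , eq , π′ with pair-up (p′ + q) w′ length-w′
  where
  length-w : length w ≡ p + q
  length-w = trans (sym (ℕP.+-identityʳ _)) (trans (path-length π) (ℕP.+-comm q p))
  length-w′ : length w′ ≡ double (p′ + q)
  length-w′ = ℕP.suc-injective (ℕP.suc-injective (begin
    suc (suc (length w′)) ≡⟨ cong length (sym eq) ⟩
    length (w ++ w) ≡⟨ ListP.length-++ w ⟩
    length w + length w ≡⟨ sym (double-≡ (length w)) ⟩
    double (length w) ≡⟨ cong double length-w ⟩
    double (p + q) ∎))
    where open ≡-Reasoning
... | [] , _ , f = ⊥-elim (ℕP.<⇒≢ (ℕP.≤-trans q>0 (ℕP.m≤n+m q p′)) f)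
... | r ∷ ps , e , f = record
  { l = l ; r = r ; ps = ps
  ; path = subst (λ w → Path (Inside p q) (cellX l 0) (suc (cellY l 0)) w (double q) (double p)) (sym e) π′
  ; len = cong suc f
  ; trace = begin
      tr (hol (false , l) (flat (r ∷ ps ++ (false , l) ∷ []))) ≡⟨ cong (λ v → tr (hol (false , l) v)) (trans (flat-++ (r ∷ ps) ((false , l) ∷ [])) (cong (_++ false ∷ l ∷ []) e)) ⟩
      tr (hol (false , l) (w′ ++ false ∷ l ∷ [])) ≡⟨ tr-rotate false l w′ (trans (cong parity (sym eq)) (trans (parity-++ w w) (⊕-self (parity w)))) ⟩
      tr (hol 𝟎 (false ∷ l ∷ w′)) ≡⟨ cong (λ v → tr (hol 𝟎 v)) (sym eq) ⟩
      closedTrace w ∎ }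
  where open ≡-Reasoning

inside⇒above : ∀ p q {a b} → q * suc b < p * a + (p + q) → q * b < p * suc a
inside⇒above p q {a} {b} h = ℕP.+-cancelʳ-< q (q * b) (p * suc a) (subst₂ _<_ (e₁ q b) (e₂ p q a) h)
  where
  e₁ : ∀ q b → q * suc b ≡ q * b + q
  e₁ = ℕSolver.solve-∀
  e₂ : ∀ p q a → p * a + (p + q) ≡ p * suc a + q
  e₂ = ℕSolver.solve-∀

periodicTurns-trace : ∀ {s p q x} r ps → PeriodicTurns s p q x (r ∷ ps) → + mCirc s p q ≡ tr (hol (false , x) (flat (r ∷ ps)))
periodicTurns-trace {x = x} r ps (periodicTurns t count-eq turn-eq abscissa-eq) = trans count-eq (turns-trace t x r ps turn-eq abscissa-eq)

periodicTurns-complement : ∀ {s p q x qs qs′} → complement qs ≡ qs′ → PeriodicTurns s p q (not x) qs′ → PeriodicTurns s p q x qs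
periodicTurns-complement {x = x} {qs} refl (periodicTurns t count-eq turn-eq abscissa-eq) = periodicTurns t
  (trans count-eq (cong (λ z → tr (bitsMat z)) (turns-complement t x qs)))
  (trans (sym (lastTurn-complement t x qs)) turn-eq)
  (BoolP.not-injective (trans (sym (abscissa-complement x qs)) abscissa-eq))

mCirc-right : ∀ {p q w} → 1 ≤ p → 1 ≤ q → Coprime p q → SlopePath p q w → + mCirc R p q ≡ closedTrace w
mCirc-right {p@(suc _)} {q} {w} p>0 q>0 cop π =
  trans (periodicTurns-trace r (ps ++ (false , l) ∷ []) (mCirc-periodicTurns R p>0 q>0 cop l r ps cells len)) trace
  where
  open Loop (loop p>0 q>0 π)
  cells : Path (Cell R p q) (cellX l 0) (cellY l 0) (flat (r ∷ ps)) (endX R p q) (endY R p q)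
  cells = path-map (λ _ _ (lo , hi) → lo , inside⇒above p q hi) (path-lower path)

-- `Cell L p q x y` has the same two inequalities as `Cell R q p y x`. The left curve is therefore
-- described by the path of slope q/p reflected in the main diagonal, and the reflection does not
-- change the turns.
mCirc-left : ∀ {p q w} → 1 ≤ p → 1 ≤ q → Coprime p q → SlopePath q p w → + mCirc L p q ≡ closedTrace w
mCirc-left {p} {q@(suc _)} {w} p>0 q>0 cop π = trans
  (periodicTurns-trace r (ps ++ (false , l) ∷ [])
    (periodicTurns-complement compl (mCirc-periodicTurns L p>0 q>0 cop (not l) r′ (complement ps) cells len′)))
  trace
  where
  open Loop (loop q>0 p>0 π)
  r′ : Bool × Bool
  r′ = not (proj₁ r) , not (proj₂ r)
  compl : complement (r ∷ ps ++ (false , l) ∷ []) ≡ r′ ∷ complement ps ++ (true , not l) ∷ []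
  compl = cong (r′ ∷_) (ListP.map-++ _ ps ((false , l) ∷ []))
  len′ : 1 + length (r′ ∷ complement ps) ≡ p + q
  len′ = trans (cong (λ n → suc (suc n)) (ListP.length-map _ ps)) (trans len (ℕP.+-comm q p))
  swapX : ∀ l → cellY l 0 ≡ cellX (not l) 0
  swapX false = refl
  swapX true = refl
  swapY : ∀ l → cellX l 0 ≡ cellY (not l) 0
  swapY false = refl
  swapY true = refl
  cells : Path (Cell L p q) (cellX (not l) 0) (cellY (not l) 0) (flat (r′ ∷ complement ps)) (endX L p q) (endY L p q)
  cells = subst₂ (λ a b → Path (Cell L p q) a b (flat (r′ ∷ complement ps)) (endX L p q) (endY L p q)) (swapX l) (swapY l)
    (subst (λ w → Path (Cell L p q) (cellY l 0) (cellX l 0) w (endX L p q) (endY L p q)) (sym (flat-complement (r ∷ ps)))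
      (path-map (λ _ _ (lo , hi) → inside⇒above q p hi , lo) (path-mirror (path-lower path))))

-- Mutation

open import Data.Fin using (Fin; zero; suc)
open import Data.List.Relation.Unary.Linked using (Linked; _∷_)

Markov : ℕ → ℕ → ℕ → Set
Markov x y z = x * x + y * y + z * z + x * y + x * z + y * z ≡ 6 * x * y * z

exch-comm : ∀ x y → exch x y ≡ exch y x
exch-comm = lem
  where
  lem : ∀ x y → x * x + x * y + y * y ≡ y * y + y * x + x * x
  lem = ℕSolver.solve-∀

markov-rotate : ∀ {x y z} → Markov x y z → Markov z x y
markov-rotate {x} {y} {z} h = trans (l₁ x y z) (trans h (l₂ x y z))
  where
  l₁ : ∀ x y z → z * z + x * x + y * y + z * x + z * y + x * y ≡ x * x + y * y + z * z + x * y + x * z + y * z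
  l₁ = ℕSolver.solve-∀
  l₂ : ∀ x y z → 6 * x * y * z ≡ 6 * z * x * y
  l₂ = ℕSolver.solve-∀

markov-swap : ∀ {x y z} → Markov x y z → Markov y x z
markov-swap {x} {y} {z} h = trans (l₁ x y z) (trans h (l₂ x y z))
  where
  l₁ : ∀ x y z → y * y + x * x + z * z + y * x + y * z + x * z ≡ x * x + y * y + z * z + x * y + x * z + y * z
  l₁ = ℕSolver.solve-∀
  l₂ : ∀ x y z → 6 * x * y * z ≡ 6 * y * x * z
  l₂ = ℕSolver.solve-∀

-- As a quadratic in z the Markov equation has roots with product `exch x y` and sum 6xy - x - y;
-- the sum is written additively to stay in ℕ.
vieta : ∀ {x y z z′} → 1 ≤ z → Markov x y z → z′ * z ≡ exch x y → z′ + z + x + y ≡ 6 * x * y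
vieta {x} {y} {z@(suc _)} {z′} _ mk eq = ℕP.*-cancelʳ-≡ (z′ + z + x + y) (6 * x * y) z (begin
  (z′ + z + x + y) * z ≡⟨ l₁ x y z z′ ⟩
  z′ * z + (z * z + x * z + y * z) ≡⟨ cong (_+ (z * z + x * z + y * z)) eq ⟩
  exch x y + (z * z + x * z + y * z) ≡⟨ l₂ x y z ⟩
  x * x + y * y + z * z + x * y + x * z + y * z ≡⟨ mk ⟩
  6 * x * y * z ∎)
  where
  open ≡-Reasoning
  l₁ : ∀ x y z z′ → (z′ + z + x + y) * z ≡ z′ * z + (z * z + x * z + y * z)
  l₁ = ℕSolver.solve-∀
  l₂ : ∀ x y z → (x * x + x * y + y * y) + (z * z + x * z + y * z) ≡ x * x + y * y + z * z + x * y + x * z + y * z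
  l₂ = ℕSolver.solve-∀

markov-mutate : ∀ {x y z z′} → z′ + z + x + y ≡ 6 * x * y → z′ * z ≡ exch x y → Markov x y z′
markov-mutate {x} {y} {z} {z′} v eq = begin
  x * x + y * y + z′ * z′ + x * y + x * z′ + y * z′ ≡⟨ l₁ x y z′ ⟩
  exch x y + (z′ * z′ + x * z′ + y * z′) ≡⟨ cong (_+ (z′ * z′ + x * z′ + y * z′)) (sym eq) ⟩
  z′ * z + (z′ * z′ + x * z′ + y * z′) ≡⟨ l₂ x y z z′ ⟩
  (z′ + z + x + y) * z′ ≡⟨ cong (_* z′) v ⟩
  6 * x * y * z′ ∎
  where
  open ≡-Reasoning
  l₁ : ∀ x y z → x * x + y * y + z * z + x * y + x * z + y * z ≡ (x * x + x * y + y * y) + (z * z + x * z + y * z)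
  l₁ = ℕSolver.solve-∀
  l₂ : ∀ x y z z′ → z′ * z + (z′ * z′ + x * z′ + y * z′) ≡ (z′ + z + x + y) * z′
  l₂ = ℕSolver.solve-∀

mutate-positive : ∀ {x y z z′} → 1 ≤ x → z′ * z ≡ exch x y → 1 ≤ z′
mutate-positive {suc x} {y} {z} {zero} _ ()
mutate-positive {z′ = suc _} _ _ = s≤s z≤n

traceOf : ℕ → ℤ
traceOf m = + 6 ℤ.* + m ℤ.+ -[1+ 0 ]

traceOf-vieta : ∀ {x y z z′} → z′ + z + x + y ≡ 6 * x * y →
  traceOf x ℤ.* traceOf y ℤ.+ ℤ.- traceOf z ℤ.+ -[1+ 2 ] ≡ traceOf z′
traceOf-vieta {x} {y} {z} {z′} v = trans (l₁ (+ x) (+ y) (+ z)) (trans (cong (λ u → + 6 ℤ.* (u ℤ.+ ℤ.- (+ z ℤ.+ + x ℤ.+ + y)) ℤ.+ -[1+ 0 ]) (sym v′)) (l₂ (+ x) (+ y) (+ z) (+ z′)))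
  where
  v′ : + z′ ℤ.+ + z ℤ.+ + x ℤ.+ + y ≡ + 6 ℤ.* + x ℤ.* + y
  v′ = trans (cong +_ v) (trans (ℤP.pos-* (6 * x) y) (cong (ℤ._* + y) (ℤP.pos-* 6 x)))
  l₁ : ∀ x y z → (+ 6 ℤ.* x ℤ.+ -[1+ 0 ]) ℤ.* (+ 6 ℤ.* y ℤ.+ -[1+ 0 ]) ℤ.+ ℤ.- (+ 6 ℤ.* z ℤ.+ -[1+ 0 ]) ℤ.+ -[1+ 2 ]
    ≡ + 6 ℤ.* (+ 6 ℤ.* x ℤ.* y ℤ.+ ℤ.- (z ℤ.+ x ℤ.+ y)) ℤ.+ -[1+ 0 ]
  l₁ = ℤSolver.solve-∀
  l₂ : ∀ x y z z′ → + 6 ℤ.* ((z′ ℤ.+ z ℤ.+ x ℤ.+ y) ℤ.+ ℤ.- (z ℤ.+ x ℤ.+ y)) ℤ.+ -[1+ 0 ] ≡ + 6 ℤ.* z′ ℤ.+ -[1+ 0 ]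
  l₂ = ℤSolver.solve-∀

-- Word pairs and numbers along the Farey tree

record Words (p₁ q₁ m₁ p₂ q₂ m₂ m : ℕ) : Set where
  field
    {w₁ w₂} : Word
    path₁ : SlopePath p₁ q₁ w₁
    path₂ : SlopePath p₂ q₂ w₂
    pair : WordPair w₁ w₂
    trace₁ : closedTrace w₁ ≡ traceOf m₁
    trace₂ : closedTrace w₂ ≡ traceOf m₂
    trace₁₂ : closedTrace (w₁ ++ w₂) ≡ traceOf m

module _ {p₁ q₁ m₁ p₂ q₂ m₂ m m′ : ℕ} (unimod : p₁ * q₂ ≡ p₂ * q₁ + 1) (W : Words p₁ q₁ m₁ p₂ q₂ m₂ m) where
  open Words W

  words-firstChild : m′ + m₂ + m₁ + m ≡ 6 * m₁ * m → Words p₁ q₁ m₁ (p₁ + p₂) (q₁ + q₂) m m′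
  words-firstChild v = record
    { path₁ = path₁ ; path₂ = slopePath-mediant unimod path₁ path₂ ; pair = wordPairˡ {w₁} {w₂} pair
    ; trace₁ = trace₁ ; trace₂ = trace₁₂
    ; trace₁₂ = trans (closedTraceˡ {w₁} {w₂} pair)
        (trans (cong₂ (λ a b → a ℤ.+ ℤ.- b ℤ.+ -[1+ 2 ]) (cong₂ ℤ._*_ trace₁ trace₁₂) trace₂) (traceOf-vieta {m₁} {m} {m₂} v)) }

  words-secondChild : m′ + m₁ + m₂ + m ≡ 6 * m₂ * m → Words (p₁ + p₂) (q₁ + q₂) m p₂ q₂ m₂ m′
  words-secondChild v = record
    { path₁ = slopePath-mediant unimod path₁ path₂ ; path₂ = path₂ ; pair = wordPairʳ {w₁} {w₂} pair
    ; trace₁ = trace₁₂ ; trace₂ = trace₂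
    ; trace₁₂ = trans (closedTraceʳ {w₁} {w₂} pair)
        (trans (cong₂ (λ a b → a ℤ.+ ℤ.- b ℤ.+ -[1+ 2 ]) (cong₂ ℤ._*_ trace₂ trace₁₂) trace₁) (traceOf-vieta {m₂} {m} {m₁} v)) }

-- `mirrorWords` serves the left curve. Taking reciprocals reverses the order of slopes, so there
-- the two neighbours change places.
record Node (p₁ q₁ m₁ p₂ q₂ m₂ m : ℕ) : Set where
  field
    unimod : p₁ * q₂ ≡ p₂ * q₁ + 1
    markov : Markov m₁ m₂ m
    pos₁ : 1 ≤ m₁
    pos₂ : 1 ≤ m₂
    pos : 1 ≤ m
    words : Words p₁ q₁ m₁ p₂ q₂ m₂ m
    mirrorWords : Words q₂ p₂ m₂ q₁ p₁ m₁ m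

node-init : Node 1 0 1 0 1 1 3
node-init = record { unimod = refl ; markov = refl ; pos₁ = s≤s z≤n ; pos₂ = s≤s z≤n ; pos = s≤s z≤n ; words = ws ; mirrorWords = ws }
  where
  ws : Words 1 0 1 0 1 1 3
  ws = record { path₁ = slopePath-∞ ; path₂ = slopePath-0 ; pair = wordPair-init ; trace₁ = refl ; trace₂ = refl ; trace₁₂ = refl }

det-first : ∀ p₁ q₁ p₂ q₂ → p₁ * q₂ ≡ p₂ * q₁ + 1 → p₁ * (q₁ + q₂) ≡ (p₁ + p₂) * q₁ + 1
det-first p₁ q₁ p₂ q₂ d = trans (ℕP.*-distribˡ-+ p₁ q₁ q₂) (trans (cong (λ z → p₁ * q₁ + z) d) (lem p₁ q₁ p₂))
  where
  lem : ∀ p₁ q₁ p₂ → p₁ * q₁ + (p₂ * q₁ + 1) ≡ (p₁ + p₂) * q₁ + 1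
  lem = ℕSolver.solve-∀

det-second : ∀ p₁ q₁ p₂ q₂ → p₁ * q₂ ≡ p₂ * q₁ + 1 → (p₁ + p₂) * q₂ ≡ p₂ * (q₁ + q₂) + 1
det-second p₁ q₁ p₂ q₂ d = trans (ℕP.*-distribʳ-+ q₂ p₁ p₂) (trans (cong (_+ p₂ * q₂) d) (lem q₁ p₂ q₂))
  where
  lem : ∀ q₁ p₂ q₂ → p₂ * q₁ + 1 + p₂ * q₂ ≡ p₂ * (q₁ + q₂) + 1
  lem = ℕSolver.solve-∀

det-mirror : ∀ p₁ q₁ p₂ q₂ → p₁ * q₂ ≡ p₂ * q₁ + 1 → q₂ * p₁ ≡ q₁ * p₂ + 1
det-mirror p₁ q₁ p₂ q₂ d = trans (ℕP.*-comm q₂ p₁) (trans d (cong (_+ 1) (ℕP.*-comm p₂ q₁)))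

words-cong : ∀ {p₁ q₁ m₁ p₂ q₂ m₂ m p₁′ q₁′ p₂′ q₂′} → p₁ ≡ p₁′ → q₁ ≡ q₁′ → p₂ ≡ p₂′ → q₂ ≡ q₂′ →
  Words p₁ q₁ m₁ p₂ q₂ m₂ m → Words p₁′ q₁′ m₁ p₂′ q₂′ m₂ m
words-cong refl refl refl refl W = W

module _ {p₁ q₁ m₁ p₂ q₂ m₂ m m′ : ℕ} (ν : Node p₁ q₁ m₁ p₂ q₂ m₂ m) where
  open Node ν

  -- The second neighbour is mutated away and the old mediant takes its place. In the mirrored pair
  -- that neighbour stands first, so the other kind of child occurs there.
  node-first : m′ * m₂ ≡ exch m₁ m → Node p₁ q₁ m₁ (p₁ + p₂) (q₁ + q₂) m m′
  node-first eq = record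
    { unimod = det-first p₁ q₁ p₂ q₂ unimod
    ; markov = markov-mutate {m₁} {m} {m₂} v eq
    ; pos₁ = pos₁ ; pos₂ = pos ; pos = mutate-positive {m₁} {m} pos₁ eq
    ; words = words-firstChild unimod words v
    ; mirrorWords = words-cong (ℕP.+-comm q₂ q₁) (ℕP.+-comm p₂ p₁) refl refl
        (words-secondChild (det-mirror p₁ q₁ p₂ q₂ unimod) mirrorWords v) }
    where
    v : m′ + m₂ + m₁ + m ≡ 6 * m₁ * m
    v = vieta {m₁} {m} {m₂} pos₂ (markov-swap {m} {m₁} {m₂} (markov-rotate {m₁} {m₂} {m} markov)) eq

  node-second : m′ * m₁ ≡ exch m₂ m → Node (p₁ + p₂) (q₁ + q₂) m p₂ q₂ m₂ m′
  node-second eq = record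
    { unimod = det-second p₁ q₁ p₂ q₂ unimod
    ; markov = markov-swap {m₂} {m} {m′} (markov-mutate {m₂} {m} {m₁} v eq)
    ; pos₁ = pos ; pos₂ = pos₂ ; pos = mutate-positive {m₂} {m} pos₂ eq
    ; words = words-secondChild unimod words v
    ; mirrorWords = words-cong refl refl (ℕP.+-comm q₂ q₁) (ℕP.+-comm p₂ p₁)
        (words-firstChild (det-mirror p₁ q₁ p₂ q₂ unimod) mirrorWords v) }
    where
    v : m′ + m₁ + m₂ + m ≡ 6 * m₂ * m
    v = vieta {m₂} {m} {m₁} pos₁ (markov-rotate {m} {m₁} {m₂} (markov-rotate {m₁} {m₂} {m} markov)) eq

-- Labelled triples under mutation

data Arrangement : Fin 3 → Fin 3 → Fin 3 → Set where
  a012 : Arrangement zero (suc zero) (suc (suc zero))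
  a021 : Arrangement zero (suc (suc zero)) (suc zero)
  a102 : Arrangement (suc zero) zero (suc (suc zero))
  a120 : Arrangement (suc zero) (suc (suc zero)) zero
  a201 : Arrangement (suc (suc zero)) zero (suc zero)
  a210 : Arrangement (suc (suc zero)) (suc zero) zero

arrangement-cases : ∀ {i j k} → Arrangement i j k → ∀ h → h ≡ i ⊎ h ≡ j ⊎ h ≡ k
arrangement-cases a012 zero = inj₁ refl
arrangement-cases a012 (suc zero) = inj₂ (inj₁ refl)
arrangement-cases a012 (suc (suc zero)) = inj₂ (inj₂ refl)
arrangement-cases a021 zero = inj₁ refl
arrangement-cases a021 (suc zero) = inj₂ (inj₂ refl)
arrangement-cases a021 (suc (suc zero)) = inj₂ (inj₁ refl)
arrangement-cases a102 zero = inj₂ (inj₁ refl)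
arrangement-cases a102 (suc zero) = inj₁ refl
arrangement-cases a102 (suc (suc zero)) = inj₂ (inj₂ refl)
arrangement-cases a120 zero = inj₂ (inj₂ refl)
arrangement-cases a120 (suc zero) = inj₁ refl
arrangement-cases a120 (suc (suc zero)) = inj₂ (inj₁ refl)
arrangement-cases a201 zero = inj₂ (inj₁ refl)
arrangement-cases a201 (suc zero) = inj₂ (inj₂ refl)
arrangement-cases a201 (suc (suc zero)) = inj₁ refl
arrangement-cases a210 zero = inj₂ (inj₂ refl)
arrangement-cases a210 (suc zero) = inj₂ (inj₁ refl)
arrangement-cases a210 (suc (suc zero)) = inj₁ refl

rotate : ∀ {i j k} → Arrangement i j k → Arrangement j i k × Arrangement k j i
rotate a012 = a102 , a210
rotate a021 = a201 , a120
rotate a102 = a012 , a201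
rotate a120 = a210 , a021
rotate a201 = a021 , a102
rotate a210 = a120 , a012

others : ∀ {i j k} → Arrangement i j k → (other₁ i ≡ j × other₂ i ≡ k) ⊎ (other₁ i ≡ k × other₂ i ≡ j)
others a012 = inj₁ (refl , refl)
others a021 = inj₂ (refl , refl)
others a102 = inj₁ (refl , refl)
others a120 = inj₂ (refl , refl)
others a201 = inj₁ (refl , refl)
others a210 = inj₂ (refl , refl)

update-arrangement : ∀ {i j k} → Arrangement i j k → ∀ s v → update s i v i ≡ v × update s i v j ≡ s j × update s i v k ≡ s k
update-arrangement a012 s v = refl , refl , refl
update-arrangement a021 s v = refl , refl , refl
update-arrangement a102 s v = refl , refl , refl
update-arrangement a120 s v = refl , refl , refl
update-arrangement a201 s v = refl , refl , refl
update-arrangement a210 s v = refl , refl , refl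

natLabel : ℕ → ℕ → Label
natLabel p q = (+ p , + q)

-- `i` is the position mutated last and carries the mediant of the other two. A position may not be
-- mutated twice in a row, so the next mutation replaces one of the two parents.
record Triangulated (s : State) (i j k : Fin 3) : Set where
  field
    {p₁ q₁ m₁ p₂ q₂ m₂ m} : ℕ
    arrangement : Arrangement i j k
    mediant : s i ≡ ⟨ natLabel (p₁ + p₂) (q₁ + q₂) , m ⟩
    first : s j ≡ ⟨ natLabel p₁ q₁ , m₁ ⟩
    second : s k ≡ ⟨ natLabel p₂ q₂ , m₂ ⟩
    node : Node p₁ q₁ m₁ p₂ q₂ m₂ m

newLabel-sum : ∀ a b c d e f → e * (b + d) ≢ f * (a + c) → newLabel (natLabel a b) (natLabel c d) (natLabel e f) ≡ natLabel (a + c) (b + d)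
newLabel-sum a b c d e f ne with (+ e ℤ.* + (b + d)) ℤP.≟ (+ f ℤ.* + (a + c))
... | yes eq = ⊥-elim (ne (ℤP.+-injective (trans (ℤP.pos-* e (b + d)) (trans eq (sym (ℤP.pos-* f (a + c)))))))
... | no _ = refl

-- By the last hypothesis the label of i is not the mediant of its neighbours, so `newLabel` adds rather than subtracts.
mutation-result : ∀ {s s′ i j k a b c d e f x y z} → Arrangement i j k → Mutation s i s′ →
  s i ≡ ⟨ natLabel e f , z ⟩ → s j ≡ ⟨ natLabel a b , x ⟩ → s k ≡ ⟨ natLabel c d , y ⟩ → e * (b + d) ≢ f * (a + c) →
  Σ[ z′ ∈ ℕ ] z′ * z ≡ exch x y × s′ i ≡ ⟨ natLabel (a + c) (b + d) , z′ ⟩ × s′ j ≡ s j × s′ k ≡ s k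
mutation-result {s} {i = i} {j} {k} {a} {b} {c} {d} {e} {f} {x} {y} {z} arr (mutate z′ eq) si sj sk ne =
  z′ , trans (cong (λ P → z′ * number P) (sym si)) (trans eq exch-eq) , trans (proj₁ updated) (cong (λ l → ⟨ l , z′ ⟩) label-eq) , proj₁ (proj₂ updated) , proj₂ (proj₂ updated)
  where
  updated = update-arrangement arr s ⟨ newLabel (label (s (other₁ i))) (label (s (other₂ i))) (label (s i)) , z′ ⟩
  exch-eq : exch (number (s (other₁ i))) (number (s (other₂ i))) ≡ exch x y
  exch-eq with others arr
  ... | inj₁ (o₁ , o₂) rewrite o₁ | o₂ | sj | sk = refl
  ... | inj₂ (o₁ , o₂) rewrite o₁ | o₂ | sj | sk = exch-comm y x
  label-eq : newLabel (label (s (other₁ i))) (label (s (other₂ i))) (label (s i)) ≡ natLabel (a + c) (b + d)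
  label-eq with others arr
  ... | inj₁ (o₁ , o₂) rewrite o₁ | o₂ | sj | sk | si = newLabel-sum a b c d e f ne
  ... | inj₂ (o₁ , o₂) rewrite o₁ | o₂ | sj | sk | si =
    trans (newLabel-sum c d a b e f (λ h → ne (trans (cong (e *_) (ℕP.+-comm b d)) (trans h (cong (f *_) (ℕP.+-comm c a))))))
      (cong₂ natLabel (ℕP.+-comm c a) (ℕP.+-comm d b))

-- The neighbours of the label p₁/q₁ are p₂/q₂ and the mediant, with sum (p₁ + 2p₂)/(q₁ + 2q₂). Its
-- determinant against p₁/q₁ is 2(p₁q₂ - p₂q₁) = 2, so the two fractions differ.
not-difference : ∀ p₁ q₁ p₂ q₂ → p₁ * q₂ ≡ p₂ * q₁ + 1 → p₁ * (q₁ + q₂ + q₂) ≢ q₁ * (p₁ + p₂ + p₂)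
not-difference p₁ q₁ p₂ q₂ unimod eq = ℕP.m≢1+m+n (p₁ * q₁ + (p₂ * q₁ + p₂ * q₁)) (sym (begin
  suc (p₁ * q₁ + (p₂ * q₁ + p₂ * q₁) + 1) ≡⟨ l₂ (p₁ * q₁) (p₂ * q₁) ⟩
  p₁ * q₁ + ((p₂ * q₁ + 1) + (p₂ * q₁ + 1)) ≡⟨ cong (λ z → p₁ * q₁ + (z + z)) (sym unimod) ⟩
  p₁ * q₁ + (p₁ * q₂ + p₁ * q₂) ≡⟨ l₁ p₁ q₁ q₂ ⟩
  p₁ * (q₁ + q₂ + q₂) ≡⟨ eq ⟩
  q₁ * (p₁ + p₂ + p₂) ≡⟨ l₃ p₁ q₁ p₂ ⟩
  p₁ * q₁ + (p₂ * q₁ + p₂ * q₁) ∎))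
  where
  open ≡-Reasoning
  l₁ : ∀ p₁ q₁ q₂ → p₁ * q₁ + (p₁ * q₂ + p₁ * q₂) ≡ p₁ * (q₁ + q₂ + q₂)
  l₁ = ℕSolver.solve-∀
  l₂ : ∀ a b → suc (a + (b + b) + 1) ≡ a + ((b + 1) + (b + 1))
  l₂ = ℕSolver.solve-∀
  l₃ : ∀ p₁ q₁ p₂ → q₁ * (p₁ + p₂ + p₂) ≡ p₁ * q₁ + (p₂ * q₁ + p₂ * q₁)
  l₃ = ℕSolver.solve-∀

triangulated-mutate : ∀ {s s′ i j k h} → Triangulated s i j k → i ≢ h → Mutation s h s′ → ∃₂ λ j′ k′ → Triangulated s′ h j′ k′
triangulated-mutate {s} {s′} {i} {j} {k} {h} T i≢h μ with arrangement-cases (Triangulated.arrangement T) h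
... | inj₁ refl = ⊥-elim (i≢h refl)
... | inj₂ (inj₁ refl) =
  let open Triangulated T
      arr = proj₁ (rotate arrangement)
      (z′ , eq , sh , si , sk) = mutation-result arr μ first mediant second (not-difference p₁ q₁ p₂ q₂ (Node.unimod node))
  in i , k , record { arrangement = arr ; mediant = sh ; first = trans si mediant ; second = trans sk second
                    ; node = node-second node (trans eq (exch-comm m m₂)) }
... | inj₂ (inj₂ refl) =
  let open Triangulated T
      arr = proj₂ (rotate arrangement)
      (z′ , eq , sh , sj , si) = mutation-result arr μ second first mediant (nd p₁ q₁ p₂ q₂ (Node.unimod node))
  in j , i , record { arrangement = arr ; mediant = sh ; first = trans sj first ; second = trans si mediant
                    ; node = node-first node eq }
  where
  nd : ∀ p₁ q₁ p₂ q₂ → p₁ * q₂ ≡ p₂ * q₁ + 1 → p₂ * (q₁ + (q₁ + q₂)) ≢ q₂ * (p₁ + (p₁ + p₂))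
  nd p₁ q₁ p₂ q₂ unimod eq = not-difference q₂ p₂ q₁ p₁ (det-mirror p₁ q₁ p₂ q₂ unimod)
    (trans (cong (q₂ *_) (flip p₁ p₂)) (trans (sym eq) (cong (p₂ *_) (sym (flip q₁ q₂)))))
    where
    flip : ∀ a b → b + a + a ≡ a + (a + b)
    flip = ℕSolver.solve-∀

triangulated-run : ∀ {s is s′ i j k} → Triangulated s i j k → Linked _≢_ (i ∷ is) → Run s is s′ →
  ∃ λ i′ → ∃₂ λ j′ k′ → Triangulated s′ i′ j′ k′
triangulated-run T _ done = _ , _ , _ , T
triangulated-run T (i≢h ∷ linked) (step μ run) = triangulated-run (proj₂ (proj₂ (triangulated-mutate T i≢h μ))) linked run

-- The first mutation removes the one label with a negative numerator and gives 1/1 with the number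
-- 1 + 1 + 1 = 3. From then on all labels are pairs of natural numbers.
triangulated-init : ∀ {s} → Mutation initState pos-11 s → Triangulated s pos-11 pos10 pos01
triangulated-init (mutate z′ eq) = record
  { arrangement = a210 ; mediant = cong (λ z → ⟨ natLabel 1 1 , z ⟩) (trans (sym (ℕP.*-identityʳ z′)) eq)
  ; first = refl ; second = refl ; node = node-init }

triangulated : ∀ {is s} → Admissible is → Run initState is s → ∃ λ i → ∃₂ λ j k → Triangulated s i j k
triangulated ((_ , refl) , linked) (step μ run) = triangulated-run (triangulated-init μ) linked run

record Slope (p q m : ℕ) : Set where
  field
    {w w′} : Word
    coprime : Coprime p q
    positive : 1 ≤ m
    path : SlopePath p q w
    trace : closedTrace w ≡ traceOf m
    mirrorPath : SlopePath q p w′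
    mirrorTrace : closedTrace w′ ≡ traceOf m

coprime-of-det : ∀ p q {r s} → p * s ≡ r * q + 1 → Coprime p q
coprime-of-det p q {r} {s} unimod {d} (d∣p , d∣q) = Div.∣1⇒≡1 (Div.∣m+n∣m⇒∣n (subst (d ∣_) unimod (Div.∣m⇒∣m*n s d∣p)) (Div.∣n⇒∣m*n r d∣q))

slope-at : ∀ {s i j k} → Triangulated s i j k → ∀ h → ∃₂ λ p q → ∃ λ m → s h ≡ ⟨ natLabel p q , m ⟩ × Slope p q m
slope-at T h with arrangement-cases (Triangulated.arrangement T) h
... | inj₁ refl = _ , _ , _ , mediant , record
  { coprime = coprime-of-det (p₁ + p₂) (q₁ + q₂) {p₂} {q₂} (det-second p₁ q₁ p₂ q₂ unimod)
  ; positive = pos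
  ; path = slopePath-mediant unimod (Words.path₁ words) (Words.path₂ words)
  ; trace = Words.trace₁₂ words
  ; mirrorPath = subst₂ (λ a b → SlopePath a b (Words.w₁ mirrorWords ++ Words.w₂ mirrorWords)) (ℕP.+-comm q₂ q₁) (ℕP.+-comm p₂ p₁)
      (slopePath-mediant (det-mirror p₁ q₁ p₂ q₂ unimod) (Words.path₁ mirrorWords) (Words.path₂ mirrorWords))
  ; mirrorTrace = Words.trace₁₂ mirrorWords }
  where
  open Triangulated T
  open Node node
... | inj₂ (inj₁ refl) = _ , _ , _ , first , record
  { coprime = coprime-of-det p₁ q₁ {p₂} {q₂} unimod
  ; positive = pos₁
  ; path = Words.path₁ words ; trace = Words.trace₁ words
  ; mirrorPath = Words.path₂ mirrorWords ; mirrorTrace = Words.trace₂ mirrorWords }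
  where
  open Triangulated T
  open Node node
... | inj₂ (inj₂ refl) = _ , _ , _ , second , record
  { coprime = Coprimality.sym (coprime-of-det q₂ p₂ {q₁} {p₁} (det-mirror p₁ q₁ p₂ q₂ unimod))
  ; positive = pos₂
  ; path = Words.path₂ words ; trace = Words.trace₂ words
  ; mirrorPath = Words.path₁ mirrorWords ; mirrorTrace = Words.trace₁ mirrorWords }
  where
  open Triangulated T
  open Node node

-- `LabelIs` compares labels only as fractions; coprimality of the stored label identifies numerator
-- and denominator.
reduced-unique : ∀ {a b p q} → Coprime a b → Coprime p q → a * q ≡ b * p → a ≡ p × b ≡ q
reduced-unique {a} {b} {p} {q} ab pq eq =
  Div.∣-antisym (Coprimality.coprime-divisor ab (divides q (trans (sym eq) (ℕP.*-comm a q))))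
                (Coprimality.coprime-divisor pq (divides b (trans (ℕP.*-comm q a) eq))) ,
  Div.∣-antisym (Coprimality.coprime-divisor (Coprimality.sym ab) (divides p (trans eq (ℕP.*-comm b p))))
                (Coprimality.coprime-divisor (Coprimality.sym pq) (divides a (trans (ℕP.*-comm p b) (sym eq))))

-- Positivity of m ensures that the truncated subtraction agrees with the integer one.
traceOf-ℕ : ∀ {x m} → 1 ≤ m → + x ≡ traceOf m → x ≡ 6 * m ∸ 1
traceOf-ℕ {x} {suc m} _ eq = ℤP.+-injective (trans eq (cong (ℤ._+ -[1+ 0 ]) (sym (ℤP.pos-* 6 (suc m)))))

theorem5p5 : ∀ (p q : ℕ) → 1 ≤ p → p ≤ q → gcd p q ≡ 1 →
    ∀ (m : ℕ) → IsGenMarkov p q m →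
    (mCirc L p q ≡ 6 * m ∸ 1) × (mCirc R p q ≡ 6 * m ∸ 1)
theorem5p5 p q p>0 p≤q gcd≡1 m (is , s , i , adm , run , (label-eq , _) , num) with slope-at (proj₂ (proj₂ (proj₂ (triangulated adm run)))) i
... | a , b , m′ , si , S = conclude (proj₁ ab) (proj₂ ab) (trans (cong number (sym si)) num)
  where
  pq : Coprime p q
  pq = Coprimality.gcd≡1⇒coprime gcd≡1
  q>0 : 1 ≤ q
  q>0 = ℕP.≤-trans p>0 p≤q
  ab : a ≡ p × b ≡ q
  ab = reduced-unique (Slope.coprime S) pq (ℤP.+-injective (begin
    + (a * q) ≡⟨ ℤP.pos-* a q ⟩
    + a ℤ.* + q ≡⟨ cong (λ P → proj₁ (label P) ℤ.* + q) (sym si) ⟩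
    proj₁ (label (s i)) ℤ.* + q ≡⟨ label-eq ⟩
    proj₂ (label (s i)) ℤ.* + p ≡⟨ cong (λ P → proj₂ (label P) ℤ.* + p) si ⟩
    + b ℤ.* + p ≡⟨ sym (ℤP.pos-* b p) ⟩
    + (b * p) ∎))
    where open ≡-Reasoning
  conclude : a ≡ p → b ≡ q → m′ ≡ m → (mCirc L p q ≡ 6 * m ∸ 1) × (mCirc R p q ≡ 6 * m ∸ 1)
  conclude refl refl refl =
    traceOf-ℕ positive (trans (mCirc-left p>0 q>0 pq mirrorPath) mirrorTrace) ,
    traceOf-ℕ positive (trans (mCirc-right p>0 q>0 pq path) trace)
    where open Slope S
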